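{- Let $G$ be a finite simple graph with $n=|V(G)|$ vertices and let $\lambda\vdash n$ be an integer partition. Then the coefficient of the Schur function $s_\lambda$ in the Schur expansion of the chromatic symmetric function $X_G$ is \[ [s_\lambda]X_G=\sum_{T\in\mathcal{T}(\lambda)}(-1)^{|W(T)|}\,\pi(T)^!\,N_G(T), \] i.e. $X_G=\sum_{\lambda\vdash n}\Big(\sum_{T\in\mathcal{T}(\lambda)}(-1)^{|W(T)|}\,\pi(T)^!\,N_G(T)\Big)s_\lambda$.
   Context: The chromatic symmetric function of a graph $G$ is $X_G=\sum_{\kappa}\prod_{v\in V(G)}x_{\kappa(v)}$, summed over all proper colorings $\kappa:V(G)\to\{1,2,\dots\}$. A stable partition of $G$ is a set partition of $V(G)$ into stable (independent) sets; its type is the integer partition formed by the block sizes. For an integer partition $\pi=1^{m_1}2^{m_2}\cdots$ (with $m_i$ the multiplicity of $i$), $\pi^!=\prod_{i\ge1}m_i!$. Young diagrams are drawn in French notation: row $i$ (counted from bottom to top) has $\lambda_i$ left-justified cells. A rim hook is a sequence of edge-connected cells along the northeast boundary of a Young diagram whose removal leaves the Young diagram of a smaller partition. For a composition $\mu=(\mu_1,\dots,\mu_l)$ of $n$, a rim hook tableau of shape $\lambda$ and content $\mu$ is a filling of the diagram of $\lambda$ by rim hooks of lengths $\mu_l,\mu_{l-1},\dots$ labeled $1,2,\dots$, such that for every $i$ removing the last $i$ rim hooks leaves the Young diagram of a partition. A rim hook tabloid is such a tableau with labels removed; it is special if every rim hook intersects the first column. $\mathcal{T}(\lambda)$ denotes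 the set of special rim hook tabloids of shape $\lambda$. For $T\in\mathcal{T}(\lambda)$: $\pi(T)$ is the integer partition whose parts are the lengths of the rim hooks of $T$; $W(T)$ is the set of rim hooks of $T$ that span an even number of rows (so $|W(T)|$ is their number); $N_G(T)$ is the number of stable partitions of $G$ whose type is $\pi(T)$. -}

module Defs where

-- Conventions: everything finite is handled by explicit, duplicate-free
-- enumeration into lists, and counting is done with Boolean tests.

open import Data.Nat using (ℕ; zero; suc; _+_; _*_; _∸_; _≤ᵇ_; _≡ᵇ_; _<ᵇ_; _!)
open import Data.Bool using (Bool; true; false; _∧_; _∨_; not; if_then_else_)
open import Data.List using (List; []; _∷_; map; concatMap; upTo; allFin; foldr; length; filter)
open import Data.Nat.ListAction using (sum; product)
open import Data.Fin using (Fin; zero; suc; toℕ)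
open import Data.Vec using (Vec; []; _∷_; lookup)
open import Data.Integer as ℤ using (ℤ; +_)
open import Relation.Binary.PropositionalEquality using (_≡_)

allᵇ : {A : Set} → (A → Bool) → List A → Bool
allᵇ p []       = true
allᵇ p (x ∷ xs) = p x ∧ allᵇ p xs

countᵇ : {A : Set} → (A → Bool) → List A → ℕ
countᵇ p []       = 0
countᵇ p (x ∷ xs) = (if p x then 1 else 0) + countᵇ p xs

sumℤ : List ℤ → ℤ
sumℤ = foldr ℤ._+_ (+ 0)

listsOfLen : {A : Set} → ℕ → List A → List (List A)
listsOfLen zero    xs = [] ∷ []
listsOfLen (suc k) xs = concatMap (λ x → map (x ∷_) (listsOfLen k xs)) xs

sublists : {A : Set} → List A → List (List A)
sublists []       = [] ∷ []
sublists (x ∷ xs) = let r = sublists xs in map (x ∷_) r Data.List.++ r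

record SimpleGraph (n : ℕ) : Set where
  field
    Adj    : Fin n → Fin n → Bool
    symm   : ∀ u v → Adj u v ≡ Adj v u
    irrefl : ∀ v → Adj v v ≡ false
open SimpleGraph public

_==ᶠ_ : {N : ℕ} → Fin N → Fin N → Bool
i ==ᶠ j = toℕ i ≡ᵇ toℕ j

consF : {n N : ℕ} → Fin N → (Fin n → Fin N) → Fin (suc n) → Fin N
consF c f zero    = c
consF c f (suc i) = f i

allFuns : (n N : ℕ) → List (Fin n → Fin N)
allFuns zero    N = (λ ()) ∷ []
allFuns (suc n) N = concatMap (λ c → map (consF c) (allFuns n N)) (allFin N)

-- Chromatic symmetric function, in N variables x_0 … x_{N-1}.
-- Coefficient of the monomial x^α (α : Fin N → ℕ) in X_G(x_0,…,x_{N-1},0,0,…):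
-- the number of proper colourings κ : V → Fin N with |κ⁻¹(i)| = α i.

properᵇ : {n N : ℕ} → SimpleGraph n → (Fin n → Fin N) → Bool
properᵇ {n} G κ =
  allᵇ (λ u → allᵇ (λ v → not (Adj G u v ∧ (κ u ==ᶠ κ v))) (allFin n)) (allFin n)

hasContentᵇ : {n N : ℕ} → (Fin n → Fin N) → (Fin N → ℕ) → Bool
hasContentᵇ {n} {N} κ α =
  allᵇ (λ i → countᵇ (λ v → κ v ==ᶠ i) (allFin n) ≡ᵇ α i) (allFin N)

chromCoeff : {n : ℕ} → SimpleGraph n → (N : ℕ) → (Fin N → ℕ) → ℕ
chromCoeff {n} G N α =
  countᵇ (λ κ → properᵇ G κ ∧ hasContentᵇ κ α) (allFuns n N)

-- Integer partitions: lists λ₁ ≥ λ₂ ≥ … ≥ λ_ℓ > 0 (λ₁ = bottom row).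

decreasingᵇ : List ℕ → Bool
decreasingᵇ []           = true
decreasingᵇ (a ∷ [])     = true
decreasingᵇ (a ∷ b ∷ xs) = (b ≤ᵇ a) ∧ decreasingᵇ (b ∷ xs)

isPartitionOfᵇ : ℕ → List ℕ → Bool
isPartitionOfᵇ n xs = decreasingᵇ xs ∧ allᵇ (λ a → 1 ≤ᵇ a) xs ∧ (sum xs ≡ᵇ n)

partitionsOf : ℕ → List (List ℕ)
partitionsOf n =
  filter (λ xs → Data.Bool._≟_ (isPartitionOfᵇ n xs) true)
    (concatMap (λ k → listsOfLen k (upTo (suc n))) (upTo (suc n)))

-- Schur functions in N variables via semistandard Young tableaux.
-- A filling of shape λ is a list of rows (bottom row first), row i has λ_i
-- entries from Fin N.

fillings : List ℕ → (N : ℕ) → List (List (List (Fin N)))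
fillings []       N = [] ∷ []
fillings (l ∷ ls) N =
  concatMap (λ r → map (r ∷_) (fillings ls N)) (listsOfLen l (allFin N))

rowWeakᵇ : {N : ℕ} → List (Fin N) → Bool
rowWeakᵇ []           = true
rowWeakᵇ (a ∷ [])     = true
rowWeakᵇ (a ∷ b ∷ xs) = (toℕ a ≤ᵇ toℕ b) ∧ rowWeakᵇ (b ∷ xs)

colStrictᵇ : {N : ℕ} → List (Fin N) → List (Fin N) → Bool
colStrictᵇ lower       []          = true
colStrictᵇ []          (b ∷ bs)    = false
colStrictᵇ (a ∷ as)    (b ∷ bs)    = (toℕ a <ᵇ toℕ b) ∧ colStrictᵇ as bs

colsStrictᵇ : {N : ℕ} → List (List (Fin N)) → Bool
colsStrictᵇ []           = true
colsStrictᵇ (r ∷ [])     = true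
colsStrictᵇ (r ∷ s ∷ rs) = colStrictᵇ r s ∧ colsStrictᵇ (s ∷ rs)

tableauContentᵇ : {N : ℕ} → List (List (Fin N)) → (Fin N → ℕ) → Bool
tableauContentᵇ {N} t α =
  allᵇ (λ i → sum (map (countᵇ (λ e → e ==ᶠ i)) t) ≡ᵇ α i) (allFin N)

isSSYTᵇ : {N : ℕ} → List (List (Fin N)) → Bool
isSSYTᵇ t = allᵇ rowWeakᵇ t ∧ colsStrictᵇ t

schurCoeff : List ℕ → (N : ℕ) → (Fin N → ℕ) → ℕ
schurCoeff sh N α = countᵇ (λ t → isSSYTᵇ t ∧ tableauContentᵇ t α) (fillings sh N)

-- Rim hooks.  Shapes are handled as padded lists (trailing zeros allowed).
-- For μ ⊆ λ of the same length, row i of λ/μ consists of the cells in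
-- columns μ_i+1 … λ_i.  λ/μ is a rim hook iff it is nonempty, edge-connected
-- and contains no 2×2 square; since rows of a skew shape are intervals, this
-- means: the set of occupied rows is a (nonempty) interval, and any two
-- consecutive occupied rows i, i+1 share exactly one column, i.e.
-- |(μ_i, λ_i] ∩ (μ_{i+1}, λ_{i+1}]| = λ_{i+1} ∸ μ_i = 1.

occupied : List ℕ → List ℕ → List Bool
occupied (l ∷ ls) (m ∷ ms) = (m <ᵇ l) ∷ occupied ls ms
occupied _        _        = []

runs : Bool → List Bool → ℕ
runs prev []           = 0
runs prev (true ∷ bs)  = (if prev then 0 else 1) + runs true bs
runs prev (false ∷ bs) = runs false bs

shareOneᵇ : List ℕ → List ℕ → Bool
shareOneᵇ (l ∷ l' ∷ ls) (m ∷ m' ∷ ms) =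
  ((not ((m <ᵇ l) ∧ (m' <ᵇ l'))) ∨ ((l' ∸ m) ≡ᵇ 1)) ∧ shareOneᵇ (l' ∷ ls) (m' ∷ ms)
shareOneᵇ _ _ = true

containedᵇ : List ℕ → List ℕ → Bool
containedᵇ (l ∷ ls) (m ∷ ms) = (m ≤ᵇ l) ∧ containedᵇ ls ms
containedᵇ []       []       = true
containedᵇ _        _        = false

isRimHookᵇ : List ℕ → List ℕ → Bool
isRimHookᵇ sh μ =
  containedᵇ sh μ ∧ decreasingᵇ μ ∧ (runs false (occupied sh μ) ≡ᵇ 1) ∧ shareOneᵇ sh μ

meetsFirstColumnᵇ : List ℕ → List ℕ → Bool
meetsFirstColumnᵇ (l ∷ ls) (m ∷ ms) = ((m ≡ᵇ 0) ∧ (1 ≤ᵇ l)) ∨ meetsFirstColumnᵇ ls ms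
meetsFirstColumnᵇ _ _ = false

below : List ℕ → List (List ℕ)
below []       = [] ∷ []
below (l ∷ ls) = concatMap (λ m → map (m ∷_) (below ls)) (upTo (suc l))

specialRemovals : List ℕ → List (List ℕ)
specialRemovals sh =
  filter (λ μ → Data.Bool._≟_ (isRimHookᵇ sh μ ∧ meetsFirstColumnᵇ sh μ) true) (below sh)

record HookData : Set where
  constructor hook
  field
    len  : ℕ
    rows : ℕ
open HookData public

hookData : List ℕ → List ℕ → HookData
hookData sh μ = hook (sum sh ∸ sum μ) (countᵇ (λ b → b) (occupied sh μ))

isEmptyShapeᵇ : List ℕ → Bool
isEmptyShapeᵇ = allᵇ (λ a → a ≡ᵇ 0)

-- Special rim hook tabloids of shape λ, listed as the sequence of rim hooks
-- in order of removal (each removal leaves a Young diagram; every rim hook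
-- meets the first column).  A tabloid is determined by its sequence of
-- removals and conversely, so each tabloid occurs exactly once.
-- The first argument is fuel; fuel ≥ |λ| suffices since each removal
-- removes at least one cell.
specialTabloids : ℕ → List ℕ → List (List HookData)
specialTabloids zero    sh = if isEmptyShapeᵇ sh then [] ∷ [] else []
specialTabloids (suc f) sh =
  if isEmptyShapeᵇ sh then [] ∷ []
  else concatMap (λ μ → map (hookData sh μ ∷_) (specialTabloids f μ)) (specialRemovals sh)

𝒯 : List ℕ → List (List HookData)
𝒯 sh = specialTabloids (sum sh) sh

πT : List HookData → List ℕ
πT = map len

isEvenᵇ : ℕ → Bool
isEvenᵇ zero          = true
isEvenᵇ (suc zero)    = false
isEvenᵇ (suc (suc k)) = isEvenᵇ k

|W| : List HookData → ℕ
|W| = countᵇ (λ h → isEvenᵇ (rows h))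

mult : ℕ → List ℕ → ℕ
mult k = countᵇ (λ a → a ≡ᵇ k)

-- π^! = ∏_{i ≥ 1} m_i !  (parts are ≤ sum π, so i ranges over 1..sum π)
factorialOfPartition : List ℕ → ℕ
factorialOfPartition π = product (map (λ i → (mult (suc i) π) !) (upTo (sum π)))

-- Stable partitions of G.  A set partition of V = Fin n is a set of blocks,
-- i.e. a sublist of the (duplicate-free) list of all subsets of V.

allSubsets : (n : ℕ) → List (Vec Bool n)
allSubsets zero    = [] ∷ []
allSubsets (suc n) = concatMap (λ b → map (b ∷_) (allSubsets n)) (true ∷ false ∷ [])

blockSize : {n : ℕ} → Vec Bool n → ℕ
blockSize {n} B = countᵇ (λ v → lookup B v) (allFin n)

isStableᵇ : {n : ℕ} → SimpleGraph n → Vec Bool n → Bool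
isStableᵇ {n} G B =
  allᵇ (λ u → allᵇ (λ v → not (lookup B u ∧ lookup B v ∧ Adj G u v)) (allFin n)) (allFin n)

isStablePartitionᵇ : {n : ℕ} → SimpleGraph n → List (Vec Bool n) → Bool
isStablePartitionᵇ {n} G P =
  allᵇ (λ B → 1 ≤ᵇ blockSize B) P
  ∧ allᵇ (λ v → countᵇ (λ B → lookup B v) P ≡ᵇ 1) (allFin n)
  ∧ allᵇ (isStableᵇ G) P

hasTypeᵇ : {n : ℕ} → List (Vec Bool n) → List ℕ → Bool
hasTypeᵇ {n} P π =
  allᵇ (λ k → countᵇ (λ B → blockSize B ≡ᵇ k) P ≡ᵇ mult k π) (upTo (suc (n + sum π)))
  ∧ (length P ≡ᵇ length π)

stablePartitionCount : {n : ℕ} → SimpleGraph n → List ℕ → ℕ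
stablePartitionCount {n} G π =
  countᵇ (λ P → isStablePartitionᵇ G P ∧ hasTypeᵇ P π) (sublists (allSubsets n))

sign : ℕ → ℤ
sign k = if isEvenᵇ k then + 1 else ℤ.- (+ 1)

claimedCoeff : {n : ℕ} → SimpleGraph n → List ℕ → ℤ
claimedCoeff G sh =
  sumℤ (map (λ T → sign (|W| T) ℤ.* (+ (factorialOfPartition (πT T) * stablePartitionCount G (πT T))))
            (𝒯 sh))

{-# OPTIONS --safe #-}
-- Let F π be the number of proper colourings with content π.  It is symmetric in π and ignores zeros, and
-- sorting colourings by their fibres gives F π = π^! N_G(π) when π has no zeros.  Read F as the linear
-- functional h_π ↦ F π on symmetric functions.  Expanding the Jacobi–Trudi determinant of s_λ repeatedly
-- along its first column produces one signed h_π per special rim hook tabloid of shape λ and type π, so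
-- the claimed coefficient of s_λ is F(s_λ).  It remains to see Σ_λ F(s_λ) K_{λα} = F α.  Removing the
-- largest letter from semistandard tableaux turns K_{λα} into a sum over μ with λ/μ a horizontal strip,
-- and Pieri's rule, a row and a column operation on the determinant, turns the sum over λ into
-- F(h_a s_μ); so the identity follows by induction on the number of variables.
module Submission where

open import Defs
open import Data.Nat as ℕ using (ℕ; zero; suc; z≤n; s≤s; pred; _!)
import Data.Nat.Properties as ℕₚ
open import Data.Nat.ListAction using (sum; product)
import Data.Nat.ListAction.Properties as ListActₚ
open import Data.Nat.Tactic.RingSolver using () renaming (solve-∀ to ℕ-solve-∀)
open import Data.Integer using (ℤ; +_; -_; _+_; _-_; _*_)
import Data.Integer.Properties as ℤₚ
open import Data.Integer.Tactic.RingSolver using (solve-∀)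
open import Data.Bool using (Bool; true; false; _∧_; _∨_; not; T; if_then_else_)
import Data.Bool.Properties as Boolₚ
open import Data.Empty using (⊥; ⊥-elim)
open import Data.Fin using (Fin; zero; suc; toℕ; inject₁; fromℕ)
import Data.Fin.Properties as Finₚ
open import Data.Fin.Relation.Unary.Top using (view; ‵fromℕ; ‵inject₁)
open import Data.List using (List; []; _∷_; _++_; map; concatMap; filter; length; replicate;
  zipWith; tabulate; allFin; upTo)
import Data.List.Properties as Listₚ
open import Data.List.Relation.Unary.All as All using (All; []; _∷_)
import Data.List.Relation.Unary.All.Properties as Allₚ
import Data.List.Relation.Binary.Permutation.Propositional as ↭
open ↭ using (_↭_; ↭-refl; ↭-prep; ↭-swap; ↭-trans; ↭-sym)
import Data.List.Relation.Binary.Permutation.Propositional.Properties as ↭ₚ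
open import Data.Maybe using (Maybe; just; nothing)
open import Data.Product using (∃; ∃₂; _×_; _,_; proj₁; proj₂)
open import Data.Sum using (_⊎_; inj₁; inj₂)
open import Data.Vec as Vec using (Vec; []; _∷_; lookup)
import Data.Vec.Properties as Vecₚ
open import Function using (_∘_; id)
open import Relation.Nullary using (yes; no; ¬_; contradiction)
open import Relation.Binary.PropositionalEquality hiding (J)

-- The functional `F` is linear but not multiplicative, so a determinant in the `h_k` cannot be
-- evaluated entry by entry in ℤ. Every determinant therefore carries the list `π` of the indices
-- chosen so far, and `F` is applied only when no column is left. The ring of symmetric functions
-- never appears: `F-↭` stands for its commutativity, `F-0` for `h_0 = 1` and `F-support` for the
-- grading, and these three properties are all that is used of `F` until the graph comes in. The
-- second obstacle is the number of rows. A horizontal strip may start a new row, whereas row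
-- operations compare determinants of one size. Shapes are therefore padded with zeros to `n + 1`
-- rows with entries at most `n`; a shape of size at most `n` then always keeps an empty last row
-- into which the strip can grow. The strips enter by intervals: between consecutive parts of `μ` a
-- part of the larger shape moves freely, so summing over it replaces a row of the determinant by a
-- difference of two tail sums, of which one repeats the neighbouring row.

infix 5 ∑

-- Finite sums over lists

opaque
  -- Opaque, so that a sum over a list such as `upTo (suc k)` does not unfold in goals and its
  -- summand can be inferred by unification.
  ∑ : {A : Set} → List A → (A → ℤ) → ℤ
  ∑ xs f = sumℤ (map f xs)

syntax ∑ xs (λ x → e) = ∑[ x ← xs ] e

⟦_⟧ : Bool → ℤ
⟦ true ⟧  = + 1
⟦ false ⟧ = + 0

module _ {A : Set} where
  opaque
    unfolding ∑

    ∑-def : (xs : List A) (f : A → ℤ) → sumℤ (map f xs) ≡ ∑ xs f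
    ∑-def xs f = refl

    ∑-[] : (f : A → ℤ) → ∑ [] f ≡ + 0
    ∑-[] f = refl

    ∑-∷ : (x : A) (xs : List A) (f : A → ℤ) → ∑ (x ∷ xs) f ≡ f x + ∑ xs f
    ∑-∷ x xs f = refl

    ∑-single : (x : A) (f : A → ℤ) → ∑ (x ∷ []) f ≡ f x
    ∑-single x f = ℤₚ.+-identityʳ (f x)

    ∑-congᴬ : {P : A → Set} {f g : A → ℤ} {xs : List A} → All P xs →
              (∀ x → P x → f x ≡ g x) → ∑ xs f ≡ ∑ xs g
    ∑-congᴬ []         eq = refl
    ∑-congᴬ (px ∷ pxs) eq = cong₂ _+_ (eq _ px) (∑-congᴬ pxs eq)

    ∑-cong : (xs : List A) {f g : A → ℤ} → (∀ x → f x ≡ g x) → ∑ xs f ≡ ∑ xs g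
    ∑-cong []       eq = refl
    ∑-cong (x ∷ xs) eq = cong₂ _+_ (eq x) (∑-cong xs eq)

    ∑-++ : (xs ys : List A) (f : A → ℤ) → ∑ (xs ++ ys) f ≡ ∑ xs f + ∑ ys f
    ∑-++ []       ys f = sym (ℤₚ.+-identityˡ _)
    ∑-++ (x ∷ xs) ys f = trans (cong (_+_ (f x)) (∑-++ xs ys f)) (sym (ℤₚ.+-assoc (f x) _ _))

    ∑-map : {B : Set} (xs : List B) (h : B → A) (f : A → ℤ) → ∑ (map h xs) f ≡ ∑ xs (f ∘ h)
    ∑-map xs h f = cong sumℤ (sym (Listₚ.map-∘ xs))

    ∑-concatMap : {B : Set} (xs : List B) (h : B → List A) (f : A → ℤ) →
                  ∑ (concatMap h xs) f ≡ ∑[ x ← xs ] ∑ (h x) f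
    ∑-concatMap []       h f = refl
    ∑-concatMap (x ∷ xs) h f = trans (∑-++ (h x) _ f) (cong (_+_ (∑ (h x) f)) (∑-concatMap xs h f))

    ∑-zero : (xs : List A) {f : A → ℤ} → (∀ x → f x ≡ + 0) → ∑ xs f ≡ + 0
    ∑-zero []       eq = refl
    ∑-zero (x ∷ xs) eq = cong₂ _+_ (eq x) (∑-zero xs eq)

    ∑-+ : (xs : List A) (f g : A → ℤ) → (∑[ x ← xs ] (f x + g x)) ≡ ∑ xs f + ∑ xs g
    ∑-+ []       f g = refl
    ∑-+ (x ∷ xs) f g = trans (cong (_+_ (f x + g x)) (∑-+ xs f g)) (lemma (f x) (g x) _ _)
      where
      lemma : ∀ a b c d → a + b + (c + d) ≡ a + c + (b + d)
      lemma = solve-∀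

    ∑-*ˡ : (c : ℤ) (xs : List A) (f : A → ℤ) → (∑[ x ← xs ] c * f x) ≡ c * ∑ xs f
    ∑-*ˡ c []       f = sym (ℤₚ.*-zeroʳ c)
    ∑-*ˡ c (x ∷ xs) f = trans (cong (_+_ (c * f x)) (∑-*ˡ c xs f)) (sym (ℤₚ.*-distribˡ-+ c (f x) _))

    ∑-*ʳ : (c : ℤ) (xs : List A) (f : A → ℤ) → (∑[ x ← xs ] f x * c) ≡ ∑ xs f * c
    ∑-*ʳ c xs f = trans (∑-cong xs λ x → ℤₚ.*-comm (f x) c) (trans (∑-*ˡ c xs f) (ℤₚ.*-comm c _))

opaque
  unfolding ∑

  ∑-swap : {A B : Set} (xs : List A) (ys : List B) (f : A → B → ℤ) →
           (∑[ x ← xs ] ∑[ y ← ys ] f x y) ≡ (∑[ y ← ys ] ∑[ x ← xs ] f x y)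
  ∑-swap []       ys f = sym (∑-zero ys λ _ → refl)
  ∑-swap (x ∷ xs) ys f =
    trans (cong (_+_ (∑ ys (f x))) (∑-swap xs ys f)) (sym (∑-+ ys (f x) _))

  ∑-filter : {A : Set} (b : A → Bool) (xs : List A) (f : A → ℤ) →
             ∑ (filter (λ x → b x Data.Bool.≟ true) xs) f ≡ ∑[ x ← xs ] ⟦ b x ⟧ * f x
  ∑-filter b []       f = refl
  ∑-filter b (x ∷ xs) f with b x
  ... | true  = cong₂ _+_ (sym (ℤₚ.*-identityˡ (f x))) (∑-filter b xs f)
  ... | false = trans (∑-filter b xs f) (sym (ℤₚ.+-identityˡ _))

  ∑-countᵇ : {A : Set} (b : A → Bool) (xs : List A) → + countᵇ b xs ≡ ∑[ x ← xs ] ⟦ b x ⟧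
  ∑-countᵇ b []       = refl
  ∑-countᵇ b (x ∷ xs) with b x
  ... | true  = cong (_+_ (+ 1)) (∑-countᵇ b xs)
  ... | false = trans (∑-countᵇ b xs) (sym (ℤₚ.+-identityˡ _))

  ∑-upTo : (k : ℕ) (f : ℕ → ℤ) → ∑ (upTo (suc k)) f ≡ f 0 + (∑[ i ← upTo k ] f (suc i))
  ∑-upTo k f = cong (_+_ (f 0))
    (trans (cong (λ l → ∑ l f) (sym (Listₚ.map-upTo suc k))) (∑-map (upTo k) suc f))

∑-listsOfLen : {A : Set} (k : ℕ) (xs : List A) (f : List A → ℤ) →
               ∑ (listsOfLen (suc k) xs) f ≡ ∑[ x ← xs ] ∑[ r ← listsOfLen k xs ] f (x ∷ r)
∑-listsOfLen k xs f =
  trans (∑-concatMap xs _ f) (∑-cong xs λ x → ∑-map (listsOfLen k xs) (x ∷_) f)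

-- Boolean tests and their brackets

⟦⟧-∧ : ∀ a b → ⟦ a ∧ b ⟧ ≡ ⟦ a ⟧ * ⟦ b ⟧
⟦⟧-∧ true  b = sym (ℤₚ.*-identityˡ _)
⟦⟧-∧ false b = refl

⟦⟧-guard : ∀ b {x y : ℤ} → (b ≡ true → x ≡ y) → ⟦ b ⟧ * x ≡ ⟦ b ⟧ * y
⟦⟧-guard true  eq = cong (_*_ (+ 1)) (eq refl)
⟦⟧-guard false eq = refl

true-ext : ∀ {a b} → (a ≡ true → b ≡ true) → (b ≡ true → a ≡ true) → a ≡ b
true-ext {true}  {b}     f g = sym (f refl)
true-ext {false} {true}  f g = g refl
true-ext {false} {false} f g = refl

∧⁻ : ∀ {a b} → a ∧ b ≡ true → (a ≡ true) × (b ≡ true)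
∧⁻ {true} {true} p = refl , refl

∧⁺ : ∀ {a b} → a ≡ true → b ≡ true → a ∧ b ≡ true
∧⁺ refl refl = refl

∧⁺˙ : ∀ {a b} → (a ≡ true) × (b ≡ true) → a ∧ b ≡ true
∧⁺˙ (p , q) = ∧⁺ p q

T⇒≡ : ∀ {b} → T b → b ≡ true
T⇒≡ {true} _ = refl

≡⇒T : ∀ {b} → b ≡ true → T b
≡⇒T refl = _

≡ᵇ⁻ : ∀ {a b} → (a ℕ.≡ᵇ b) ≡ true → a ≡ b
≡ᵇ⁻ {a} {b} p = ℕₚ.≡ᵇ⇒≡ a b (≡⇒T p)

≡ᵇ⁺ : ∀ {a b} → a ≡ b → (a ℕ.≡ᵇ b) ≡ true
≡ᵇ⁺ {a} {b} p = T⇒≡ (ℕₚ.≡⇒≡ᵇ a b p)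

≤ᵇ⁻ : ∀ {a b} → (a ℕ.≤ᵇ b) ≡ true → a ℕ.≤ b
≤ᵇ⁻ {a} {b} p = ℕₚ.≤ᵇ⇒≤ a b (≡⇒T p)

≤ᵇ⁺ : ∀ {a b} → a ℕ.≤ b → (a ℕ.≤ᵇ b) ≡ true
≤ᵇ⁺ p = T⇒≡ (ℕₚ.≤⇒≤ᵇ p)

<ᵇ⁻ : ∀ {a b} → (a ℕ.<ᵇ b) ≡ true → a ℕ.< b
<ᵇ⁻ {a} {b} p = ℕₚ.<ᵇ⇒< a b (≡⇒T p)

<ᵇ⁺ : ∀ {a b} → a ℕ.< b → (a ℕ.<ᵇ b) ≡ true
<ᵇ⁺ p = T⇒≡ (ℕₚ.<⇒<ᵇ p)

⟦⟧-false : ∀ {b} → (b ≡ true → ⊥) → ⟦ b ⟧ ≡ + 0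
⟦⟧-false {true}  p = ⊥-elim (p refl)
⟦⟧-false {false} p = refl


∑-δ : (k m : ℕ) (f : ℕ → ℤ) → m ℕ.< k → (∑[ i ← upTo k ] ⟦ m ℕ.≡ᵇ i ⟧ * f i) ≡ f m
∑-δ (suc k) zero f _ = trans (∑-upTo k (λ i → ⟦ 0 ℕ.≡ᵇ i ⟧ * f i))
  (trans (cong₂ _+_ (ℤₚ.*-identityˡ (f 0)) (∑-zero (upTo k) λ _ → refl)) (ℤₚ.+-identityʳ _))
∑-δ (suc k) (suc m) f (s≤s p) =
  trans (∑-upTo k (λ i → ⟦ suc m ℕ.≡ᵇ i ⟧ * f i)) (trans (ℤₚ.+-identityˡ _) (∑-δ k m (f ∘ suc) p))

-- Trades a bound that depends on an outer variable for a bracket over a fixed range; only then can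
-- two sums be interchanged.
∑-≤ : (k l : ℕ) (f : ℕ → ℤ) → l ℕ.< k →
      ∑ (upTo (suc l)) f ≡ (∑[ i ← upTo k ] ⟦ i ℕ.≤ᵇ l ⟧ * f i)
∑-≤ (suc k) zero f _ = begin
  ∑ (upTo 1) f                            ≡⟨ ∑-upTo 0 f ⟩
  f 0 + ∑ [] (λ i → f (suc i))            ≡⟨ cong₂ _+_ (sym (ℤₚ.*-identityˡ (f 0)))
                                              (trans (∑-[] _) (sym (∑-zero (upTo k) λ _ → refl))) ⟩
  + 1 * f 0 + (∑[ i ← upTo k ] + 0 * f (suc i)) ≡⟨ ∑-upTo k (λ i → ⟦ i ℕ.≤ᵇ 0 ⟧ * f i) ⟨
  (∑[ i ← upTo (suc k) ] ⟦ i ℕ.≤ᵇ 0 ⟧ * f i) ∎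
  where open ≡-Reasoning
∑-≤ (suc k) (suc l) f (s≤s p) = begin
  ∑ (upTo (suc (suc l))) f                ≡⟨ ∑-upTo (suc l) f ⟩
  f 0 + ∑ (upTo (suc l)) (f ∘ suc)        ≡⟨ cong₂ _+_ (sym (ℤₚ.*-identityˡ (f 0)))
       (trans (∑-≤ k l (f ∘ suc) p) (∑-cong (upTo k) λ { zero → refl ; (suc i) → refl })) ⟩
  + 1 * f 0 + (∑[ i ← upTo k ] ⟦ suc i ℕ.≤ᵇ suc l ⟧ * f (suc i)) ≡⟨ ∑-upTo k (λ i → ⟦ i ℕ.≤ᵇ suc l ⟧ * f i) ⟨
  (∑[ i ← upTo (suc k) ] ⟦ i ℕ.≤ᵇ suc l ⟧ * f i) ∎
  where open ≡-Reasoning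

-- Laplace expansions

sign-suc : ∀ k → sign (suc k) ≡ - sign k
sign-suc zero          = refl
sign-suc (suc zero)    = refl
sign-suc (suc (suc k)) = sign-suc k

sign-+ : ∀ j k → sign (j ℕ.+ k) ≡ sign j * sign k
sign-+ zero    k = sym (ℤₚ.*-identityˡ _)
sign-+ (suc j) k = begin
  sign (suc (j ℕ.+ k)) ≡⟨ sign-suc (j ℕ.+ k) ⟩
  - sign (j ℕ.+ k)     ≡⟨ cong -_ (sign-+ j k) ⟩
  - (sign j * sign k)  ≡⟨ ℤₚ.neg-distribˡ-* (sign j) (sign k) ⟩
  - sign j * sign k    ≡⟨ cong (_* sign k) (sign-suc j) ⟨
  sign (suc j) * sign k ∎
  where open ≡-Reasoning

sign² : ∀ k → sign k * sign k ≡ + 1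
sign² zero          = refl
sign² (suc zero)    = refl
sign² (suc (suc k)) = sign² k

-- Alternating sum over the ways of splitting off one element: a Laplace expansion along a column.
lap : {X : Set} → (X → List X → ℤ) → List X → ℤ
lap φ []       = + 0
lap φ (x ∷ xs) = φ x xs - lap (λ y ys → φ y (x ∷ ys)) xs

module _ {X : Set} where

  -- The hypothesis `x ∷ ys ↭ xs` makes permutation-invariant facts about `xs`, such as its sum or a
  -- bound on its entries, available in each term of the expansion.
  lap-cong↭ : {φ ψ : X → List X → ℤ} (xs : List X) →
              (∀ x ys → x ∷ ys ↭ xs → φ x ys ≡ ψ x ys) → lap φ xs ≡ lap ψ xs
  lap-cong↭ []       eq = refl
  lap-cong↭ (x ∷ xs) eq = cong₂ _-_ (eq x xs ↭-refl)
    (lap-cong↭ xs λ y ys p → eq y (x ∷ ys) (↭-trans (↭-swap y x ↭-refl) (↭-prep x p)))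

  lap-cong : {φ ψ : X → List X → ℤ} (xs : List X) →
             (∀ x ys → φ x ys ≡ ψ x ys) → lap φ xs ≡ lap ψ xs
  lap-cong xs eq = lap-cong↭ xs λ x ys _ → eq x ys

  lap-zero : {φ : X → List X → ℤ} (xs : List X) → (∀ x ys → φ x ys ≡ + 0) → lap φ xs ≡ + 0
  lap-zero []       eq = refl
  lap-zero (x ∷ xs) eq = cong₂ _-_ (eq x xs) (lap-zero xs λ y ys → eq y (x ∷ ys))

  lap-+ : (φ ψ : X → List X → ℤ) (xs : List X) →
          lap (λ x ys → φ x ys + ψ x ys) xs ≡ lap φ xs + lap ψ xs
  lap-+ φ ψ []       = refl
  lap-+ φ ψ (x ∷ xs) = trans (cong (_-_ (φ x xs + ψ x xs)) (lap-+ _ _ xs))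
                             (lemma (φ x xs) (ψ x xs) _ _)
    where
    lemma : ∀ a b c d → a + b - (c + d) ≡ (a - c) + (b - d)
    lemma = solve-∀

  lap-* : (c : ℤ) (φ : X → List X → ℤ) (xs : List X) →
          lap (λ x ys → c * φ x ys) xs ≡ c * lap φ xs
  lap-* c φ []       = sym (ℤₚ.*-zeroʳ c)
  lap-* c φ (x ∷ xs) = trans (cong (_-_ (c * φ x xs)) (lap-* c _ xs)) (lemma c (φ x xs) _)
    where
    lemma : ∀ c a b → c * a - c * b ≡ c * (a - b)
    lemma = solve-∀

  lap-∑ : {I : Set} (is : List I) (φ : I → X → List X → ℤ) (xs : List X) →
          lap (λ x ys → ∑[ i ← is ] φ i x ys) xs ≡ ∑[ i ← is ] lap (φ i) xs
  lap-∑ []       φ xs = trans (lap-zero xs λ x ys → ∑-[] _) (sym (∑-[] _))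
  lap-∑ (i ∷ is) φ xs =
    trans (lap-cong xs λ x ys → ∑-∷ i is _)
      (trans (lap-+ (φ i) _ xs)
        (trans (cong (_+_ (lap (φ i) xs)) (lap-∑ is φ xs)) (sym (∑-∷ i is _))))

  lap-map : {Y : Set} (h : Y → X) (φ : X → List X → ℤ) (xs : List Y) →
            lap φ (map h xs) ≡ lap (λ x ys → φ (h x) (map h ys)) xs
  lap-map h φ []       = refl
  lap-map h φ (x ∷ xs) = cong (_-_ (φ (h x) (map h xs))) (lap-map h _ xs)

  -- Two equal columns.
  lap-lap : (ψ : X → X → List X → ℤ) → (∀ x y zs → ψ x y zs ≡ ψ y x zs) → (xs : List X) →
            lap (λ x ys → lap (ψ x) ys) xs ≡ + 0
  lap-lap ψ ψ-sym []       = refl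
  lap-lap ψ ψ-sym (x ∷ xs) = begin
    -- The terms in which `x` is taken second cancel those in which it is taken first, by `ψ-sym`;
    -- what remains is the same claim for `xs`, with `x` left over.
    lap (ψ x) xs - lap (λ y ys → ψ y x ys - lap (λ z zs → ψ y z (x ∷ zs)) ys) xs
      ≡⟨ cong (_-_ (lap (ψ x) xs)) (trans
           (lap-cong xs λ y ys → trans (cong₂ _-_ (ψ-sym y x ys) refl)
              (cong (_+_ (ψ x y ys)) (sym (ℤₚ.-1*i≡-i (lap (λ z zs → ψ y z (x ∷ zs)) ys)))))
           (lap-+ (ψ x) _ xs)) ⟩
    lap (ψ x) xs - (lap (ψ x) xs + lap (λ y ys → - (+ 1) * lap (λ z zs → ψ y z (x ∷ zs)) ys) xs)
      ≡⟨ cong (λ e → lap (ψ x) xs - (lap (ψ x) xs + e)) (trans (lap-* (- (+ 1)) _ xs)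
           (cong (_*_ (- (+ 1))) (lap-lap (λ y z zs → ψ y z (x ∷ zs)) (λ y z zs → ψ-sym y z (x ∷ zs)) xs))) ⟩
    lap (ψ x) xs - (lap (ψ x) xs + + 0)
      ≡⟨ lemma (lap (ψ x) xs) ⟩
    + 0 ∎
    where
    open ≡-Reasoning
    lemma : ∀ a → a - (a + + 0) ≡ + 0
    lemma = solve-∀

  -- Any other choice leaves `z` at the end of the remainder, where `φ` vanishes; the sign comes
  -- from moving `z` past `xs`.
  lap-last : (φ : X → List X → ℤ) (xs : List X) (z : X) → (∀ x ys → φ x (ys ++ z ∷ []) ≡ + 0) →
             lap φ (xs ++ z ∷ []) ≡ sign (length xs) * φ z xs
  lap-last φ []       z eq = lemma (φ z [])
    where
    lemma : ∀ a → a - + 0 ≡ + 1 * a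
    lemma = solve-∀
  lap-last φ (x ∷ xs) z eq = begin
    φ x (xs ++ z ∷ []) - lap (λ y ys → φ y (x ∷ ys)) (xs ++ z ∷ [])
      ≡⟨ cong₂ _-_ (eq x xs) (lap-last _ xs z λ y ys → eq y (x ∷ ys)) ⟩
    + 0 - sign (length xs) * φ z (x ∷ xs)
      ≡⟨ lemma (sign (length xs)) _ ⟩
    - sign (length xs) * φ z (x ∷ xs)
      ≡⟨ cong (_* φ z (x ∷ xs)) (sign-suc (length xs)) ⟨
    sign (suc (length xs)) * φ z (x ∷ xs) ∎
    where
    open ≡-Reasoning
    lemma : ∀ a b → + 0 - a * b ≡ - a * b
    lemma = solve-∀

  -- The row `r` is either split off or left over. The first case is linearity of the entry, the
  -- second is linearity of the smaller determinant, which is known by induction when this is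
  -- applied; hence the two hypotheses.
  lap-linear : {I : Set} (is : List I) (w : I → ℤ) (ρ : I → X) (r : X) (φ : X → List X → ℤ) →
    (∀ ys → φ r ys ≡ ∑[ i ← is ] w i * φ (ρ i) ys) →
    (∀ x pre post → φ x (pre ++ r ∷ post) ≡ ∑[ i ← is ] w i * φ x (pre ++ ρ i ∷ post)) →
    ∀ pre post → lap φ (pre ++ r ∷ post) ≡ ∑[ i ← is ] w i * lap φ (pre ++ ρ i ∷ post)
  lap-linear is w ρ r φ φ-head φ-tail pre post = go pre φ φ-head φ-tail
    where
    open ≡-Reasoning
    combine : (f g : _ → ℤ) →
      (∑[ i ← is ] w i * f i) - (∑[ i ← is ] w i * g i) ≡ ∑[ i ← is ] w i * (f i - g i)
    combine f g = begin
      (∑[ i ← is ] w i * f i) - (∑[ i ← is ] w i * g i)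
        ≡⟨ cong (_+_ (∑[ i ← is ] w i * f i)) (ℤₚ.-1*i≡-i (∑[ i ← is ] w i * g i)) ⟨
      (∑[ i ← is ] w i * f i) + - (+ 1) * (∑[ i ← is ] w i * g i)
        ≡⟨ cong (_+_ (∑[ i ← is ] w i * f i)) (∑-*ˡ (- (+ 1)) is _) ⟨
      (∑[ i ← is ] w i * f i) + (∑[ i ← is ] - (+ 1) * (w i * g i))
        ≡⟨ ∑-+ is _ _ ⟨
      (∑[ i ← is ] (w i * f i + - (+ 1) * (w i * g i)))
        ≡⟨ ∑-cong is (λ i → lemma (w i) (f i) (g i)) ⟩
      (∑[ i ← is ] w i * (f i - g i)) ∎
      where
      lemma : ∀ w a b → w * a + - (+ 1) * (w * b) ≡ w * (a - b)
      lemma = solve-∀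
    go : ∀ pre (φ : X → List X → ℤ) →
      (∀ ys → φ r ys ≡ ∑[ i ← is ] w i * φ (ρ i) ys) →
      (∀ x pre post → φ x (pre ++ r ∷ post) ≡ ∑[ i ← is ] w i * φ x (pre ++ ρ i ∷ post)) →
      lap φ (pre ++ r ∷ post) ≡ ∑[ i ← is ] w i * lap φ (pre ++ ρ i ∷ post)
    go [] φ φ-head φ-tail = begin
      φ r post - lap (λ y ys → φ y (r ∷ ys)) post
        ≡⟨ cong₂ _-_ (φ-head post) (trans (lap-cong post λ y ys → φ-tail y [] ys)
             (trans (lap-∑ is _ post) (∑-cong is λ i → lap-* (w i) _ post))) ⟩
      (∑[ i ← is ] w i * φ (ρ i) post) - (∑[ i ← is ] w i * lap (λ y ys → φ y (ρ i ∷ ys)) post)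
        ≡⟨ combine _ _ ⟩
      (∑[ i ← is ] w i * lap φ (ρ i ∷ post)) ∎
    go (x ∷ pre) φ φ-head φ-tail = trans
      (cong₂ _-_ (φ-tail x pre post)
        (go pre (λ y ys → φ y (x ∷ ys)) (λ ys → φ-head (x ∷ ys)) (λ y pre post → φ-tail y (x ∷ pre) post)))
      (combine _ _)

  -- Two equal adjacent rows.
  lap-repeat : (r : X) (φ : X → List X → ℤ) → (∀ x pre post → φ x (pre ++ r ∷ r ∷ post) ≡ + 0) →
               ∀ pre post → lap φ (pre ++ r ∷ r ∷ post) ≡ + 0
  lap-repeat r φ eq [] post = begin
    φ r (r ∷ post) - (φ r (r ∷ post) - lap (λ y ys → φ y (r ∷ r ∷ ys)) post)
      ≡⟨ cong (λ e → φ r (r ∷ post) - (φ r (r ∷ post) - e)) (lap-zero post λ y ys → eq y [] ys) ⟩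
    φ r (r ∷ post) - (φ r (r ∷ post) - + 0) ≡⟨ lemma (φ r (r ∷ post)) ⟩
    + 0 ∎
    where
    open ≡-Reasoning
    lemma : ∀ a → a - (a - + 0) ≡ + 0
    lemma = solve-∀
  lap-repeat r φ eq (x ∷ pre) post =
    cong₂ _-_ (eq x pre post) (lap-repeat r _ (λ y pre post → eq y (x ∷ pre) post) pre post)

-- Jacobi–Trudi determinants and the Pieri rule

Row : Set
Row = ℕ → ℕ → ℤ

∑-upTo-cong : ∀ k {f g : ℕ → ℤ} → (∀ i → i ℕ.< k → f i ≡ g i) → ∑ (upTo k) f ≡ ∑ (upTo k) g
∑-upTo-cong k eq = ∑-congᴬ (Allₚ.all-upTo k) eq

all-length-listsOfLen : {A : Set} (k : ℕ) (xs : List A) → All (λ r → length r ≡ k) (listsOfLen k xs)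
all-length-listsOfLen zero    xs = refl ∷ []
all-length-listsOfLen (suc k) xs = Allₚ.concat⁺ (Allₚ.map⁺ (All.universal
  (λ x → Allₚ.map⁺ (All.map (cong suc) (all-length-listsOfLen k xs))) xs))

-- interlaced u μ κ: κ/μ is a horizontal strip and all parts of κ are at most u.
interlaced : ℕ → List ℕ → List ℕ → Bool
interlaced u []       []       = true
interlaced u []       (_ ∷ _)  = false
interlaced u (_ ∷ _)  []       = false
interlaced u (m ∷ ms) (l ∷ ls) = ((m ℕ.≤ᵇ l) ∧ (l ℕ.≤ᵇ u)) ∧ interlaced m ms ls

-- The partition plus its staircase. With columns counted from the right, starting at 0, the
-- Jacobi-Trudi entry `h_(λ_i − i + j)` becomes `h_(b − c)` with `b` from this list and `c` the
-- column.
stair : List ℕ → List ℕ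
stair []       = []
stair (l ∷ ls) = l ℕ.+ length ls ∷ stair ls

length-stair : ∀ ls → length (stair ls) ≡ length ls
length-stair []       = refl
length-stair (l ∷ ls) = cong suc (length-stair ls)

stair-snoc : ∀ ls → stair (ls ++ 0 ∷ []) ≡ map suc (stair ls) ++ 0 ∷ []
stair-snoc []       = refl
stair-snoc (l ∷ ls) = cong₂ _∷_
  (trans (cong (l ℕ.+_) (trans (Listₚ.length-++ ls) (ℕₚ.+-comm (length ls) 1))) (ℕₚ.+-suc l (length ls)))
  (stair-snoc ls)

-- The sum of the column numbers `c`, ..., `c + m ∸ 1`, by which the row numbers of a determinant
-- exceed its degree.
tri : ℕ → ℕ → ℕ
tri c zero    = 0
tri c (suc m) = c ℕ.+ tri (suc c) m

tri-suc : ∀ c m → tri (suc c) m ≡ m ℕ.+ tri c m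
tri-suc c zero    = refl
tri-suc c (suc m) = cong suc (trans (cong (c ℕ.+_) (tri-suc (suc c) m)) (lemma c m (tri (suc c) m)))
  where
  lemma : ∀ c m t → c ℕ.+ (m ℕ.+ t) ≡ m ℕ.+ (c ℕ.+ t)
  lemma = ℕ-solve-∀

sum-stair : ∀ μ → sum (stair μ) ≡ sum μ ℕ.+ tri 0 (length μ)
sum-stair []       = refl
sum-stair (l ∷ ls) = begin
  l ℕ.+ length ls ℕ.+ sum (stair ls)
    ≡⟨ cong (l ℕ.+ length ls ℕ.+_) (sum-stair ls) ⟩
  l ℕ.+ length ls ℕ.+ (sum ls ℕ.+ tri 0 (length ls))
    ≡⟨ lemma l (length ls) (sum ls) (tri 0 (length ls)) ⟩
  l ℕ.+ sum ls ℕ.+ (length ls ℕ.+ tri 0 (length ls))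
    ≡⟨ cong (l ℕ.+ sum ls ℕ.+_) (tri-suc 0 (length ls)) ⟨
  l ℕ.+ sum ls ℕ.+ tri 1 (length ls) ∎
  where
  open ≡-Reasoning
  lemma : ∀ l q s t → l ℕ.+ q ℕ.+ (s ℕ.+ t) ≡ l ℕ.+ s ℕ.+ (q ℕ.+ t)
  lemma = ℕ-solve-∀

module JacobiTrudi
  (n : ℕ) (F : List ℕ → ℤ)
  (F-↭ : ∀ {π ρ} → π ↭ ρ → F π ≡ F ρ)
  (F-0 : ∀ π → F (0 ∷ π) ≡ F π)
  (F-support : ∀ π → ¬ (sum π ≡ n) → F π ≡ + 0)
  where

  -- F is read as the linear functional h_π ↦ F π.  Then det m c rows π is its value at h_π times the
  -- determinant with entry Σ_k r j k · h_k in row r and column j = c, …, c + m ∸ 1, and 0 unless there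
  -- are exactly m rows.  The factor sign m gives the last row the sign + in each expansion.
  det : ℕ → ℕ → List Row → List ℕ → ℤ
  det zero    c []       π = F π
  det zero    c (_ ∷ _)  π = + 0
  det (suc m) c rows     π =
    sign m * lap (λ r rs → ∑[ k ← upTo (suc n) ] r c k * det m (suc c) rs (k ∷ π)) rows

  det-↭ : ∀ m c rows {π ρ} → π ↭ ρ → det m c rows π ≡ det m c rows ρ
  det-↭ zero    c []      p = F-↭ p
  det-↭ zero    c (_ ∷ _) p = refl
  det-↭ (suc m) c rows    p = cong (_*_ (sign m)) (lap-cong rows λ r rs →
    ∑-cong (upTo (suc n)) λ k → cong (_*_ (r c k)) (det-↭ m (suc c) rs (↭-prep k p)))

  *-∑-comm : {I : Set} (is : List I) (c : ℤ) (w f : I → ℤ) →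
             c * (∑[ i ← is ] w i * f i) ≡ ∑[ i ← is ] w i * (c * f i)
  *-∑-comm is c w f = trans (sym (∑-*ˡ c is _)) (∑-cong is λ i → lemma c (w i) (f i))
    where
    lemma : ∀ c w f → c * (w * f) ≡ w * (c * f)
    lemma = solve-∀

  ∑-linear : {I K : Set} (is : List I) (ks : List K) (w : I → ℤ) (f : K → I → ℤ) (g : K → ℤ) →
    (∀ k → g k ≡ ∑[ i ← is ] w i * f k i) → ∑ ks g ≡ ∑[ i ← is ] w i * (∑[ k ← ks ] f k i)
  ∑-linear is ks w f g eq = trans (∑-cong ks eq) (trans (∑-swap ks is _)
    (∑-cong is λ i → ∑-*ˡ (w i) ks _))

  det-linear : {I : Set} (is : List I) (w : I → ℤ) (ρ : I → Row) (r : Row) →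
    (∀ j k → r j k ≡ ∑[ i ← is ] w i * ρ i j k) → ∀ m c pre post π →
    det m c (pre ++ r ∷ post) π ≡ ∑[ i ← is ] w i * det m c (pre ++ ρ i ∷ post) π
  det-linear is w ρ r eq zero    c []      post π = sym (∑-zero is λ i → ℤₚ.*-zeroʳ (w i))
  det-linear is w ρ r eq zero    c (_ ∷ _) post π = sym (∑-zero is λ i → ℤₚ.*-zeroʳ (w i))
  det-linear is w ρ r eq (suc m) c pre     post π = trans
    (cong (_*_ (sign m)) (lap-linear is w ρ r _
      (λ ys → ∑-linear is (upTo (suc n)) w (λ k i → ρ i c k * det m (suc c) ys (k ∷ π)) _ λ k →
         trans (cong (_* det m (suc c) ys (k ∷ π)) (eq c k))
           (trans (sym (∑-*ʳ (det m (suc c) ys (k ∷ π)) is (λ i → w i * ρ i c k)))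
             (∑-cong is λ i → ℤₚ.*-assoc (w i) (ρ i c k) _)))
      (λ x pre post → ∑-linear is (upTo (suc n)) w
         (λ k i → x c k * det m (suc c) (pre ++ ρ i ∷ post) (k ∷ π)) _ λ k →
         trans (cong (_*_ (x c k)) (det-linear is w ρ r eq m (suc c) pre post (k ∷ π)))
           (*-∑-comm is (x c k) w _))
      pre post))
    (*-∑-comm is (sign m) w _)

  -- Vanishing is asked only for the columns `c`, ..., `c + m ∸ 1` and for `k ≤ n`, the only values
  -- that the determinant reads: the tail row discarded in `pieri` is zero there and not elsewhere.
  det-zero-row : ∀ m c (r : Row) → (∀ j k → c ℕ.≤ j → j ℕ.< c ℕ.+ m → k ℕ.≤ n → r j k ≡ + 0) →
                 ∀ pre post π → det m c (pre ++ r ∷ post) π ≡ + 0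
  det-zero-row zero    c r r≡0 []      post π = refl
  det-zero-row zero    c r r≡0 (_ ∷ _) post π = refl
  det-zero-row (suc m) c r r≡0 pre     post π = trans
    -- A zero row is the linear combination over the empty index set.
    (cong (_*_ (sign m)) (trans (lap-linear [] (λ (_ : ℕ) → + 0) (λ _ → r) r _
      (λ ys → trans (trans (∑-upTo-cong (suc n) λ k k≤n →
           cong (_* det m (suc c) ys (k ∷ π))
             (r≡0 c k ℕₚ.≤-refl (ℕₚ.m<m+n c (s≤s z≤n)) (ℕₚ.≤-pred k≤n)))
           (∑-zero (upTo (suc n)) λ k → refl)) (sym (∑-[] _)))
      (λ x pre post → trans (∑-zero (upTo (suc n)) λ k →
           trans (cong (_*_ (x c k)) (det-zero-row m (suc c) r
              (λ j k c<j j<c+m → r≡0 j k (ℕₚ.<⇒≤ c<j) (subst (j ℕ.<_) (sym (ℕₚ.+-suc c m)) j<c+m)) pre post (k ∷ π)))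
             (ℤₚ.*-zeroʳ (x c k))) (sym (∑-[] _)))
      pre post) (∑-[] _)))
    (ℤₚ.*-zeroʳ (sign m))

  det-repeat : ∀ m c (r : Row) pre post π → det m c (pre ++ r ∷ r ∷ post) π ≡ + 0
  det-repeat zero    c r []      post π = refl
  det-repeat zero    c r (_ ∷ _) post π = refl
  det-repeat (suc m) c r pre     post π = trans
    (cong (_*_ (sign m)) (lap-repeat r _ (λ x pre post → ∑-zero (upTo (suc n)) λ k →
      trans (cong (_*_ (x c k)) (det-repeat m (suc c) r pre post (k ∷ π))) (ℤₚ.*-zeroʳ (x c k))) pre post))
    (ℤₚ.*-zeroʳ (sign m))

  -- Row j ↦ h_{b−j} of a Jacobi–Trudi matrix, and its tail sum j ↦ Σ_{c ≥ b} h_{c−j};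
  -- the generators h_k with k > n are dropped.
  v R : ℕ → Row
  v b j k = ⟦ b ℕ.≡ᵇ j ℕ.+ k ⟧
  R b j k = ⟦ b ℕ.≤ᵇ j ℕ.+ k ⟧

  R-suc : ∀ b j k → R b (suc j) k ≡ v b (suc j) k + R b j k
  R-suc zero    j k = refl
  R-suc (suc b) j k = go b (j ℕ.+ k)
    where
    go : ∀ b a → ⟦ b ℕ.<ᵇ suc a ⟧ ≡ ⟦ b ℕ.≡ᵇ a ⟧ + ⟦ b ℕ.<ᵇ a ⟧
    go zero    zero    = refl
    go zero    (suc a) = refl
    go (suc b) zero    = refl
    go (suc b) (suc a) = go b a

  -- By R-suc, subtracting each column from the next turns all columns but the first from R into v.
  det-R : ∀ m c bs π → det (suc m) c (map R bs) π ≡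
    sign m * lap (λ b bs′ → ∑[ k ← upTo (suc n) ] R b c k * det m (suc c) (map v bs′) (k ∷ π)) bs
  det-R zero    c bs π = cong (_*_ (+ 1)) (trans (lap-map R _ bs) (lap-cong bs λ b bs′ →
    ∑-cong (upTo (suc n)) λ k → cong (_*_ (R b c k)) (same bs′ k)))
    where
    same : ∀ bs k → det 0 (suc c) (map R bs) (k ∷ π) ≡ det 0 (suc c) (map v bs) (k ∷ π)
    same []      k = refl
    same (_ ∷ _) k = refl
  det-R (suc m) c bs π = cong (_*_ (sign (suc m))) (begin
    lap (λ r rs → ∑[ k ← K ] r c k * det (suc m) (suc c) rs (k ∷ π)) (map R bs)
      ≡⟨ lap-map R _ bs ⟩
    lap (λ b bs′ → ∑[ k ← K ] R b c k * det (suc m) (suc c) (map R bs′) (k ∷ π)) bs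
      ≡⟨ lap-cong bs (λ b bs′ → trans (∑-cong K λ k → trans
           (cong (_*_ (R b c k)) (split bs′ k)) (ℤₚ.*-distribˡ-+ (R b c k) _ _)) (∑-+ K _ _)) ⟩
    lap (λ b bs′ → (∑[ k ← K ] R b c k * det (suc m) (suc c) (map v bs′) (k ∷ π)) +
                   (∑[ k ← K ] R b c k * (sign m * lap (λ b′ → E b′ k) bs′))) bs
      ≡⟨ lap-+ _ _ bs ⟩
    lap (λ b bs′ → ∑[ k ← K ] R b c k * det (suc m) (suc c) (map v bs′) (k ∷ π)) bs +
    lap (λ b bs′ → ∑[ k ← K ] R b c k * (sign m * lap (λ b′ → E b′ k) bs′)) bs
      -- The second summand has the tail sums of column `c` in both of its first two columns, so it
      -- expands a determinant with two equal columns.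
      ≡⟨ cong (_+_ (lap _ bs)) (trans
           (lap-cong bs λ b bs′ → trans (∑-cong K λ k → sym (pull b k bs′)) (sym (lap-∑ K _ bs′)))
           (lap-lap (λ b b′ bs″ → ∑[ k ← K ] R b c k * (sign m * E b′ k bs″)) E-sym bs)) ⟩
    lap (λ b bs′ → ∑[ k ← K ] R b c k * det (suc m) (suc c) (map v bs′) (k ∷ π)) bs + + 0
      ≡⟨ ℤₚ.+-identityʳ _ ⟩
    lap (λ b bs′ → ∑[ k ← K ] R b c k * det (suc m) (suc c) (map v bs′) (k ∷ π)) bs ∎)
    where
    open ≡-Reasoning
    K = upTo (suc n)
    E : ℕ → ℕ → List ℕ → ℤ
    E b k bs = ∑[ l ← K ] R b c l * det m (suc (suc c)) (map v bs) (l ∷ k ∷ π)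
    pull : ∀ b k bs′ → lap (λ b′ bs″ → R b c k * (sign m * E b′ k bs″)) bs′ ≡
                       R b c k * (sign m * lap (λ b′ → E b′ k) bs′)
    pull b k bs′ = trans (lap-* (R b c k) _ bs′) (cong (_*_ (R b c k)) (lap-* (sign m) _ bs′))
    split : ∀ bs′ k → det (suc m) (suc c) (map R bs′) (k ∷ π) ≡
                      det (suc m) (suc c) (map v bs′) (k ∷ π) + sign m * lap (λ b′ → E b′ k) bs′
    split bs′ k = begin
      det (suc m) (suc c) (map R bs′) (k ∷ π)
        ≡⟨ det-R m (suc c) bs′ (k ∷ π) ⟩
      sign m * lap (λ b bs″ → ∑[ l ← K ] R b (suc c) l * det m (suc (suc c)) (map v bs″) (l ∷ k ∷ π)) bs′
        ≡⟨ cong (_*_ (sign m)) (trans (lap-cong bs′ λ b bs″ → trans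
             (∑-cong K λ l → trans (cong (_* det m (suc (suc c)) (map v bs″) (l ∷ k ∷ π)) (R-suc b c l))
                (ℤₚ.*-distribʳ-+ (det m (suc (suc c)) (map v bs″) (l ∷ k ∷ π)) (v b (suc c) l) (R b c l))) (∑-+ K _ _)) (lap-+ _ _ bs′)) ⟩
      sign m * (lap (λ b bs″ → ∑[ l ← K ] v b (suc c) l * det m (suc (suc c)) (map v bs″) (l ∷ k ∷ π)) bs′
                + lap (λ b′ → E b′ k) bs′)
        ≡⟨ ℤₚ.*-distribˡ-+ (sign m) _ _ ⟩
      sign m * lap (λ b bs″ → ∑[ l ← K ] v b (suc c) l * det m (suc (suc c)) (map v bs″) (l ∷ k ∷ π)) bs′
                + sign m * lap (λ b′ → E b′ k) bs′
        ≡⟨ cong (λ e → sign m * e + sign m * lap (λ b′ → E b′ k) bs′) (lap-map v _ bs′) ⟨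
      det (suc m) (suc c) (map v bs′) (k ∷ π) + sign m * lap (λ b′ → E b′ k) bs′ ∎
    -- Interchanging `k` and `l` commutes the two entries, which `det-↭` permits.
    E-sym : ∀ b b′ bs → (∑[ k ← K ] R b c k * (sign m * E b′ k bs)) ≡ (∑[ k ← K ] R b′ c k * (sign m * E b k bs))
    E-sym b b′ bs = begin
      (∑[ k ← K ] R b c k * (sign m * E b′ k bs))
        ≡⟨ ∑-cong K (λ k → expand b b′ k) ⟩
      (∑[ k ← K ] ∑[ l ← K ] sign m * (R b c k * R b′ c l * det m (suc (suc c)) (map v bs) (l ∷ k ∷ π)))
        ≡⟨ ∑-swap K K _ ⟩
      (∑[ l ← K ] ∑[ k ← K ] sign m * (R b c k * R b′ c l * det m (suc (suc c)) (map v bs) (l ∷ k ∷ π)))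
        ≡⟨ ∑-cong K (λ l → ∑-cong K λ k → cong (_*_ (sign m)) (cong₂ _*_ (ℤₚ.*-comm (R b c k) (R b′ c l))
             (det-↭ m (suc (suc c)) (map v bs) (↭-swap l k ↭-refl)))) ⟩
      (∑[ l ← K ] ∑[ k ← K ] sign m * (R b′ c l * R b c k * det m (suc (suc c)) (map v bs) (k ∷ l ∷ π)))
        ≡⟨ ∑-cong K (λ l → expand b′ b l) ⟨
      (∑[ l ← K ] R b′ c l * (sign m * E b l bs)) ∎
      where
      lemma : ∀ x s y d → x * (s * (y * d)) ≡ s * (x * y * d)
      lemma = solve-∀
      expand : ∀ b b′ k → R b c k * (sign m * E b′ k bs) ≡
        (∑[ l ← K ] sign m * (R b c k * R b′ c l * det m (suc (suc c)) (map v bs) (l ∷ k ∷ π)))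
      expand b b′ k = trans (cong (_*_ (R b c k)) (sym (∑-*ˡ (sign m) K _)))
        (trans (sym (∑-*ˡ (R b c k) K _))
          (∑-cong K λ l → lemma (R b c k) (sign m) (R b′ c l) _))

  -- An entry `h_(b − c)` depends only on the difference of the row number and the column number.
  det-shift : ∀ m c bs π → det m (suc c) (map v (map suc bs)) π ≡ det m c (map v bs) π
  det-shift zero    c []      π = refl
  det-shift zero    c (_ ∷ _) π = refl
  det-shift (suc m) c bs      π = cong (_*_ (sign m))
    (trans (lap-map v _ (map suc bs)) (trans (lap-map suc _ bs) (trans
      (lap-cong bs λ b bs′ → ∑-cong (upTo (suc n)) λ k →
        cong (_*_ (v b c k)) (det-shift m (suc c) bs′ (k ∷ π)))
      (sym (lap-map v _ bs)))))

  -- This is `h_0 = 1`. Each expansion puts a new index in front of the `0`, which `det-↭` brings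
  -- back to the head.
  det-drop-0 : ∀ m c rows π → det m c rows (0 ∷ π) ≡ det m c rows π
  det-drop-0 zero    c []      π = F-0 π
  det-drop-0 zero    c (_ ∷ _) π = refl
  det-drop-0 (suc m) c rows    π = cong (_*_ (sign m)) (lap-cong rows λ r rs →
    ∑-cong (upTo (suc n)) λ k → cong (_*_ (r c k))
      (trans (det-↭ m (suc c) rs (↭-swap k 0 ↭-refl)) (det-drop-0 m (suc c) rs (k ∷ π))))

  -- The row `v 0` is zero in every column after column 0, so the expansion along column 0 has to
  -- take the row numbered 0 there. The parameter `e` is `v` or `R`, the two kinds of entries that
  -- column 0 can have; `sign m` cancels the sign from `lap-last`.
  lap-last-0 : ∀ (e : ℕ → Row) m bs π → length bs ≡ m →
    sign m * lap (λ b bs′ → ∑[ k ← upTo (suc n) ] e b 0 k * det m 1 (map v bs′) (k ∷ π)) (bs ++ 0 ∷ [])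
    ≡ ∑[ k ← upTo (suc n) ] e 0 0 k * det m 1 (map v bs) (k ∷ π)
  lap-last-0 e m bs π refl = begin
    sign m * lap φ (bs ++ 0 ∷ [])
      ≡⟨ cong (_*_ (sign m)) (lap-last φ bs 0 λ b bs′ → ∑-zero (upTo (suc n)) λ k →
           trans (cong (_*_ (e b 0 k)) (trans (cong (λ rs → det m 1 rs (k ∷ π)) (Listₚ.map-++ v bs′ (0 ∷ [])))
             (det-zero-row m 1 (v 0) (λ { (suc j) k _ _ _ → refl }) (map v bs′) [] (k ∷ π))))
             (ℤₚ.*-zeroʳ (e b 0 k))) ⟩
    sign m * (sign m * φ 0 bs)
      ≡⟨ ℤₚ.*-assoc (sign m) (sign m) _ ⟨
    sign m * sign m * φ 0 bs
      ≡⟨ cong (_* φ 0 bs) (sign² m) ⟩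
    + 1 * φ 0 bs
      ≡⟨ ℤₚ.*-identityˡ _ ⟩
    φ 0 bs ∎
    where
    open ≡-Reasoning
    φ : ℕ → List ℕ → ℤ
    φ b bs′ = ∑[ k ← upTo (suc n) ] e b 0 k * det m 1 (map v bs′) (k ∷ π)

  -- The value of F at h_π s_μ, by the Jacobi–Trudi formula.
  J : List ℕ → List ℕ → ℤ
  J μ π = det (length μ) 0 (map v (stair μ)) π

  J-snoc-0 : ∀ μ π → J (μ ++ 0 ∷ []) π ≡ J μ π
  J-snoc-0 μ π = begin
    det (length (μ ++ 0 ∷ [])) 0 (map v (stair (μ ++ 0 ∷ []))) π
      ≡⟨ cong₂ (λ m bs → det m 0 (map v bs) π)
           (trans (Listₚ.length-++ μ) (ℕₚ.+-comm (length μ) 1)) (stair-snoc μ) ⟩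
    det (suc (length μ)) 0 (map v (map suc (stair μ) ++ 0 ∷ [])) π
      ≡⟨ cong (_*_ (sign (length μ))) (lap-map v _ (map suc (stair μ) ++ 0 ∷ [])) ⟩
    sign (length μ) * lap (λ b bs′ → ∑[ k ← upTo (suc n) ] v b 0 k * det (length μ) 1 (map v bs′) (k ∷ π))
                          (map suc (stair μ) ++ 0 ∷ [])
      ≡⟨ lap-last-0 v (length μ) (map suc (stair μ)) π
           (trans (Listₚ.length-map suc (stair μ)) (length-stair μ)) ⟩
    (∑[ k ← upTo (suc n) ] ⟦ 0 ℕ.≡ᵇ k ⟧ * det (length μ) 1 (map v (map suc (stair μ))) (k ∷ π))
      ≡⟨ ∑-δ (suc n) 0 _ (s≤s z≤n) ⟩
    det (length μ) 1 (map v (map suc (stair μ))) (0 ∷ π)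
      ≡⟨ det-drop-0 (length μ) 1 (map v (map suc (stair μ))) π ⟩
    det (length μ) 1 (map v (map suc (stair μ))) π
      ≡⟨ det-shift (length μ) 0 (stair μ) π ⟩
    J μ π ∎
    where open ≡-Reasoning

  -- After the column operation tail sums remain only in column 0, where the last row, numbered 0,
  -- has the entry `h_0 + … + h_n`. Expanding along that column multiplies `s_μ` by this sum.
  det-R-snoc-0 : ∀ μ π → det (length (μ ++ 0 ∷ [])) 0 (map R (stair (μ ++ 0 ∷ []))) π ≡
                 ∑[ k ← upTo (suc n) ] J (μ ++ 0 ∷ []) (k ∷ π)
  det-R-snoc-0 μ π = begin
    det (length (μ ++ 0 ∷ [])) 0 (map R (stair (μ ++ 0 ∷ []))) π
      ≡⟨ cong₂ (λ m bs → det m 0 (map R bs) π)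
           (trans (Listₚ.length-++ μ) (ℕₚ.+-comm (length μ) 1)) (stair-snoc μ) ⟩
    det (suc (length μ)) 0 (map R (map suc (stair μ) ++ 0 ∷ [])) π
      ≡⟨ det-R (length μ) 0 (map suc (stair μ) ++ 0 ∷ []) π ⟩
    sign (length μ) * lap (λ b bs′ → ∑[ k ← upTo (suc n) ] R b 0 k * det (length μ) 1 (map v bs′) (k ∷ π))
                          (map suc (stair μ) ++ 0 ∷ [])
      ≡⟨ lap-last-0 R (length μ) (map suc (stair μ)) π
           (trans (Listₚ.length-map suc (stair μ)) (length-stair μ)) ⟩
    (∑[ k ← upTo (suc n) ] + 1 * det (length μ) 1 (map v (map suc (stair μ))) (k ∷ π))
      ≡⟨ ∑-cong (upTo (suc n)) (λ k → trans (ℤₚ.*-identityˡ _)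
           (trans (det-shift (length μ) 0 (stair μ) (k ∷ π)) (sym (J-snoc-0 μ (k ∷ π))))) ⟩
    (∑[ k ← upTo (suc n) ] J (μ ++ 0 ∷ []) (k ∷ π)) ∎
    where open ≡-Reasoning

  -- The leftover tail starts at `u + suc q` because this is the staircase entry of a part `u` that
  -- comes just before a part with `q` parts after it. When `u` is the preceding part, the leftover
  -- is therefore the completed row of `u`.
  R-interval : ∀ m u q → m ℕ.≤ u → u ℕ.≤ n → ∀ j k →
    R (m ℕ.+ q) j k ≡ (∑[ l ← upTo (suc n) ] ⟦ (m ℕ.≤ᵇ l) ∧ (l ℕ.≤ᵇ u) ⟧ * v (l ℕ.+ q) j k)
                      + R (u ℕ.+ suc q) j k
  R-interval m u q m≤u u≤n j k = go (j ℕ.+ k)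
    where
    open ≡-Reasoning
    term-zero : ∀ a → (∀ l → l ℕ.≤ u → l ℕ.+ q ≡ a → ⊥) →
      (∑[ l ← upTo (suc n) ] ⟦ (m ℕ.≤ᵇ l) ∧ (l ℕ.≤ᵇ u) ⟧ * ⟦ l ℕ.+ q ℕ.≡ᵇ a ⟧) ≡ + 0
    term-zero a ne = ∑-zero (upTo (suc n)) λ l → trans
      (⟦⟧-guard ((m ℕ.≤ᵇ l) ∧ (l ℕ.≤ᵇ u)) λ p → ⟦⟧-false λ e → ne l (≤ᵇ⁻ (proj₂ (∧⁻ p))) (≡ᵇ⁻ e))
      (ℤₚ.*-zeroʳ ⟦ (m ℕ.≤ᵇ l) ∧ (l ℕ.≤ᵇ u) ⟧)
    go : ∀ a → ⟦ m ℕ.+ q ℕ.≤ᵇ a ⟧ ≡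
      (∑[ l ← upTo (suc n) ] ⟦ (m ℕ.≤ᵇ l) ∧ (l ℕ.≤ᵇ u) ⟧ * ⟦ l ℕ.+ q ℕ.≡ᵇ a ⟧) + ⟦ u ℕ.+ suc q ℕ.≤ᵇ a ⟧
    go a with a ℕₚ.≤? u ℕ.+ q
    ... | no a≰u+q = begin
      ⟦ m ℕ.+ q ℕ.≤ᵇ a ⟧ ≡⟨ cong ⟦_⟧ (≤ᵇ⁺ (ℕₚ.≤-trans (ℕₚ.+-monoˡ-≤ q m≤u) (ℕₚ.<⇒≤ (ℕₚ.≰⇒> a≰u+q)))) ⟩
      + 1 ≡⟨ cong₂ _+_ (term-zero a λ l l≤u e → a≰u+q (subst (ℕ._≤ u ℕ.+ q) e (ℕₚ.+-monoˡ-≤ q l≤u)))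
               (cong ⟦_⟧ (≤ᵇ⁺ (subst (ℕ._≤ a) (sym (ℕₚ.+-suc u q)) (ℕₚ.≰⇒> a≰u+q)))) ⟨
      _ ∎
    ... | yes a≤u+q with q ℕₚ.≤? a
    ...   | no q≰a = begin
      ⟦ m ℕ.+ q ℕ.≤ᵇ a ⟧ ≡⟨ ⟦⟧-false (λ p → q≰a (ℕₚ.≤-trans (ℕₚ.m≤n+m q m) (≤ᵇ⁻ p))) ⟩
      + 0 ≡⟨ cong₂ _+_ (term-zero a λ l l≤u e → q≰a (subst (q ℕ.≤_) e (ℕₚ.m≤n+m q l)))
               (⟦⟧-false λ p → ℕₚ.<⇒≱ (subst (ℕ._≤ a) (ℕₚ.+-suc u q) (≤ᵇ⁻ p)) a≤u+q) ⟨
      _ ∎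
    -- Here `q ≤ a ≤ u + q`, and the only index that can contribute is `l = a ∸ q`.
    ...   | yes q≤a = begin
      ⟦ m ℕ.+ q ℕ.≤ᵇ a ⟧
        ≡⟨ cong ⟦_⟧ (true-ext (λ p → ∧⁺ (≤ᵇ⁺ (ℕₚ.m+n≤o⇒m≤o∸n m (≤ᵇ⁻ p))) (≤ᵇ⁺ d≤u))
             (λ p → ≤ᵇ⁺ (subst (m ℕ.+ q ℕ.≤_) (ℕₚ.m∸n+n≡m q≤a) (ℕₚ.+-monoˡ-≤ q (≤ᵇ⁻ {m} {a ℕ.∸ q} (proj₁ (∧⁻ p))))))) ⟩
      ⟦ (m ℕ.≤ᵇ d) ∧ (d ℕ.≤ᵇ u) ⟧
        ≡⟨ ∑-δ (suc n) d (λ l → ⟦ (m ℕ.≤ᵇ l) ∧ (l ℕ.≤ᵇ u) ⟧) (s≤s (ℕₚ.≤-trans d≤u u≤n)) ⟨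
      (∑[ l ← upTo (suc n) ] ⟦ d ℕ.≡ᵇ l ⟧ * ⟦ (m ℕ.≤ᵇ l) ∧ (l ℕ.≤ᵇ u) ⟧)
        ≡⟨ ∑-cong (upTo (suc n)) (λ l → trans (ℤₚ.*-comm ⟦ d ℕ.≡ᵇ l ⟧ _) (cong (λ b → ⟦ (m ℕ.≤ᵇ l) ∧ (l ℕ.≤ᵇ u) ⟧ * ⟦ b ⟧)
             (true-ext (λ p → ≡ᵇ⁺ (trans (cong (ℕ._+ q) (sym (≡ᵇ⁻ {d} {l} p))) (ℕₚ.m∸n+n≡m q≤a)))
                       (λ p → ≡ᵇ⁺ (trans (cong (ℕ._∸ q) (sym (≡ᵇ⁻ {l ℕ.+ q} {a} p))) (ℕₚ.m+n∸n≡m l q)))))) ⟩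
      (∑[ l ← upTo (suc n) ] ⟦ (m ℕ.≤ᵇ l) ∧ (l ℕ.≤ᵇ u) ⟧ * ⟦ l ℕ.+ q ℕ.≡ᵇ a ⟧)
        ≡⟨ ℤₚ.+-identityʳ _ ⟨
      (∑[ l ← upTo (suc n) ] ⟦ (m ℕ.≤ᵇ l) ∧ (l ℕ.≤ᵇ u) ⟧ * ⟦ l ℕ.+ q ℕ.≡ᵇ a ⟧) + + 0
        ≡⟨ cong (_+_ (∑[ l ← upTo (suc n) ] ⟦ (m ℕ.≤ᵇ l) ∧ (l ℕ.≤ᵇ u) ⟧ * ⟦ l ℕ.+ q ℕ.≡ᵇ a ⟧))
             (⟦⟧-false λ p → ℕₚ.<⇒≱ (subst (ℕ._≤ a) (ℕₚ.+-suc u q) (≤ᵇ⁻ p)) a≤u+q) ⟨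
      _ ∎
      where
      d = a ℕ.∸ q
      d≤u : d ℕ.≤ u
      d≤u = subst (d ℕ.≤_) (ℕₚ.m+n∸n≡m u q) (ℕₚ.∸-monoˡ-≤ q a≤u+q)

  -- The row operation behind the Pieri rule: a partial sum of rows v may be completed to a row R when
  -- the missing tail contributes nothing.
  det-R-interval : ∀ M m u q pre post π → m ℕ.≤ u → u ℕ.≤ n →
    det M 0 (pre ++ R (u ℕ.+ suc q) ∷ post) π ≡ + 0 →
    (∑[ l ← upTo (suc n) ] ⟦ (m ℕ.≤ᵇ l) ∧ (l ℕ.≤ᵇ u) ⟧ * det M 0 (pre ++ v (l ℕ.+ q) ∷ post) π) ≡
    det M 0 (pre ++ R (m ℕ.+ q) ∷ post) π
  det-R-interval M m u q pre post π m≤u u≤n u-zero = sym (begin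
    det M 0 (pre ++ R (m ℕ.+ q) ∷ post) π
      ≡⟨ det-linear (nothing ∷ map just (upTo (suc n))) w ρ (R (m ℕ.+ q))
           (λ j k → trans (R-interval m u q m≤u u≤n j k) (sym (expand (λ r → r j k)))) M 0 pre post π ⟩
    (∑[ i ← nothing ∷ map just (upTo (suc n)) ] w i * det M 0 (pre ++ ρ i ∷ post) π)
      ≡⟨ expand (λ r → det M 0 (pre ++ r ∷ post) π) ⟩
    S + det M 0 (pre ++ R (u ℕ.+ suc q) ∷ post) π
      ≡⟨ cong (_+_ S) u-zero ⟩
    S + + 0
      ≡⟨ ℤₚ.+-identityʳ _ ⟩
    S ∎)
    where
    open ≡-Reasoning
    S = ∑[ l ← upTo (suc n) ] ⟦ (m ℕ.≤ᵇ l) ∧ (l ℕ.≤ᵇ u) ⟧ * det M 0 (pre ++ v (l ℕ.+ q) ∷ post) π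
    w : Maybe ℕ → ℤ
    w nothing  = + 1
    w (just l) = ⟦ (m ℕ.≤ᵇ l) ∧ (l ℕ.≤ᵇ u) ⟧
    ρ : Maybe ℕ → Row
    ρ nothing  = R (u ℕ.+ suc q)
    ρ (just l) = v (l ℕ.+ q)
    expand : ∀ (f : Row → ℤ) → (∑[ i ← nothing ∷ map just (upTo (suc n)) ] w i * f (ρ i)) ≡
      (∑[ l ← upTo (suc n) ] ⟦ (m ℕ.≤ᵇ l) ∧ (l ℕ.≤ᵇ u) ⟧ * f (v (l ℕ.+ q))) + f (R (u ℕ.+ suc q))
    expand f = trans (∑-∷ nothing (map just (upTo (suc n))) (λ i → w i * f (ρ i)))
      (trans (cong₂ _+_ (ℤₚ.*-identityˡ (f (R (u ℕ.+ suc q)))) (∑-map (upTo (suc n)) just _))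
        (ℤₚ.+-comm (f (R (u ℕ.+ suc q))) _))

  -- Rows are completed from the first on. Letting a part run from `m` to `u` turns its row `v` into
  -- the row `R` of `m` minus a tail, and that tail repeats the completed row of `u` at the end of
  -- `pre`, so it contributes nothing. The first row has no predecessor, which is why the vanishing
  -- is a hypothesis.
  ∑-interlaced : ∀ M ms pre u π → u ℕ.≤ n → decreasingᵇ (u ∷ ms) ≡ true →
    (∀ post → suc (length post) ≡ length ms → det M 0 (pre ++ R (u ℕ.+ length ms) ∷ post) π ≡ + 0) →
    (∑[ ls ← listsOfLen (length ms) (upTo (suc n)) ]
      ⟦ interlaced u ms ls ⟧ * det M 0 (pre ++ map v (stair ls)) π) ≡
    det M 0 (pre ++ map R (stair ms)) π
  ∑-interlaced M [] pre u π u≤n dec u-zero =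
    trans (∑-single [] (λ ls → ⟦ interlaced u [] ls ⟧ * det M 0 (pre ++ map v (stair ls)) π))
      (ℤₚ.*-identityˡ (det M 0 (pre ++ []) π))
  ∑-interlaced M (m ∷ ms) pre u π u≤n dec u-zero = begin
    (∑[ ls ← listsOfLen (suc q) K ] ⟦ interlaced u (m ∷ ms) ls ⟧ * det M 0 (pre ++ map v (stair ls)) π)
      ≡⟨ ∑-listsOfLen q K _ ⟩
    (∑[ l ← K ] ∑[ ls ← listsOfLen q K ] ⟦ c l ∧ interlaced m ms ls ⟧ * D (l ℕ.+ length ls) ls)
      ≡⟨ ∑-cong K (λ l → ∑-congᴬ (all-length-listsOfLen q K) λ ls len →
           trans (cong₂ _*_ (⟦⟧-∧ (c l) (interlaced m ms ls)) (cong (λ a → D (l ℕ.+ a) ls) len))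
                 (lemma ⟦ c l ⟧ ⟦ interlaced m ms ls ⟧ _)) ⟩
    (∑[ l ← K ] ∑[ ls ← listsOfLen q K ] ⟦ interlaced m ms ls ⟧ * (⟦ c l ⟧ * D (l ℕ.+ q) ls))
      ≡⟨ ∑-swap K (listsOfLen q K) _ ⟩
    (∑[ ls ← listsOfLen q K ] ∑[ l ← K ] ⟦ interlaced m ms ls ⟧ * (⟦ c l ⟧ * D (l ℕ.+ q) ls))
      ≡⟨ ∑-congᴬ (all-length-listsOfLen q K) (λ ls len → trans (∑-*ˡ ⟦ interlaced m ms ls ⟧ K _)
           (cong (_*_ ⟦ interlaced m ms ls ⟧) (det-R-interval M m u q pre (map v (stair ls)) π m≤u u≤n
             (u-zero _ (cong suc (trans (Listₚ.length-map v (stair ls)) (trans (length-stair ls) len))))))) ⟩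
    (∑[ ls ← listsOfLen q K ] ⟦ interlaced m ms ls ⟧ * det M 0 (pre ++ R (m ℕ.+ q) ∷ map v (stair ls)) π)
      ≡⟨ ∑-cong (listsOfLen q K) (λ ls → cong (λ rs → ⟦ interlaced m ms ls ⟧ * det M 0 rs π)
           (Listₚ.∷ʳ-++ pre (R (m ℕ.+ q)) (map v (stair ls)))) ⟨
    (∑[ ls ← listsOfLen q K ] ⟦ interlaced m ms ls ⟧ * det M 0 ((pre ++ R (m ℕ.+ q) ∷ []) ++ map v (stair ls)) π)
      ≡⟨ ∑-interlaced M ms (pre ++ R (m ℕ.+ q) ∷ []) m π (ℕₚ.≤-trans m≤u u≤n) (proj₂ (∧⁻ dec))
           (λ post _ → trans (cong (λ rs → det M 0 rs π) (Listₚ.∷ʳ-++ pre (R (m ℕ.+ q)) _))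
              (det-repeat M 0 (R (m ℕ.+ q)) pre post π)) ⟩
    det M 0 ((pre ++ R (m ℕ.+ q) ∷ []) ++ map R (stair ms)) π
      ≡⟨ cong (λ rs → det M 0 rs π) (Listₚ.∷ʳ-++ pre (R (m ℕ.+ q)) _) ⟩
    det M 0 (pre ++ map R (stair (m ∷ ms))) π ∎
    where
    open ≡-Reasoning
    K = upTo (suc n)
    q = length ms
    c : ℕ → Bool
    c l = (m ℕ.≤ᵇ l) ∧ (l ℕ.≤ᵇ u)
    D : ℕ → List ℕ → ℤ
    D b ls = det M 0 (pre ++ v b ∷ map v (stair ls)) π
    m≤u : m ℕ.≤ u
    m≤u = ≤ᵇ⁻ (proj₁ (∧⁻ dec))
    lemma : ∀ a b d → a * b * d ≡ b * (a * d)
    lemma = solve-∀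

  -- h_k s_μ summed over all k, which avoids tracking degrees; F-support restores them later.
  pieri : ∀ μ π → decreasingᵇ (n ∷ μ ++ 0 ∷ []) ≡ true →
    (∑[ κ ← listsOfLen (length (μ ++ 0 ∷ [])) (upTo (suc n)) ] ⟦ interlaced n (μ ++ 0 ∷ []) κ ⟧ * J κ π) ≡
    (∑[ k ← upTo (suc n) ] J (μ ++ 0 ∷ []) (k ∷ π))
  pieri μ π dec = begin
    (∑[ κ ← listsOfLen M (upTo (suc n)) ] ⟦ interlaced n μ0 κ ⟧ * J κ π)
      ≡⟨ ∑-congᴬ (all-length-listsOfLen M (upTo (suc n))) (λ κ len →
           cong (λ m → ⟦ interlaced n μ0 κ ⟧ * det m 0 (map v (stair κ)) π) len) ⟩
    (∑[ κ ← listsOfLen M (upTo (suc n)) ] ⟦ interlaced n μ0 κ ⟧ * det M 0 (map v (stair κ)) π)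
      -- For the first row the tail is zero outright: it starts at `n + M`, which exceeds `j + k`
      -- for all `j < M` and `k ≤ n`.
      ≡⟨ ∑-interlaced M μ0 [] n π ℕₚ.≤-refl dec (λ post len → det-zero-row M 0 _
           (λ j k _ j<M k≤n → ⟦⟧-false λ p → ℕₚ.<⇒≱ (ℕₚ.+-mono-<-≤ j<M k≤n)
              (subst (ℕ._≤ j ℕ.+ k) (ℕₚ.+-comm n M) (≤ᵇ⁻ p))) [] post π) ⟩
    det M 0 (map R (stair μ0)) π
      ≡⟨ det-R-snoc-0 μ π ⟩
    (∑[ k ← upTo (suc n) ] J μ0 (k ∷ π)) ∎
    where
    open ≡-Reasoning
    μ0 = μ ++ 0 ∷ []
    M = length μ0

  -- Homogeneity: a nonzero term matches every row number `b` with a column `j` and the index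
  -- `k = b − j`, and the column numbers add up to `tri c m`.
  det-support : ∀ m c bs π → ¬ (sum bs ℕ.+ sum π ≡ n ℕ.+ tri c m) → det m c (map v bs) π ≡ + 0
  det-support zero    c []      π ne = F-support π λ e → ne (trans e (sym (ℕₚ.+-identityʳ n)))
  det-support zero    c (_ ∷ _) π ne = refl
  det-support (suc m) c bs      π ne = trans (cong (_*_ (sign m)) (trans (lap-map v _ bs)
    (trans (lap-cong↭ {ψ = λ _ _ → + 0} bs λ b bs′ p → ∑-zero (upTo (suc n)) λ k → trans
      (⟦⟧-guard (b ℕ.≡ᵇ c ℕ.+ k) λ e → det-support m (suc c) bs′ (k ∷ π) λ e′ → ne (begin
        sum bs ℕ.+ sum π                 ≡⟨ cong (ℕ._+ sum π) (ListActₚ.sum-↭ p) ⟨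
        b ℕ.+ sum bs′ ℕ.+ sum π          ≡⟨ cong (λ b → b ℕ.+ sum bs′ ℕ.+ sum π) (≡ᵇ⁻ {b} {c ℕ.+ k} e) ⟩
        c ℕ.+ k ℕ.+ sum bs′ ℕ.+ sum π    ≡⟨ lemma₁ c k (sum bs′) (sum π) ⟩
        c ℕ.+ (sum bs′ ℕ.+ (k ℕ.+ sum π)) ≡⟨ cong (c ℕ.+_) e′ ⟩
        c ℕ.+ (n ℕ.+ tri (suc c) m)      ≡⟨ lemma₂ c n (tri (suc c) m) ⟩
        n ℕ.+ (c ℕ.+ tri (suc c) m)      ∎)) (ℤₚ.*-zeroʳ ⟦ b ℕ.≡ᵇ c ℕ.+ k ⟧))
      (lap-zero bs λ _ _ → refl)))) (ℤₚ.*-zeroʳ (sign m))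
    where
    open ≡-Reasoning
    lemma₁ : ∀ c k s p → c ℕ.+ k ℕ.+ s ℕ.+ p ≡ c ℕ.+ (s ℕ.+ (k ℕ.+ p))
    lemma₁ = ℕ-solve-∀
    lemma₂ : ∀ c n t → c ℕ.+ (n ℕ.+ t) ≡ n ℕ.+ (c ℕ.+ t)
    lemma₂ = ℕ-solve-∀

  J-support : ∀ μ π → ¬ (sum μ ℕ.+ sum π ≡ n) → J μ π ≡ + 0
  J-support μ π ne = det-support (length μ) 0 (stair μ) π λ e → ne (ℕₚ.+-cancelʳ-≡ (tri 0 (length μ)) _ _
    (trans (lemma (sum μ) (sum π) (tri 0 (length μ))) (trans (cong (ℕ._+ sum π) (sym (sum-stair μ))) e)))
    where
    lemma : ∀ a b c → a ℕ.+ b ℕ.+ c ≡ a ℕ.+ c ℕ.+ b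
    lemma = ℕ-solve-∀

-- Kostka numbers

tabulate-snoc : {A : Set} (N : ℕ) (f : Fin (suc N) → A) →
                tabulate f ≡ tabulate (f ∘ inject₁) ++ f (fromℕ N) ∷ []
tabulate-snoc zero    f = refl
tabulate-snoc (suc N) f = cong (f zero ∷_) (tabulate-snoc N (f ∘ suc))

∑-allFin-snoc : (N : ℕ) (g : Fin (suc N) → ℤ) →
                ∑ (allFin (suc N)) g ≡ ∑ (allFin N) (g ∘ inject₁) + g (fromℕ N)
∑-allFin-snoc N g = begin
  ∑ (allFin (suc N)) g
    ≡⟨ cong (λ xs → ∑ xs g) (tabulate-snoc N id) ⟩
  ∑ (tabulate inject₁ ++ fromℕ N ∷ []) g
    ≡⟨ ∑-++ (tabulate inject₁) (fromℕ N ∷ []) g ⟩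
  ∑ (tabulate inject₁) g + ∑ (fromℕ N ∷ []) g
    ≡⟨ cong₂ _+_ (trans (cong (λ xs → ∑ xs g) (sym (Listₚ.map-tabulate id inject₁)))
                        (∑-map (allFin N) inject₁ g)) (∑-single (fromℕ N) g) ⟩
  ∑ (allFin N) (g ∘ inject₁) + g (fromℕ N) ∎
  where open ≡-Reasoning

allᵇ⁻ : {A : Set} {p : A → Bool} {xs : List A} → allᵇ p xs ≡ true → All (λ x → p x ≡ true) xs
allᵇ⁻ {xs = []}     _ = []
allᵇ⁻ {xs = x ∷ xs} e = proj₁ (∧⁻ e) ∷ allᵇ⁻ (proj₂ (∧⁻ e))

allᵇ⁺ : {A : Set} {p : A → Bool} {xs : List A} → All (λ x → p x ≡ true) xs → allᵇ p xs ≡ true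
allᵇ⁺ []       = refl
allᵇ⁺ (e ∷ es) = ∧⁺ e (allᵇ⁺ es)

allFinᵇ⁻ : ∀ {N} {p : Fin N → Bool} → allᵇ p (allFin N) ≡ true → ∀ i → p i ≡ true
allFinᵇ⁻ e = Allₚ.tabulate⁻ (allᵇ⁻ e)

allFinᵇ⁺ : ∀ {N} {p : Fin N → Bool} → (∀ i → p i ≡ true) → allᵇ p (allFin N) ≡ true
allFinᵇ⁺ e = allᵇ⁺ (Allₚ.tabulate⁺ e)

module _ {A : Set} (r : A → A → Bool) where

  headᵇ : A → List A → Bool
  headᵇ a []      = true
  headᵇ a (b ∷ _) = r a b

  chainᵇ : List A → Bool
  chainᵇ []       = true
  chainᵇ (a ∷ xs) = headᵇ a xs ∧ chainᵇ xs

-- A chain with an extreme letter z is a chain of other letters followed by a run of z.  It serves for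
-- tableau rows (z the largest entry) and for partitions padded by zeros.
∑-chain-padded : {A B : Set} (X : List A) (Y : List B) (ι : A → B) (z : B)
  (rA : A → A → Bool) (rB : B → B → Bool) →
  (∀ g → ∑ Y g ≡ ∑ X (g ∘ ι) + g z) →
  (∀ a a′ → rB (ι a) (ι a′) ≡ rA a a′) → (∀ a → rB (ι a) z ≡ true) →
  rB z z ≡ true → (∀ a → rB z (ι a) ≡ false) →
  ∀ l (f : List B → ℤ) →
  (∑[ r ← listsOfLen l Y ] ⟦ chainᵇ rB r ⟧ * f r) ≡
  (∑[ m ← upTo (suc l) ] ∑[ r ← listsOfLen m X ]
    ⟦ chainᵇ rA r ⟧ * f (map ι r ++ replicate (l ℕ.∸ m) z))
∑-chain-padded X Y ι z rA rB ∑Y ιι ιz zz zι = go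
  where
  open ≡-Reasoning
  head-z : ∀ k → headᵇ rB z (replicate k z) ≡ true
  head-z zero    = refl
  head-z (suc k) = zz
  head-ι : ∀ a r k → headᵇ rB (ι a) (map ι r ++ replicate k z) ≡ headᵇ rA a r
  head-ι a (b ∷ r) k       = ιι a b
  head-ι a []      zero    = refl
  head-ι a []      (suc k) = ιz a
  regroup : ∀ h c x → ⟦ h ∧ c ⟧ * x ≡ ⟦ c ⟧ * (⟦ h ⟧ * x)
  regroup h c x = trans (cong (_* x) (⟦⟧-∧ h c)) (lemma ⟦ h ⟧ ⟦ c ⟧ x)
    where
    lemma : ∀ a b x → a * b * x ≡ b * (a * x)
    lemma = solve-∀
  go : ∀ l (f : List _ → ℤ) → (∑[ r ← listsOfLen l Y ] ⟦ chainᵇ rB r ⟧ * f r) ≡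
    (∑[ m ← upTo (suc l) ] ∑[ r ← listsOfLen m X ]
      ⟦ chainᵇ rA r ⟧ * f (map ι r ++ replicate (l ℕ.∸ m) z))
  go zero f = begin
    (∑[ r ← [] ∷ [] ] ⟦ chainᵇ rB r ⟧ * f r)
      ≡⟨ ∑-single [] _ ⟩
    + 1 * f []
      ≡⟨ ∑-single [] _ ⟨
    (∑[ r ← [] ∷ [] ] ⟦ chainᵇ rA r ⟧ * f (map ι r ++ []))
      ≡⟨ ∑-single 0 _ ⟨
    (∑[ m ← 0 ∷ [] ] ∑[ r ← listsOfLen m X ] ⟦ chainᵇ rA r ⟧ * f (map ι r ++ replicate (0 ℕ.∸ m) z)) ∎
  go (suc l) f = begin
    (∑[ r ← listsOfLen (suc l) Y ] ⟦ chainᵇ rB r ⟧ * f r)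
      ≡⟨ trans (∑-listsOfLen l Y _) (∑Y _) ⟩
    (∑[ a ← X ] ∑[ r ← listsOfLen l Y ] ⟦ chainᵇ rB (ι a ∷ r) ⟧ * f (ι a ∷ r))
      + (∑[ r ← listsOfLen l Y ] ⟦ chainᵇ rB (z ∷ r) ⟧ * f (z ∷ r))
      ≡⟨ cong₂ _+_ (trans (∑-cong X below-part) (∑-swap X (upTo (suc l)) _)) z-part ⟩
    (∑[ m ← upTo (suc l) ] ∑[ a ← X ] ∑[ r ← listsOfLen m X ]
      ⟦ chainᵇ rA (a ∷ r) ⟧ * f (map ι (a ∷ r) ++ replicate (l ℕ.∸ m) z)) + g 0
      ≡⟨ cong (_+ g 0) (∑-cong (upTo (suc l)) λ m → sym (∑-listsOfLen m X _)) ⟩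
    (∑[ m ← upTo (suc l) ] g (suc m)) + g 0
      ≡⟨ ℤₚ.+-comm _ (g 0) ⟩
    g 0 + (∑[ m ← upTo (suc l) ] g (suc m))
      ≡⟨ ∑-upTo (suc l) g ⟨
    (∑[ m ← upTo (suc (suc l)) ] g m) ∎
    where
    g : ℕ → ℤ
    g m = ∑[ r ← listsOfLen m X ] ⟦ chainᵇ rA r ⟧ * f (map ι r ++ replicate (suc l ℕ.∸ m) z)
    below-part : ∀ a → (∑[ r ← listsOfLen l Y ] ⟦ chainᵇ rB (ι a ∷ r) ⟧ * f (ι a ∷ r)) ≡
      (∑[ m ← upTo (suc l) ] ∑[ r ← listsOfLen m X ]
        ⟦ chainᵇ rA (a ∷ r) ⟧ * f (map ι (a ∷ r) ++ replicate (l ℕ.∸ m) z))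
    below-part a = trans (∑-cong (listsOfLen l Y) λ r → regroup (headᵇ rB (ι a) r) (chainᵇ rB r) _)
      (trans (go l (λ r → ⟦ headᵇ rB (ι a) r ⟧ * f (ι a ∷ r)))
        (∑-cong (upTo (suc l)) λ m → ∑-cong (listsOfLen m X) λ r → trans
          (cong (λ b → ⟦ chainᵇ rA r ⟧ * (⟦ b ⟧ * f (map ι (a ∷ r) ++ replicate (l ℕ.∸ m) z))) (head-ι a r (l ℕ.∸ m)))
          (sym (regroup (headᵇ rA a r) (chainᵇ rA r) _))))
    -- After `z` no letter of `X` may follow, so in the formula for the tail only `m = 0` survives
    -- and the list consists of copies of `z`.
    z-part : (∑[ r ← listsOfLen l Y ] ⟦ chainᵇ rB (z ∷ r) ⟧ * f (z ∷ r)) ≡ g 0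
    z-part = begin
      (∑[ r ← listsOfLen l Y ] ⟦ chainᵇ rB (z ∷ r) ⟧ * f (z ∷ r))
        ≡⟨ ∑-cong (listsOfLen l Y) (λ r → regroup (headᵇ rB z r) (chainᵇ rB r) _) ⟩
      (∑[ r ← listsOfLen l Y ] ⟦ chainᵇ rB r ⟧ * (⟦ headᵇ rB z r ⟧ * f (z ∷ r)))
        ≡⟨ go l (λ r → ⟦ headᵇ rB z r ⟧ * f (z ∷ r)) ⟩
      (∑[ m ← upTo (suc l) ] h m)
        ≡⟨ ∑-upTo l h ⟩
      h 0 + (∑[ m ← upTo l ] h (suc m))
        ≡⟨ cong₂ _+_ (trans (∑-single [] _) (trans (cong (_*_ (+ 1)) (trans
              (cong (λ b → ⟦ b ⟧ * f (z ∷ replicate l z)) (head-z l)) (ℤₚ.*-identityˡ _))) (sym (∑-single [] _))))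
             (∑-zero (upTo l) h-suc) ⟩
      g 0 + + 0
        ≡⟨ ℤₚ.+-identityʳ _ ⟩
      g 0 ∎
      where
      h : ℕ → ℤ
      h m = ∑[ r ← listsOfLen m X ] ⟦ chainᵇ rA r ⟧ *
              (⟦ headᵇ rB z (map ι r ++ replicate (l ℕ.∸ m) z) ⟧ * f (z ∷ map ι r ++ replicate (l ℕ.∸ m) z))
      h-suc : ∀ m → h (suc m) ≡ + 0
      h-suc m = trans (∑-listsOfLen m X _) (∑-zero X λ a → ∑-zero (listsOfLen m X) λ r →
        trans (cong (λ b → ⟦ chainᵇ rA (a ∷ r) ⟧ * (⟦ b ⟧ * f (z ∷ map ι (a ∷ r) ++ replicate (l ℕ.∸ suc m) z))) (zι a))
          (ℤₚ.*-zeroʳ ⟦ chainᵇ rA (a ∷ r) ⟧))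

_≤ᶠ_ : ∀ {N} → Fin N → Fin N → Bool
i ≤ᶠ j = toℕ i ℕ.≤ᵇ toℕ j

rowWeakᵇ≡chainᵇ : ∀ {N} (r : List (Fin N)) → rowWeakᵇ r ≡ chainᵇ _≤ᶠ_ r
rowWeakᵇ≡chainᵇ []          = refl
rowWeakᵇ≡chainᵇ (a ∷ [])    = refl
rowWeakᵇ≡chainᵇ (a ∷ b ∷ r) = cong ((a ≤ᶠ b) ∧_) (rowWeakᵇ≡chainᵇ (b ∷ r))

pad : ∀ {N} → ℕ → List (Fin N) → List (Fin (suc N))
pad {N} k r = map inject₁ r ++ replicate k (fromℕ N)

∑-weakRows : ∀ N l (f : List (Fin (suc N)) → ℤ) →
  (∑[ r ← listsOfLen l (allFin (suc N)) ] ⟦ rowWeakᵇ r ⟧ * f r) ≡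
  (∑[ m ← upTo (suc l) ] ∑[ r ← listsOfLen m (allFin N) ] ⟦ rowWeakᵇ r ⟧ * f (pad (l ℕ.∸ m) r))
∑-weakRows N l f = trans
  (∑-cong (listsOfLen l (allFin (suc N))) λ r → cong (λ b → ⟦ b ⟧ * f r) (rowWeakᵇ≡chainᵇ r))
  (trans (∑-chain-padded (allFin N) (allFin (suc N)) inject₁ (fromℕ N) _≤ᶠ_ _≤ᶠ_ (∑-allFin-snoc N)
      (λ a b → cong₂ ℕ._≤ᵇ_ (Finₚ.toℕ-inject₁ a) (Finₚ.toℕ-inject₁ b))
      (λ a → ≤ᵇ⁺ (Finₚ.≤fromℕ (inject₁ a)))
      (≤ᵇ⁺ (ℕₚ.≤-refl {toℕ (fromℕ N)}))
      (λ a → below-top a) l f)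
    (∑-cong (upTo (suc l)) λ m → ∑-cong (listsOfLen m (allFin N)) λ r →
      cong (λ b → ⟦ b ⟧ * f (pad (l ℕ.∸ m) r)) (sym (rowWeakᵇ≡chainᵇ r))))
  where
  below-top : ∀ a → (fromℕ N ≤ᶠ inject₁ a) ≡ false
  below-top a = Boolₚ.¬-not λ e → ℕₚ.<⇒≱ (Finₚ.toℕ<n a)
    (subst₂ ℕ._≤_ (Finₚ.toℕ-fromℕ N) (Finₚ.toℕ-inject₁ a) (≤ᵇ⁻ e))

-- Inverse to deleting the largest letter from a filling with weakly increasing rows.
padRows : ∀ {N} → List ℕ → List ℕ → List (List (Fin N)) → List (List (Fin (suc N)))
padRows (l ∷ ls) (m ∷ ms) (r ∷ t) = pad (l ℕ.∸ m) r ∷ padRows ls ms t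
padRows _        _        _       = []

∑-fillings : ∀ l ls N (f : List (List (Fin N)) → ℤ) →
  ∑ (fillings (l ∷ ls) N) f ≡ ∑[ r ← listsOfLen l (allFin N) ] ∑[ t ← fillings ls N ] f (r ∷ t)
∑-fillings l ls N f = trans (∑-concatMap (listsOfLen l (allFin N)) _ f)
  (∑-cong (listsOfLen l (allFin N)) λ r → ∑-map (fillings ls N) (r ∷_) f)

∑-below : ∀ l ls (f : List ℕ → ℤ) →
  ∑ (below (l ∷ ls)) f ≡ ∑[ m ← upTo (suc l) ] ∑[ ms ← below ls ] f (m ∷ ms)
∑-below l ls f = trans (∑-concatMap (upTo (suc l)) _ f)
  (∑-cong (upTo (suc l)) λ m → ∑-map (below ls) (m ∷_) f)

⟦⟧-∧-* : ∀ a b x → ⟦ a ∧ b ⟧ * x ≡ ⟦ a ⟧ * (⟦ b ⟧ * x)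
⟦⟧-∧-* a b x = trans (cong (_* x) (⟦⟧-∧ a b)) (ℤₚ.*-assoc ⟦ a ⟧ ⟦ b ⟧ x)

-- The rows are independent of each other here. Column strictness stays inside `g` and is resolved
-- only after all rows are padded, where it becomes the strip condition.
∑-weakFillings : ∀ κ N (g : List (List (Fin (suc N))) → ℤ) →
  (∑[ t ← fillings κ (suc N) ] ⟦ allᵇ rowWeakᵇ t ⟧ * g t) ≡
  (∑[ μ ← below κ ] ∑[ t ← fillings μ N ] ⟦ allᵇ rowWeakᵇ t ⟧ * g (padRows κ μ t))
∑-weakFillings []       N g = trans (∑-single [] _)
  (sym (trans (∑-single [] _) (∑-single [] _)))
∑-weakFillings (l ∷ ls) N g = begin
  (∑[ t ← fillings (l ∷ ls) (suc N) ] ⟦ allᵇ rowWeakᵇ t ⟧ * g t)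
    ≡⟨ ∑-fillings l ls (suc N) _ ⟩
  (∑[ r ← listsOfLen l (allFin (suc N)) ] ∑[ t ← fillings ls (suc N) ] ⟦ rowWeakᵇ r ∧ allᵇ rowWeakᵇ t ⟧ * g (r ∷ t))
    ≡⟨ ∑-cong (listsOfLen l (allFin (suc N))) (λ r → trans
         (∑-cong (fillings ls (suc N)) λ t → ⟦⟧-∧-* (rowWeakᵇ r) (allᵇ rowWeakᵇ t) (g (r ∷ t)))
         (trans (∑-*ˡ ⟦ rowWeakᵇ r ⟧ (fillings ls (suc N)) _)
                (cong (_*_ ⟦ rowWeakᵇ r ⟧) (∑-weakFillings ls N (λ t → g (r ∷ t)))))) ⟩
  (∑[ r ← listsOfLen l (allFin (suc N)) ] ⟦ rowWeakᵇ r ⟧ * G r)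
    ≡⟨ ∑-weakRows N l G ⟩
  (∑[ m ← upTo (suc l) ] ∑[ r ← listsOfLen m (allFin N) ] ⟦ rowWeakᵇ r ⟧ * G (pad (l ℕ.∸ m) r))
    ≡⟨ ∑-cong (upTo (suc l)) (λ m → trans
         (∑-cong (listsOfLen m (allFin N)) λ r → trans (sym (∑-*ˡ ⟦ rowWeakᵇ r ⟧ (below ls) _))
            (∑-cong (below ls) λ ms → trans (sym (∑-*ˡ ⟦ rowWeakᵇ r ⟧ (fillings ms N) _))
              (∑-cong (fillings ms N) λ t → sym (⟦⟧-∧-* (rowWeakᵇ r) (allᵇ rowWeakᵇ t) _))))
         (trans (∑-swap (listsOfLen m (allFin N)) (below ls) _)
           (∑-cong (below ls) λ ms → sym (∑-fillings m ms N _)))) ⟩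
  (∑[ m ← upTo (suc l) ] ∑[ ms ← below ls ] ∑[ t ← fillings (m ∷ ms) N ] ⟦ allᵇ rowWeakᵇ t ⟧ * g (padRows (l ∷ ls) (m ∷ ms) t))
    ≡⟨ ∑-below l ls _ ⟨
  (∑[ μ ← below (l ∷ ls) ] ∑[ t ← fillings μ N ] ⟦ allᵇ rowWeakᵇ t ⟧ * g (padRows (l ∷ ls) μ t)) ∎
  where
  open ≡-Reasoning
  G : List (Fin (suc N)) → ℤ
  G r = ∑[ ms ← below ls ] ∑[ t ← fillings ms N ] ⟦ allᵇ rowWeakᵇ t ⟧ * g (r ∷ padRows ls ms t)

all-length-fillings : ∀ μ N → All (λ t → map length t ≡ μ) (fillings μ N)
all-length-fillings []       N = refl ∷ []
all-length-fillings (m ∷ ms) N = Allₚ.concat⁺ (Allₚ.map⁺ (All.map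
  (λ {r} len → Allₚ.map⁺ (All.map (cong₂ _∷_ len) (all-length-fillings ms N)))
  (all-length-listsOfLen m (allFin N))))

suc≤ᵇsuc : ∀ a b → (suc a ℕ.≤ᵇ suc b) ≡ (a ℕ.≤ᵇ b)
suc≤ᵇsuc zero    b = refl
suc≤ᵇsuc (suc a) b = refl

inject₁<fromℕ : ∀ {N} (i : Fin N) → (toℕ (inject₁ i) ℕ.<ᵇ toℕ (fromℕ N)) ≡ true
inject₁<fromℕ i = <ᵇ⁺ (subst₂ ℕ._<_ (sym (Finₚ.toℕ-inject₁ i)) (sym (Finₚ.toℕ-fromℕ _)) (Finₚ.toℕ<n i))

fromℕ≮ : ∀ {N} (i : Fin (suc N)) → (toℕ (fromℕ N) ℕ.<ᵇ toℕ i) ≡ false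
fromℕ≮ i = Boolₚ.¬-not λ e → ℕₚ.<⇒≱ (<ᵇ⁻ e) (Finₚ.≤fromℕ i)

colStrictᵇ-[] : ∀ {N} (r : List (Fin N)) → colStrictᵇ r [] ≡ true
colStrictᵇ-[] []      = refl
colStrictᵇ-[] (_ ∷ _) = refl

-- Nothing may stand above a copy of the largest letter, so the whole upper row has to fit over `r`;
-- a largest letter above an entry of `r` is always allowed.
colStrictᵇ-pad : ∀ {N} (r s : List (Fin N)) a b →
  colStrictᵇ (pad a r) (pad b s) ≡ (length s ℕ.+ b ℕ.≤ᵇ length r) ∧ colStrictᵇ r s
colStrictᵇ-pad {N} []  []      a       zero    = colStrictᵇ-[] (pad {N} a [])
colStrictᵇ-pad []      []      zero    (suc b) = refl
colStrictᵇ-pad {N} []  []      (suc a) (suc b) = cong (_∧ colStrictᵇ (pad {N} a []) (pad b [])) (fromℕ≮ (fromℕ N))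
colStrictᵇ-pad []      (x ∷ s) zero    b       = refl
colStrictᵇ-pad []      (x ∷ s) (suc a) b       = cong (_∧ colStrictᵇ (pad a []) (pad b s)) (fromℕ≮ (inject₁ x))
colStrictᵇ-pad (y ∷ r) []      a       zero    = refl
colStrictᵇ-pad (y ∷ r) []      a       (suc b) = begin
  _ ∧ colStrictᵇ (pad a r) (pad b [])  ≡⟨ cong₂ _∧_ (inject₁<fromℕ y) (colStrictᵇ-pad r [] a b) ⟩
  (b ℕ.≤ᵇ length r) ∧ colStrictᵇ r []  ≡⟨ cong ((b ℕ.≤ᵇ length r) ∧_) (colStrictᵇ-[] r) ⟩
  (b ℕ.≤ᵇ length r) ∧ true             ≡⟨ cong (_∧ true) (suc≤ᵇsuc b (length r)) ⟨
  (suc b ℕ.≤ᵇ suc (length r)) ∧ true   ∎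
  where
  open ≡-Reasoning
colStrictᵇ-pad (y ∷ r) (x ∷ s) a       b       = begin
  (toℕ (inject₁ y) ℕ.<ᵇ toℕ (inject₁ x)) ∧ colStrictᵇ (pad a r) (pad b s)
    ≡⟨ cong₂ _∧_ (cong₂ ℕ._<ᵇ_ (Finₚ.toℕ-inject₁ y) (Finₚ.toℕ-inject₁ x)) (colStrictᵇ-pad r s a b) ⟩
  (toℕ y ℕ.<ᵇ toℕ x) ∧ ((length s ℕ.+ b ℕ.≤ᵇ length r) ∧ colStrictᵇ r s)
    ≡⟨ swap (toℕ y ℕ.<ᵇ toℕ x) (length s ℕ.+ b ℕ.≤ᵇ length r) _ ⟩
  (length s ℕ.+ b ℕ.≤ᵇ length r) ∧ ((toℕ y ℕ.<ᵇ toℕ x) ∧ colStrictᵇ r s)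
    ≡⟨ cong (_∧ ((toℕ y ℕ.<ᵇ toℕ x) ∧ colStrictᵇ r s)) (suc≤ᵇsuc (length s ℕ.+ b) (length r)) ⟨
  (suc (length s ℕ.+ b) ℕ.≤ᵇ suc (length r)) ∧ ((toℕ y ℕ.<ᵇ toℕ x) ∧ colStrictᵇ r s) ∎
  where
  open ≡-Reasoning
  swap : ∀ a b c → a ∧ (b ∧ c) ≡ b ∧ (a ∧ c)
  swap true  b     c = refl
  swap false true  c = refl
  swap false false c = refl

hstripᵇ : List ℕ → List ℕ → Bool
hstripᵇ (l ∷ l′ ∷ ls) (m ∷ m′ ∷ ms) = (l′ ℕ.≤ᵇ m) ∧ hstripᵇ (l′ ∷ ls) (m′ ∷ ms)
hstripᵇ _             _             = true

colsStrictᵇ-padRows : ∀ {N} κ μ (t : List (List (Fin N))) → containedᵇ κ μ ≡ true → map length t ≡ μ →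
  colsStrictᵇ (padRows κ μ t) ≡ hstripᵇ κ μ ∧ colsStrictᵇ t
colsStrictᵇ-padRows []       []       []      c len = refl
colsStrictᵇ-padRows (l ∷ []) (m ∷ []) (r ∷ []) c len = refl
colsStrictᵇ-padRows (l ∷ [])      (m ∷ m′ ∷ ms) (r ∷ s ∷ t) c len =
  contradiction (proj₂ (∧⁻ {m ℕ.≤ᵇ l} c)) λ ()
colsStrictᵇ-padRows (l ∷ l′ ∷ ls) (m ∷ []) (r ∷ []) c len = contradiction (proj₂ (∧⁻ {m ℕ.≤ᵇ l} c)) λ ()
colsStrictᵇ-padRows (l ∷ l′ ∷ ls) (m ∷ m′ ∷ ms) (r ∷ s ∷ t) c len = begin
  colStrictᵇ (pad (l ℕ.∸ m) r) (pad (l′ ℕ.∸ m′) s) ∧ colsStrictᵇ (padRows (l′ ∷ ls) (m′ ∷ ms) (s ∷ t))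
    ≡⟨ cong₂ _∧_ (colStrictᵇ-pad r s (l ℕ.∸ m) (l′ ℕ.∸ m′))
         (colsStrictᵇ-padRows (l′ ∷ ls) (m′ ∷ ms) (s ∷ t) (proj₂ (∧⁻ {m ℕ.≤ᵇ l} c)) (Listₚ.∷-injectiveʳ len)) ⟩
  ((length s ℕ.+ (l′ ℕ.∸ m′) ℕ.≤ᵇ length r) ∧ colStrictᵇ r s) ∧ (hstripᵇ (l′ ∷ ls) (m′ ∷ ms) ∧ colsStrictᵇ (s ∷ t))
    ≡⟨ cong (λ b → (b ∧ colStrictᵇ r s) ∧ (hstripᵇ (l′ ∷ ls) (m′ ∷ ms) ∧ colsStrictᵇ (s ∷ t)))
         (cong₂ ℕ._≤ᵇ_ (trans (cong (ℕ._+ (l′ ℕ.∸ m′)) len-s) (ℕₚ.m+[n∸m]≡n m′≤l′)) (Listₚ.∷-injectiveˡ len)) ⟩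
  ((l′ ℕ.≤ᵇ m) ∧ colStrictᵇ r s) ∧ (hstripᵇ (l′ ∷ ls) (m′ ∷ ms) ∧ colsStrictᵇ (s ∷ t))
    ≡⟨ interchange (l′ ℕ.≤ᵇ m) _ _ _ ⟩
  ((l′ ℕ.≤ᵇ m) ∧ hstripᵇ (l′ ∷ ls) (m′ ∷ ms)) ∧ (colStrictᵇ r s ∧ colsStrictᵇ (s ∷ t)) ∎
  where
  open ≡-Reasoning
  len-s : length s ≡ m′
  len-s = Listₚ.∷-injectiveˡ (Listₚ.∷-injectiveʳ len)
  m′≤l′ : m′ ℕ.≤ l′
  m′≤l′ = ≤ᵇ⁻ (proj₁ (∧⁻ (proj₂ (∧⁻ {m ℕ.≤ᵇ l} c))))
  interchange : ∀ a b c d → (a ∧ b) ∧ (c ∧ d) ≡ (a ∧ c) ∧ (b ∧ d)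
  interchange false b     c d = refl
  interchange true  false c d = sym (Boolₚ.∧-zeroʳ c)
  interchange true  true  c d = refl

countᵇ-++ : {A : Set} (p : A → Bool) (xs ys : List A) → countᵇ p (xs ++ ys) ≡ countᵇ p xs ℕ.+ countᵇ p ys
countᵇ-++ p []       ys = refl
countᵇ-++ p (x ∷ xs) ys = trans (cong ((if p x then 1 else 0) ℕ.+_) (countᵇ-++ p xs ys))
  (sym (ℕₚ.+-assoc (if p x then 1 else 0) _ _))

countᵇ-cong : {A : Set} {p q : A → Bool} (xs : List A) → (∀ x → p x ≡ q x) → countᵇ p xs ≡ countᵇ q xs
countᵇ-cong []       eq = refl
countᵇ-cong (x ∷ xs) eq = cong₂ ℕ._+_ (cong (if_then 1 else 0) (eq x)) (countᵇ-cong xs eq)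

countᵇ-map : {A B : Set} (p : B → Bool) (h : A → B) (xs : List A) → countᵇ p (map h xs) ≡ countᵇ (p ∘ h) xs
countᵇ-map p h []       = refl
countᵇ-map p h (x ∷ xs) = cong ((if p (h x) then 1 else 0) ℕ.+_) (countᵇ-map p h xs)

countᵇ-none : {A : Set} {p : A → Bool} (xs : List A) → (∀ x → p x ≡ false) → countᵇ p xs ≡ 0
countᵇ-none []       eq = refl
countᵇ-none (x ∷ xs) eq = cong₂ ℕ._+_ (cong (if_then 1 else 0) (eq x)) (countᵇ-none xs eq)

countᵇ-replicate : {A : Set} {p : A → Bool} (k : ℕ) (x : A) → p x ≡ true → countᵇ p (replicate k x) ≡ k
countᵇ-replicate zero    x eq = refl
countᵇ-replicate (suc k) x eq = cong₂ ℕ._+_ (cong (if_then 1 else 0) eq) (countᵇ-replicate k x eq)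

countᵇ-replicate-0 : {A : Set} {p : A → Bool} (k : ℕ) (x : A) → p x ≡ false → countᵇ p (replicate k x) ≡ 0
countᵇ-replicate-0 zero    x eq = refl
countᵇ-replicate-0 (suc k) x eq = cong₂ ℕ._+_ (cong (if_then 1 else 0) eq) (countᵇ-replicate-0 k x eq)

fromℕ≠inject₁ : ∀ {N} (i : Fin N) → (fromℕ N ==ᶠ inject₁ i) ≡ false
fromℕ≠inject₁ {N} i = Boolₚ.¬-not λ e → ℕₚ.<⇒≢ (Finₚ.toℕ<n i)
  (trans (sym (Finₚ.toℕ-inject₁ i)) (trans (sym (≡ᵇ⁻ e)) (Finₚ.toℕ-fromℕ N)))

inject₁≠fromℕ : ∀ {N} (i : Fin N) → (inject₁ i ==ᶠ fromℕ N) ≡ false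
inject₁≠fromℕ {N} i = Boolₚ.¬-not λ e → ℕₚ.<⇒≢ (Finₚ.toℕ<n i)
  (trans (sym (Finₚ.toℕ-inject₁ i)) (trans (≡ᵇ⁻ e) (Finₚ.toℕ-fromℕ N)))

content-inject₁ : ∀ {N} κ μ (t : List (List (Fin N))) (i : Fin N) → containedᵇ κ μ ≡ true → map length t ≡ μ →
  sum (map (countᵇ (λ e → e ==ᶠ inject₁ i)) (padRows κ μ t)) ≡ sum (map (countᵇ (λ e → e ==ᶠ i)) t)
content-inject₁ []       []       []      i c len = refl
content-inject₁ {N} (l ∷ ls) (m ∷ ms) (r ∷ t) i c len = cong₂ ℕ._+_
  (trans (countᵇ-++ _ (map inject₁ r) (replicate (l ℕ.∸ m) (fromℕ N)))
    (trans (cong₂ ℕ._+_ (trans (countᵇ-map _ inject₁ r) (countᵇ-cong r λ e →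
        cong₂ ℕ._≡ᵇ_ (Finₚ.toℕ-inject₁ e) (Finₚ.toℕ-inject₁ i)))
      (countᵇ-replicate-0 (l ℕ.∸ m) (fromℕ N) (fromℕ≠inject₁ i))) (ℕₚ.+-identityʳ _)))
  (content-inject₁ ls ms t i (proj₂ (∧⁻ c)) (Listₚ.∷-injectiveʳ len))

content-fromℕ : ∀ {N} κ μ (t : List (List (Fin N))) → containedᵇ κ μ ≡ true → map length t ≡ μ →
  sum μ ℕ.+ sum (map (countᵇ (λ e → e ==ᶠ fromℕ N)) (padRows κ μ t)) ≡ sum κ
content-fromℕ []       []       []      c len = refl
content-fromℕ {N} (l ∷ ls) (m ∷ ms) (r ∷ t) c len = begin
  (m ℕ.+ sum ms) ℕ.+ (countᵇ p (pad (l ℕ.∸ m) r) ℕ.+ S)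
    ≡⟨ cong (λ a → (m ℕ.+ sum ms) ℕ.+ (a ℕ.+ S)) (trans
         (countᵇ-++ p (map inject₁ r) (replicate (l ℕ.∸ m) (fromℕ N)))
         (cong₂ ℕ._+_ (trans (countᵇ-map p inject₁ r) (countᵇ-none r inject₁≠fromℕ))
           (countᵇ-replicate (l ℕ.∸ m) (fromℕ N) (≡ᵇ⁺ {toℕ (fromℕ N)} refl)))) ⟩
  (m ℕ.+ sum ms) ℕ.+ ((l ℕ.∸ m) ℕ.+ S)
    ≡⟨ lemma m (sum ms) (l ℕ.∸ m) S ⟩
  (m ℕ.+ (l ℕ.∸ m)) ℕ.+ (sum ms ℕ.+ S)
    ≡⟨ cong₂ ℕ._+_ (ℕₚ.m+[n∸m]≡n (≤ᵇ⁻ {m} {l} (proj₁ (∧⁻ {m ℕ.≤ᵇ l} c))))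
         (content-fromℕ ls ms t (proj₂ (∧⁻ c)) (Listₚ.∷-injectiveʳ len)) ⟩
  l ℕ.+ sum ls ∎
  where
  open ≡-Reasoning
  p : Fin (suc N) → Bool
  p e = e ==ᶠ fromℕ N
  S = sum (map (countᵇ p) (padRows ls ms t))
  lemma : ∀ a b c d → (a ℕ.+ b) ℕ.+ (c ℕ.+ d) ≡ (a ℕ.+ c) ℕ.+ (b ℕ.+ d)
  lemma = ℕ-solve-∀

tableauContentᵇ-padRows : ∀ {N} κ μ (t : List (List (Fin N))) (α : Fin (suc N) → ℕ) →
  containedᵇ κ μ ≡ true → map length t ≡ μ →
  tableauContentᵇ (padRows κ μ t) α ≡
  (sum μ ℕ.+ α (fromℕ N) ℕ.≡ᵇ sum κ) ∧ tableauContentᵇ t (α ∘ inject₁)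
tableauContentᵇ-padRows {N} κ μ t α c len = true-ext
  (λ e → ∧⁺ (≡ᵇ⁺ (trans (cong (sum μ ℕ.+_) (sym (≡ᵇ⁻ (allFinᵇ⁻ e (fromℕ N))))) (content-fromℕ κ μ t c len)))
            (allFinᵇ⁺ λ i → ≡ᵇ⁺ (trans (sym (content-inject₁ κ μ t i c len)) (≡ᵇ⁻ (allFinᵇ⁻ e (inject₁ i))))))
  (λ e → allFinᵇ⁺ (back e))
  where
  back : (sum μ ℕ.+ α (fromℕ N) ℕ.≡ᵇ sum κ) ∧ tableauContentᵇ t (α ∘ inject₁) ≡ true →
         ∀ i → (sum (map (countᵇ (λ e → e ==ᶠ i)) (padRows κ μ t)) ℕ.≡ᵇ α i) ≡ true
  back e i with view i
  ... | ‵fromℕ     = ≡ᵇ⁺ (ℕₚ.+-cancelˡ-≡ (sum μ) _ _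
          (trans (content-fromℕ κ μ t c len) (sym (≡ᵇ⁻ (proj₁ (∧⁻ e))))))
  ... | ‵inject₁ j = ≡ᵇ⁺ (trans (content-inject₁ κ μ t j c len) (≡ᵇ⁻ (allFinᵇ⁻ (proj₂ (∧⁻ e)) j)))

all-containedᵇ-below : ∀ κ → All (λ μ → containedᵇ κ μ ≡ true) (below κ)
all-containedᵇ-below []       = refl ∷ []
all-containedᵇ-below (l ∷ ls) = Allₚ.concat⁺ (Allₚ.map⁺ (All.map
  (λ m<1+l → Allₚ.map⁺ (All.map (∧⁺ (≤ᵇ⁺ (ℕₚ.≤-pred m<1+l))) (all-containedᵇ-below ls)))
  (Allₚ.all-upTo (suc l))))

schurCoeff-∑ : ∀ κ N α → + schurCoeff κ N α ≡
  ∑[ t ← fillings κ N ] ⟦ allᵇ rowWeakᵇ t ⟧ * ⟦ colsStrictᵇ t ∧ tableauContentᵇ t α ⟧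
schurCoeff-∑ κ N α = trans (∑-countᵇ _ (fillings κ N)) (∑-cong (fillings κ N) λ t →
  trans (cong ⟦_⟧ (Boolₚ.∧-assoc (allᵇ rowWeakᵇ t) (colsStrictᵇ t) (tableauContentᵇ t α)))
    (⟦⟧-∧ (allᵇ rowWeakᵇ t) _))

schurCoeff-below : ∀ κ N (α : Fin (suc N) → ℕ) → + schurCoeff κ (suc N) α ≡
  ∑[ μ ← below κ ] ⟦ hstripᵇ κ μ ⟧ * (⟦ sum μ ℕ.+ α (fromℕ N) ℕ.≡ᵇ sum κ ⟧ * + schurCoeff μ N (α ∘ inject₁))
schurCoeff-below κ N α = begin
  + schurCoeff κ (suc N) α
    ≡⟨ schurCoeff-∑ κ (suc N) α ⟩
  (∑[ t ← fillings κ (suc N) ] ⟦ allᵇ rowWeakᵇ t ⟧ * ⟦ colsStrictᵇ t ∧ tableauContentᵇ t α ⟧)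
    ≡⟨ ∑-weakFillings κ N _ ⟩
  (∑[ μ ← below κ ] ∑[ t ← fillings μ N ]
    ⟦ allᵇ rowWeakᵇ t ⟧ * ⟦ colsStrictᵇ (padRows κ μ t) ∧ tableauContentᵇ (padRows κ μ t) α ⟧)
    ≡⟨ ∑-congᴬ (all-containedᵇ-below κ) (λ μ c → trans
         (∑-congᴬ (all-length-fillings μ N) λ t len → trans
           (cong (_*_ ⟦ allᵇ rowWeakᵇ t ⟧) (trans (⟦⟧-∧ (colsStrictᵇ (padRows κ μ t)) _) (trans (cong₂ _*_
             (trans (cong ⟦_⟧ (colsStrictᵇ-padRows κ μ t c len)) (⟦⟧-∧ (hstripᵇ κ μ) (colsStrictᵇ t)))
             (trans (cong ⟦_⟧ (tableauContentᵇ-padRows κ μ t α c len)) (⟦⟧-∧ (sum μ ℕ.+ α (fromℕ N) ℕ.≡ᵇ sum κ) (tableauContentᵇ t (α ∘ inject₁)))))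
             (lemma₁ ⟦ hstripᵇ κ μ ⟧ ⟦ colsStrictᵇ t ⟧ ⟦ sum μ ℕ.+ α (fromℕ N) ℕ.≡ᵇ sum κ ⟧ ⟦ tableauContentᵇ t (α ∘ inject₁) ⟧))))
           (trans (lemma₂ ⟦ allᵇ rowWeakᵇ t ⟧ ⟦ hstripᵇ κ μ ⟧ ⟦ sum μ ℕ.+ α (fromℕ N) ℕ.≡ᵇ sum κ ⟧ _)
              (cong (λ e → ⟦ hstripᵇ κ μ ⟧ * (⟦ sum μ ℕ.+ α (fromℕ N) ℕ.≡ᵇ sum κ ⟧ * (⟦ allᵇ rowWeakᵇ t ⟧ * e)))
                 (sym (⟦⟧-∧ (colsStrictᵇ t) (tableauContentᵇ t (α ∘ inject₁)))))))
         (trans (∑-*ˡ ⟦ hstripᵇ κ μ ⟧ (fillings μ N) _) (cong (_*_ ⟦ hstripᵇ κ μ ⟧)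
           (trans (∑-*ˡ ⟦ sum μ ℕ.+ α (fromℕ N) ℕ.≡ᵇ sum κ ⟧ (fillings μ N) _)
             (cong (_*_ ⟦ sum μ ℕ.+ α (fromℕ N) ℕ.≡ᵇ sum κ ⟧) (sym (schurCoeff-∑ μ N (α ∘ inject₁)))))))) ⟩
  (∑[ μ ← below κ ] ⟦ hstripᵇ κ μ ⟧ * (⟦ sum μ ℕ.+ α (fromℕ N) ℕ.≡ᵇ sum κ ⟧ * + schurCoeff μ N (α ∘ inject₁))) ∎
  where
  open ≡-Reasoning
  lemma₁ : ∀ h c s k → h * c * (s * k) ≡ h * (s * (c * k))
  lemma₁ = solve-∀
  lemma₂ : ∀ w h s k → w * (h * (s * k)) ≡ h * (s * (w * k))
  lemma₂ = solve-∀

-- Replaces the range `below κ` by a box that depends only on the length of `κ`, so that the sums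
-- over `κ` and `μ` can be interchanged.
∑-below-box : ∀ n κ (f : List ℕ → ℤ) → All (ℕ._< suc n) κ →
  ∑ (below κ) f ≡ ∑[ μ ← listsOfLen (length κ) (upTo (suc n)) ] ⟦ containedᵇ κ μ ⟧ * f μ
∑-below-box n []       f []         = trans (∑-single [] f)
  (sym (trans (∑-single [] _) (ℤₚ.*-identityˡ (f []))))
∑-below-box n (l ∷ ls) f (l<n ∷ ls<n) = begin
  ∑ (below (l ∷ ls)) f
    ≡⟨ ∑-below l ls f ⟩
  (∑[ m ← upTo (suc l) ] ∑[ ms ← below ls ] f (m ∷ ms))
    ≡⟨ ∑-≤ (suc n) l _ l<n ⟩
  (∑[ m ← upTo (suc n) ] ⟦ m ℕ.≤ᵇ l ⟧ * (∑[ ms ← below ls ] f (m ∷ ms)))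
    ≡⟨ ∑-cong (upTo (suc n)) (λ m → trans
         (cong (_*_ ⟦ m ℕ.≤ᵇ l ⟧) (∑-below-box n ls (λ ms → f (m ∷ ms)) ls<n))
         (trans (sym (∑-*ˡ ⟦ m ℕ.≤ᵇ l ⟧ (listsOfLen (length ls) (upTo (suc n))) _))
           (∑-cong (listsOfLen (length ls) (upTo (suc n))) λ ms →
             sym (⟦⟧-∧-* (m ℕ.≤ᵇ l) (containedᵇ ls ms) (f (m ∷ ms)))))) ⟩
  (∑[ m ← upTo (suc n) ] ∑[ ms ← listsOfLen (length ls) (upTo (suc n)) ] ⟦ containedᵇ (l ∷ ls) (m ∷ ms) ⟧ * f (m ∷ ms))
    ≡⟨ ∑-listsOfLen (length ls) (upTo (suc n)) _ ⟨
  (∑[ μ ← listsOfLen (suc (length ls)) (upTo (suc n)) ] ⟦ containedᵇ (l ∷ ls) μ ⟧ * f μ) ∎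
  where open ≡-Reasoning

interlaced⁺ : ∀ u κ μ → containedᵇ κ μ ≡ true → hstripᵇ κ μ ≡ true → headᵇ (λ a b → b ℕ.≤ᵇ a) u κ ≡ true →
              interlaced u μ κ ≡ true
interlaced⁺ u []            []            c h l≤u = refl
interlaced⁺ u (l ∷ [])      (m ∷ [])      c h l≤u = ∧⁺ (∧⁺ (proj₁ (∧⁻ {m ℕ.≤ᵇ l} c)) l≤u) refl
interlaced⁺ u (l ∷ l′ ∷ ls) (m ∷ m′ ∷ ms) c h l≤u =
  ∧⁺ (∧⁺ (proj₁ (∧⁻ {m ℕ.≤ᵇ l} c)) l≤u)
     (interlaced⁺ m (l′ ∷ ls) (m′ ∷ ms) (proj₂ (∧⁻ {m ℕ.≤ᵇ l} c)) (proj₂ (∧⁻ {l′ ℕ.≤ᵇ m} h)) (proj₁ (∧⁻ {l′ ℕ.≤ᵇ m} h)))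
interlaced⁺ u (l ∷ [])      (m ∷ m′ ∷ ms) c h l≤u = contradiction (proj₂ (∧⁻ {m ℕ.≤ᵇ l} c)) λ ()
interlaced⁺ u (l ∷ l′ ∷ ls) (m ∷ [])      c h l≤u = contradiction (proj₂ (∧⁻ {m ℕ.≤ᵇ l} c)) λ ()

interlaced⁻ : ∀ u κ μ → interlaced u μ κ ≡ true → (containedᵇ κ μ ≡ true) × (hstripᵇ κ μ ≡ true)
interlaced⁻ u []            []            e = refl , refl
interlaced⁻ u (l ∷ [])      (m ∷ [])      e = ∧⁺ (proj₁ (∧⁻ {m ℕ.≤ᵇ l} (proj₁ (∧⁻ e)))) refl , refl
interlaced⁻ u (l ∷ l′ ∷ ls) (m ∷ m′ ∷ ms) e
  with c , h ← interlaced⁻ m (l′ ∷ ls) (m′ ∷ ms) (proj₂ (∧⁻ {(m ℕ.≤ᵇ l) ∧ (l ℕ.≤ᵇ u)} e)) =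
  ∧⁺ (proj₁ (∧⁻ {m ℕ.≤ᵇ l} (proj₁ (∧⁻ e)))) c ,
  ∧⁺ (proj₂ (∧⁻ {m′ ℕ.≤ᵇ l′} (proj₁ (∧⁻ (proj₂ (∧⁻ {(m ℕ.≤ᵇ l) ∧ (l ℕ.≤ᵇ u)} e)))))) h
interlaced⁻ u (l ∷ [])      (m ∷ m′ ∷ ms) e = contradiction (proj₂ (∧⁻ {(m ℕ.≤ᵇ l) ∧ (l ℕ.≤ᵇ u)} e)) λ ()
interlaced⁻ u (l ∷ l′ ∷ ls) (m ∷ [])      e = contradiction (proj₂ (∧⁻ {(m ℕ.≤ᵇ l) ∧ (l ℕ.≤ᵇ u)} e)) λ ()

interlaced⇒decreasingᵇ : ∀ u κ μ → interlaced u μ κ ≡ true → (decreasingᵇ κ ≡ true) × (decreasingᵇ μ ≡ true)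
interlaced⇒decreasingᵇ u []            []            e = refl , refl
interlaced⇒decreasingᵇ u (l ∷ [])      (m ∷ [])      e = refl , refl
interlaced⇒decreasingᵇ u (l ∷ l′ ∷ ls) (m ∷ m′ ∷ ms) e
  with κ-dec , μ-dec ← interlaced⇒decreasingᵇ m (l′ ∷ ls) (m′ ∷ ms)
                         (proj₂ (∧⁻ {(m ℕ.≤ᵇ l) ∧ (l ℕ.≤ᵇ u)} e)) =
  ∧⁺ (≤ᵇ⁺ (ℕₚ.≤-trans l′≤m m≤l)) κ-dec , ∧⁺ (≤ᵇ⁺ (ℕₚ.≤-trans m′≤l′ l′≤m)) μ-dec
  where
  tail : interlaced m (m′ ∷ ms) (l′ ∷ ls) ≡ true
  tail = proj₂ (∧⁻ {(m ℕ.≤ᵇ l) ∧ (l ℕ.≤ᵇ u)} e)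
  m≤l : m ℕ.≤ l
  m≤l = ≤ᵇ⁻ (proj₁ (∧⁻ (proj₁ (∧⁻ e))))
  m′≤l′ : m′ ℕ.≤ l′
  m′≤l′ = ≤ᵇ⁻ (proj₁ (∧⁻ (proj₁ (∧⁻ tail))))
  l′≤m : l′ ℕ.≤ m
  l′≤m = ≤ᵇ⁻ (proj₂ (∧⁻ {m′ ℕ.≤ᵇ l′} (proj₁ (∧⁻ tail))))
interlaced⇒decreasingᵇ u (l ∷ [])      (m ∷ m′ ∷ ms) e = contradiction (proj₂ (∧⁻ {(m ℕ.≤ᵇ l) ∧ (l ℕ.≤ᵇ u)} e)) λ ()
interlaced⇒decreasingᵇ u (l ∷ l′ ∷ ls) (m ∷ [])      e = contradiction (proj₂ (∧⁻ {(m ℕ.≤ᵇ l) ∧ (l ℕ.≤ᵇ u)} e)) λ ()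

-- Removing the largest letter of a tableau removes a horizontal strip.
schurCoeff-suc : ∀ n κ N (α : Fin (suc N) → ℕ) → All (ℕ._< suc n) κ → + schurCoeff κ (suc N) α ≡
  ∑[ μ ← listsOfLen (length κ) (upTo (suc n)) ]
    ⟦ interlaced n μ κ ⟧ * (⟦ sum μ ℕ.+ α (fromℕ N) ℕ.≡ᵇ sum κ ⟧ * + schurCoeff μ N (α ∘ inject₁))
schurCoeff-suc n κ N α κ≤n = trans (schurCoeff-below κ N α) (trans (∑-below-box n κ _ κ≤n)
  (∑-cong (listsOfLen (length κ) (upTo (suc n))) λ μ → trans (sym (⟦⟧-∧-* (containedᵇ κ μ) (hstripᵇ κ μ) _))
    (cong (λ b → ⟦ b ⟧ * (⟦ sum μ ℕ.+ α (fromℕ N) ℕ.≡ᵇ sum κ ⟧ * + schurCoeff μ N (α ∘ inject₁)))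
      (true-ext (λ e → interlaced⁺ n κ μ (proj₁ (∧⁻ e)) (proj₂ (∧⁻ {containedᵇ κ μ} e)) (head≤n κ≤n))
                (λ e → ∧⁺˙ (interlaced⁻ n κ μ e))))))
  where
  head≤n : ∀ {κ} → All (ℕ._< suc n) κ → headᵇ (λ a b → b ℕ.≤ᵇ a) n κ ≡ true
  head≤n []        = refl
  head≤n (l<n ∷ _) = ≤ᵇ⁺ (ℕₚ.≤-pred l<n)

schurCoeff-0 : ∀ κ α → + schurCoeff κ 0 α ≡ ⟦ isEmptyShapeᵇ κ ⟧
schurCoeff-0 κ α = trans (∑-countᵇ _ (fillings κ 0)) (trans (go κ _)
  (trans (cong (λ b → ⟦ isEmptyShapeᵇ κ ⟧ * ⟦ b ⟧) (∧⁺ (empty-SSYT (length κ)) refl)) (ℤₚ.*-identityʳ _)))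
  where
  go : ∀ κ (f : List (List (Fin 0)) → ℤ) → ∑ (fillings κ 0) f ≡ ⟦ isEmptyShapeᵇ κ ⟧ * f (replicate (length κ) [])
  go []            f = trans (∑-single [] f) (sym (ℤₚ.*-identityˡ (f [])))
  go (zero ∷ ls)   f = trans (∑-fillings 0 ls 0 f) (trans (∑-single [] _) (go ls (λ t → f ([] ∷ t))))
  go (suc l ∷ ls)  f = trans (∑-fillings (suc l) ls 0 f) (∑-[] _)
  empty-SSYT : ∀ k → isSSYTᵇ (replicate k []) ≡ true
  empty-SSYT k = ∧⁺ (weak k) (strict k)
    where
    weak : ∀ k → allᵇ (rowWeakᵇ {0}) (replicate k []) ≡ true
    weak zero    = refl
    weak (suc k) = weak k
    strict : ∀ k → colsStrictᵇ {0} (replicate k []) ≡ true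
    strict zero          = refl
    strict (suc zero)    = refl
    strict (suc (suc k)) = strict (suc k)

schurCoeff-snoc-0 : ∀ κ N α → schurCoeff (κ ++ 0 ∷ []) N α ≡ schurCoeff κ N α
schurCoeff-snoc-0 κ N α = ℤₚ.+-injective (trans (∑-countᵇ _ (fillings (κ ++ 0 ∷ []) N)) (trans (go κ _)
  (trans (∑-cong (fillings κ N) λ t → cong ⟦_⟧ (cong₂ _∧_ (cong₂ _∧_ (weak t) (strict t)) (content t)))
    (sym (∑-countᵇ _ (fillings κ N))))))
  where
  go : ∀ κ (f : List (List (Fin N)) → ℤ) → ∑ (fillings (κ ++ 0 ∷ []) N) f ≡ ∑[ t ← fillings κ N ] f (t ++ [] ∷ [])
  go []       f = trans (∑-fillings 0 [] N f) (trans (∑-single [] _) (trans (∑-single [] _) (sym (∑-single [] _))))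
  go (l ∷ ls) f = trans (∑-fillings l (ls ++ 0 ∷ []) N f) (trans
    (∑-cong (listsOfLen l (allFin N)) λ r → go ls (λ t → f (r ∷ t))) (sym (∑-fillings l ls N _)))
  weak : ∀ (t : List (List (Fin N))) → allᵇ rowWeakᵇ (t ++ [] ∷ []) ≡ allᵇ rowWeakᵇ t
  weak []      = refl
  weak (r ∷ t) = cong (rowWeakᵇ r ∧_) (weak t)
  strict : ∀ (t : List (List (Fin N))) → colsStrictᵇ (t ++ [] ∷ []) ≡ colsStrictᵇ t
  strict []          = refl
  strict (r ∷ [])    = cong (_∧ true) (colStrictᵇ-[] r)
  strict (r ∷ s ∷ t) = cong (colStrictᵇ r s ∧_) (strict (s ∷ t))
  content : ∀ (t : List (List (Fin N))) → tableauContentᵇ (t ++ [] ∷ []) α ≡ tableauContentᵇ t α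
  content t = true-ext
    (λ e → allFinᵇ⁺ λ i → ≡ᵇ⁺ (trans (sym (same i t)) (≡ᵇ⁻ (allFinᵇ⁻ e i))))
    (λ e → allFinᵇ⁺ λ i → ≡ᵇ⁺ (trans (same i t) (≡ᵇ⁻ (allFinᵇ⁻ e i))))
    where
    same : ∀ i (t : List (List (Fin N))) → sum (map (countᵇ (λ e → e ==ᶠ i)) (t ++ [] ∷ [])) ≡ sum (map (countᵇ (λ e → e ==ᶠ i)) t)
    same i []      = refl
    same i (r ∷ t) = cong (countᵇ (λ e → e ==ᶠ i) r ℕ.+_) (same i t)

-- Removal of special rim hooks

∨⁻ : ∀ {a b} → a ∨ b ≡ true → (a ≡ true) ⊎ (b ≡ true)
∨⁻ {true}  e = inj₁ refl
∨⁻ {false} e = inj₂ e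

n<ᵇn : ∀ k → (k ℕ.<ᵇ k) ≡ false
n<ᵇn zero    = refl
n<ᵇn (suc k) = n<ᵇn k

-- Removing the special hook whose lowest row is l ∷ ls moves each higher row down by one and shortens it by one.
removals : List ℕ → List (List ℕ)
removals []           = []
removals (zero ∷ ls)  = []
removals (suc l ∷ ls) = (map pred ls ++ 0 ∷ []) ∷ map (suc l ∷_) (removals ls)

specialᵇ : List ℕ → List ℕ → Bool
specialᵇ κ μ = isRimHookᵇ κ μ ∧ meetsFirstColumnᵇ κ μ

record Special (κ μ : List ℕ) : Set where
  constructor special
  field
    contained  : containedᵇ κ μ ≡ true
    decreasing : decreasingᵇ μ ≡ true
    one-run    : (runs false (occupied κ μ) ℕ.≡ᵇ 1) ≡ true
    share-one  : shareOneᵇ κ μ ≡ true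
    meets      : meetsFirstColumnᵇ κ μ ≡ true

specialᵇ⁻ : ∀ κ μ → specialᵇ κ μ ≡ true → Special κ μ
specialᵇ⁻ κ μ e
  with r , m ← ∧⁻ {isRimHookᵇ κ μ} e
  with c , r ← ∧⁻ {containedᵇ κ μ} r
  with d , r ← ∧⁻ {decreasingᵇ μ} r
  with o , s ← ∧⁻ {runs false (occupied κ μ) ℕ.≡ᵇ 1} r = special c d o s m

specialᵇ⁺ : ∀ {κ μ} → Special κ μ → specialᵇ κ μ ≡ true
specialᵇ⁺ (special c d o s m) = ∧⁺ (∧⁺ c (∧⁺ d (∧⁺ o s))) m

-- What specialᵇ demands of the rows above a row that the hook occupies and shortens from l to m.
insideᵇ : ℕ → List ℕ → ℕ → List ℕ → Bool
insideᵇ l ls m ms = containedᵇ ls ms ∧ decreasingᵇ (m ∷ ms) ∧ (runs true (occupied ls ms) ℕ.≡ᵇ 0)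
  ∧ shareOneᵇ (l ∷ ls) (m ∷ ms) ∧ meetsFirstColumnᵇ (l ∷ ls) (m ∷ ms)

record Inside (l : ℕ) (ls : List ℕ) (m : ℕ) (ms : List ℕ) : Set where
  constructor inside
  field
    contained  : containedᵇ ls ms ≡ true
    decreasing : decreasingᵇ (m ∷ ms) ≡ true
    no-run     : (runs true (occupied ls ms) ℕ.≡ᵇ 0) ≡ true
    share-one  : shareOneᵇ (l ∷ ls) (m ∷ ms) ≡ true
    meets      : meetsFirstColumnᵇ (l ∷ ls) (m ∷ ms) ≡ true

insideᵇ⁻ : ∀ l ls m ms → insideᵇ l ls m ms ≡ true → Inside l ls m ms
insideᵇ⁻ l ls m ms e
  with c , r ← ∧⁻ {containedᵇ ls ms} e
  with d , r ← ∧⁻ {decreasingᵇ (m ∷ ms)} r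
  with o , r ← ∧⁻ {runs true (occupied ls ms) ℕ.≡ᵇ 0} r
  with s , t ← ∧⁻ {shareOneᵇ (l ∷ ls) (m ∷ ms)} r = inside c d o s t

insideᵇ⁺ : ∀ l ls m ms → Inside l ls m ms → insideᵇ l ls m ms ≡ true
insideᵇ⁺ l ls m ms (inside c d o s t) = ∧⁺ c (∧⁺ d (∧⁺ o (∧⁺ s t)))

decreasing-tail : ∀ l ls → decreasingᵇ (l ∷ ls) ≡ true → decreasingᵇ ls ≡ true
decreasing-tail l []       d = refl
decreasing-tail l (_ ∷ ls) d = proj₂ (∧⁻ d)

-- An untouched lowest row does not interact with a hook above it; `dec` ensures that the shape left
-- behind is still decreasing at this row.
special-unoccupied : ∀ l ls ms → decreasingᵇ (suc l ∷ ls) ≡ true →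
                     specialᵇ (suc l ∷ ls) (suc l ∷ ms) ≡ specialᵇ ls ms
special-unoccupied l ls ms dec = true-ext (λ e → specialᵇ⁺ (to ls ms (specialᵇ⁻ (suc l ∷ ls) (suc l ∷ ms) e)))
                                          (λ e → specialᵇ⁺ (from ls ms dec (specialᵇ⁻ ls ms e)))
  where
  to : ∀ ls ms → Special (suc l ∷ ls) (suc l ∷ ms) → Special ls ms
  to ls ms (special c d o s m) rewrite n<ᵇn l = special (proj₂ (∧⁻ {l ℕ.<ᵇ suc l} c)) (decreasing-tail (suc l) ms d) o (share ls ms s) m
    where
    share : ∀ ls ms → shareOneᵇ (suc l ∷ ls) (suc l ∷ ms) ≡ true → shareOneᵇ ls ms ≡ true
    share []       ms       s = refl
    share (_ ∷ ls) []       s = share-[] ls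
      where
      share-[] : ∀ {l} ls → shareOneᵇ (l ∷ ls) [] ≡ true
      share-[] []      = refl
      share-[] (_ ∷ _) = refl
    share (_ ∷ ls) (_ ∷ ms) s = proj₂ (∧⁻ s)
  from : ∀ ls ms → decreasingᵇ (suc l ∷ ls) ≡ true → Special ls ms → Special (suc l ∷ ls) (suc l ∷ ms)
  from []        []        dec (special c d () s m)
  from (l′ ∷ ls) (m′ ∷ ms) dec (special c d o s m) =
    special (∧⁺ (<ᵇ⁺ (ℕₚ.n<1+n l)) c)
      (∧⁺ (≤ᵇ⁺ {m′} {suc l} (ℕₚ.≤-trans (≤ᵇ⁻ {m′} {l′} (proj₁ (∧⁻ {m′ ℕ.≤ᵇ l′} c)))
                                         (≤ᵇ⁻ {l′} {suc l} (proj₁ (∧⁻ {l′ ℕ.≤ᵇ suc l} dec))))) d)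
      (trans (cong (λ b → runs false (b ∷ occupied (l′ ∷ ls) (m′ ∷ ms)) ℕ.≡ᵇ 1) (n<ᵇn l)) o)
      (∧⁺ (cong (λ b → not (b ∧ (m′ ℕ.<ᵇ l′)) ∨ (l′ ℕ.∸ suc l ℕ.≡ᵇ 1)) (n<ᵇn l)) s) m

-- Once the lowest row is occupied the single allowed run has begun, and the rows above can only
-- continue it.
special-occupied : ∀ l ls m ms → m ℕ.< l → specialᵇ (l ∷ ls) (m ∷ ms) ≡ insideᵇ l ls m ms
special-occupied l ls m ms m<l = true-ext
  (λ e → insideᵇ⁺ l ls m ms (to (specialᵇ⁻ (l ∷ ls) (m ∷ ms) e)))
  (λ e → specialᵇ⁺ (from (insideᵇ⁻ l ls m ms e)))
  where
  to : Special (l ∷ ls) (m ∷ ms) → Inside l ls m ms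
  to (special c d o s t) rewrite <ᵇ⁺ m<l = inside (proj₂ (∧⁻ {m ℕ.≤ᵇ l} c)) d o s t
  from : Inside l ls m ms → Special (l ∷ ls) (m ∷ ms)
  from (inside c d o s t) = special (∧⁺ (≤ᵇ⁺ (ℕₚ.<⇒≤ m<l)) c) d
    (trans (cong (λ b → runs false (b ∷ occupied ls ms) ℕ.≡ᵇ 1) (<ᵇ⁺ m<l)) o) s t

no-run⇒misses : ∀ ls ms → (runs false (occupied ls ms) ℕ.≡ᵇ 0) ≡ true → meetsFirstColumnᵇ ls ms ≡ true → ⊥
no-run⇒misses (zero ∷ ls)  (zero ∷ ms)  o t = no-run⇒misses ls ms o t
no-run⇒misses (suc l ∷ ls) (zero ∷ ms)  () t
no-run⇒misses (l ∷ ls)     (suc m ∷ ms) o t with suc m ℕ.<ᵇ l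
... | false = no-run⇒misses ls ms o t

-- A hook that stops under a nonempty row leaves at least one cell in its top row, and no higher row
-- may be occupied, so it misses the first column.
inside-unoccupied : ∀ l l′ ls m ms → insideᵇ l (suc l′ ∷ ls) m (suc l′ ∷ ms) ≡ true → ⊥
inside-unoccupied l l′ ls m ms e with insideᵇ⁻ l (suc l′ ∷ ls) m (suc l′ ∷ ms) e
... | inside c d o s t rewrite n<ᵇn l′ with m
...   | zero  = contradiction d λ ()
...   | suc m = no-run⇒misses ls ms o t

-- Sharing exactly one column means `suc l′ ∸ m = 1`: the lower row keeps one cell less than the
-- upper row had. This is the origin of `map pred` in `removals`.
inside-occupied : ∀ l l′ ls m m′ ms → m ℕ.< l → m′ ℕ.< suc l′ →
  insideᵇ l (suc l′ ∷ ls) m (m′ ∷ ms) ≡ (l′ ℕ.≡ᵇ m) ∧ insideᵇ (suc l′) ls m′ ms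
inside-occupied l l′ ls m m′ ms m<l m′<l′ = true-ext
  (λ e → to (insideᵇ⁻ l (suc l′ ∷ ls) m (m′ ∷ ms) e))
  (λ e → insideᵇ⁺ l (suc l′ ∷ ls) m (m′ ∷ ms) (from (≡ᵇ⁻ (proj₁ (∧⁻ e))) (insideᵇ⁻ (suc l′) ls m′ ms (proj₂ (∧⁻ {l′ ℕ.≡ᵇ m} e)))))
  where
  to : Inside l (suc l′ ∷ ls) m (m′ ∷ ms) → (l′ ℕ.≡ᵇ m) ∧ insideᵇ (suc l′) ls m′ ms ≡ true
  to (inside c d o s t) rewrite <ᵇ⁺ m<l | <ᵇ⁺ m′<l′ =
    ∧⁺ (≡ᵇ⁺ l′≡m) (insideᵇ⁺ (suc l′) ls m′ ms (inside (proj₂ (∧⁻ {m′ ℕ.≤ᵇ suc l′} c)) (proj₂ (∧⁻ {m′ ℕ.≤ᵇ m} d)) o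
      (proj₂ (∧⁻ {suc l′ ℕ.∸ m ℕ.≡ᵇ 1} s)) (meets t)))
    where
    ∸≡1 : ∀ a b → suc a ℕ.∸ b ≡ 1 → a ≡ b
    ∸≡1 zero    zero    e = refl
    ∸≡1 (suc a) zero    ()
    ∸≡1 (suc a) (suc b) e = cong suc (∸≡1 a b e)
    ∸≡1 zero    (suc b) e = contradiction (trans (sym (ℕₚ.0∸n≡0 b)) e) λ ()
    l′≡m : l′ ≡ m
    l′≡m = ∸≡1 l′ m (≡ᵇ⁻ (proj₁ (∧⁻ {suc l′ ℕ.∸ m ℕ.≡ᵇ 1} s)))
    meets : meetsFirstColumnᵇ (l ∷ suc l′ ∷ ls) (m ∷ m′ ∷ ms) ≡ true →
            meetsFirstColumnᵇ (suc l′ ∷ ls) (m′ ∷ ms) ≡ true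
    meets t with ∨⁻ {(m ℕ.≡ᵇ 0) ∧ (1 ℕ.≤ᵇ l)} t
    ... | inj₂ t′ = t′
    -- If the lower row is emptied, then `l′ = 0` and the upper row loses its only cell, so the rows
    -- from the upper one on meet the first column as well.
    ... | inj₁ m≡0 = cong (λ b → (b ∧ true) ∨ meetsFirstColumnᵇ ls ms) (≡ᵇ⁺ (ℕₚ.n<1⇒n≡0 (subst (m′ ℕ.<_)
            (cong suc (trans l′≡m (≡ᵇ⁻ {m} {0} (proj₁ (∧⁻ m≡0))))) m′<l′)))
  from : l′ ≡ m → Inside (suc l′) ls m′ ms → Inside l (suc l′ ∷ ls) m (m′ ∷ ms)
  from refl (inside c d o s t) = inside (∧⁺ (≤ᵇ⁺ (ℕₚ.<⇒≤ m′<l′)) c) (∧⁺ (≤ᵇ⁺ (ℕₚ.≤-pred m′<l′)) d)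
    (trans (cong (λ b → runs true (b ∷ occupied ls ms) ℕ.≡ᵇ 0) (<ᵇ⁺ m′<l′)) o)
    (∧⁺ (trans (cong (λ b → not ((l′ ℕ.<ᵇ l) ∧ (m′ ℕ.<ᵇ suc l′)) ∨ b) (≡ᵇ⁺ (ℕₚ.m+n∸n≡m 1 l′))) (Boolₚ.∨-zeroʳ (not ((l′ ℕ.<ᵇ l) ∧ (m′ ℕ.<ᵇ suc l′))))) s)
    (trans (cong (((l′ ℕ.≡ᵇ 0) ∧ (1 ℕ.≤ᵇ l)) ∨_) t) (Boolₚ.∨-zeroʳ ((l′ ℕ.≡ᵇ 0) ∧ (1 ℕ.≤ᵇ l))))

-- With only empty rows above, the hook ends in this row and has to reach the first column there.
inside-zeros : ∀ l k m → insideᵇ (suc l) (replicate k 0) m (replicate k 0) ≡ (0 ℕ.≡ᵇ m)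
inside-zeros l k m = true-ext
  (λ e → to m (Inside.meets (insideᵇ⁻ (suc l) (replicate k 0) m (replicate k 0) e)))
  (λ e → from m e)
  where
  misses : ∀ k → meetsFirstColumnᵇ (replicate k 0) (replicate k 0) ≡ false
  misses zero    = refl
  misses (suc k) = misses k
  to : ∀ m → meetsFirstColumnᵇ (suc l ∷ replicate k 0) (m ∷ replicate k 0) ≡ true → (0 ℕ.≡ᵇ m) ≡ true
  to zero    t = refl
  to (suc m) t = trans (sym (misses k)) t
  contained : ∀ k → containedᵇ (replicate k 0) (replicate k 0) ≡ true
  contained zero    = refl
  contained (suc k) = contained k
  decreasing : ∀ k → decreasingᵇ (0 ∷ replicate k 0) ≡ true
  decreasing zero    = refl
  decreasing (suc k) = decreasing k
  no-run : ∀ b k → (runs b (occupied (replicate k 0) (replicate k 0)) ℕ.≡ᵇ 0) ≡ true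
  no-run b zero    = refl
  no-run b (suc k) = no-run false k
  share : ∀ l k → shareOneᵇ (l ∷ replicate k 0) (0 ∷ replicate k 0) ≡ true
  share l zero    = refl
  share l (suc k) = ∧⁺ (trans (cong (λ b → not b ∨ false) (Boolₚ.∧-zeroʳ (0 ℕ.<ᵇ l))) refl) (share 0 k)
  from : ∀ m → (0 ℕ.≡ᵇ m) ≡ true → insideᵇ (suc l) (replicate k 0) m (replicate k 0) ≡ true
  from zero e = insideᵇ⁺ (suc l) (replicate k 0) 0 (replicate k 0) (inside (contained k) (decreasing k) (no-run true k) (share (suc l) k) refl)

zeros-after-0 : ∀ ls → decreasingᵇ (0 ∷ ls) ≡ true → ls ≡ replicate (length ls) 0
zeros-after-0 []        d = refl
zeros-after-0 (zero ∷ ls) d = cong (0 ∷_) (zeros-after-0 ls d)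

∑-below-zeros : ∀ k (f : List ℕ → ℤ) → ∑ (below (replicate k 0)) f ≡ f (replicate k 0)
∑-below-zeros zero    f = ∑-single [] f
∑-below-zeros (suc k) f = trans (∑-below 0 (replicate k 0) f)
  (trans (∑-single 0 _) (∑-below-zeros k (λ ms → f (0 ∷ ms))))

∑-upTo-snoc : ∀ k (f : ℕ → ℤ) → ∑ (upTo (suc k)) f ≡ ∑ (upTo k) f + f k
∑-upTo-snoc k f = trans (cong (λ xs → ∑ xs f) (sym (Listₚ.upTo-∷ʳ k)))
  (trans (∑-++ (upTo k) (k ∷ []) f) (cong (_+_ (∑ (upTo k) f)) (∑-single k f)))

-- A special hook is determined by its lowest row: each occupied row fixes what remains of the one
-- below it, by `inside-occupied`, and the top nonempty row is emptied.
∑-inside : ∀ l ls (f : List ℕ → ℤ) → decreasingᵇ (suc l ∷ ls) ≡ true →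
  (∑[ m ← upTo (suc l) ] ∑[ ms ← below ls ] ⟦ insideᵇ (suc l) ls m ms ⟧ * f (m ∷ ms)) ≡
  f (map pred ls ++ 0 ∷ [])
∑-inside l ls f dec = go l ls f dec
  where
  open ≡-Reasoning
  zeros-snoc : ∀ k → 0 ∷ replicate k 0 ≡ map pred (replicate k 0) ++ 0 ∷ []
  zeros-snoc zero    = refl
  zeros-snoc (suc k) = cong (0 ∷_) (zeros-snoc k)
  zeros : ∀ l k f → (∑[ m ← upTo (suc l) ] ∑[ ms ← below (replicate k 0) ]
             ⟦ insideᵇ (suc l) (replicate k 0) m ms ⟧ * f (m ∷ ms)) ≡ f (map pred (replicate k 0) ++ 0 ∷ [])
  zeros l k f = begin
    (∑[ m ← upTo (suc l) ] ∑[ ms ← below (replicate k 0) ] ⟦ insideᵇ (suc l) (replicate k 0) m ms ⟧ * f (m ∷ ms))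
      ≡⟨ ∑-cong (upTo (suc l)) (λ m → trans (∑-below-zeros k _)
           (cong (λ b → ⟦ b ⟧ * f (m ∷ replicate k 0)) (inside-zeros l k m))) ⟩
    (∑[ m ← upTo (suc l) ] ⟦ 0 ℕ.≡ᵇ m ⟧ * f (m ∷ replicate k 0))
      ≡⟨ ∑-δ (suc l) 0 _ (s≤s z≤n) ⟩
    f (0 ∷ replicate k 0)
      ≡⟨ cong f (zeros-snoc k) ⟩
    f (map pred (replicate k 0) ++ 0 ∷ []) ∎
  go : ∀ l ls (f : List ℕ → ℤ) → decreasingᵇ (suc l ∷ ls) ≡ true →
    (∑[ m ← upTo (suc l) ] ∑[ ms ← below ls ] ⟦ insideᵇ (suc l) ls m ms ⟧ * f (m ∷ ms)) ≡
    f (map pred ls ++ 0 ∷ [])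
  go l []             f dec = zeros l 0 f
  go l (zero ∷ ls)    f dec = subst (λ ls → (∑[ m ← upTo (suc l) ] ∑[ ms ← below (0 ∷ ls) ]
      ⟦ insideᵇ (suc l) (0 ∷ ls) m ms ⟧ * f (m ∷ ms)) ≡ f (map pred (0 ∷ ls) ++ 0 ∷ []))
    (sym (zeros-after-0 ls dec)) (zeros l (suc (length ls)) f)
  go l (suc l′ ∷ ls)  f dec = begin
    (∑[ m ← upTo (suc l) ] ∑[ ms ← below (suc l′ ∷ ls) ] ⟦ insideᵇ (suc l) (suc l′ ∷ ls) m ms ⟧ * f (m ∷ ms))
      ≡⟨ ∑-upTo-cong (suc l) (λ m m<l → begin
           (∑[ ms ← below (suc l′ ∷ ls) ] ⟦ insideᵇ (suc l) (suc l′ ∷ ls) m ms ⟧ * f (m ∷ ms))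
             -- The last value `m′ = suc l′` would leave the upper row unoccupied; it is split off
             -- because it contributes nothing.
             ≡⟨ trans (∑-below (suc l′) ls _) (∑-upTo-snoc (suc l′) _) ⟩
           (∑[ m′ ← upTo (suc l′) ] ∑[ ms ← below ls ] ⟦ insideᵇ (suc l) (suc l′ ∷ ls) m (m′ ∷ ms) ⟧ * f (m ∷ m′ ∷ ms))
             + (∑[ ms ← below ls ] ⟦ insideᵇ (suc l) (suc l′ ∷ ls) m (suc l′ ∷ ms) ⟧ * f (m ∷ suc l′ ∷ ms))
             ≡⟨ cong₂ _+_
                 (∑-upTo-cong (suc l′) λ m′ m′<l′ → ∑-cong (below ls) λ ms → trans
                   (cong (λ b → ⟦ b ⟧ * f (m ∷ m′ ∷ ms)) (inside-occupied (suc l) l′ ls m m′ ms m<l m′<l′))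
                   (⟦⟧-∧-* (l′ ℕ.≡ᵇ m) (insideᵇ (suc l′) ls m′ ms) _))
                 (∑-zero (below ls) λ ms → cong (_* f (m ∷ suc l′ ∷ ms))
                   (⟦⟧-false (inside-unoccupied (suc l) l′ ls m ms))) ⟩
           (∑[ m′ ← upTo (suc l′) ] ∑[ ms ← below ls ] ⟦ l′ ℕ.≡ᵇ m ⟧ * (⟦ insideᵇ (suc l′) ls m′ ms ⟧ * f (m ∷ m′ ∷ ms))) + + 0
             ≡⟨ ℤₚ.+-identityʳ _ ⟩
           (∑[ m′ ← upTo (suc l′) ] ∑[ ms ← below ls ] ⟦ l′ ℕ.≡ᵇ m ⟧ * (⟦ insideᵇ (suc l′) ls m′ ms ⟧ * f (m ∷ m′ ∷ ms)))
             ≡⟨ trans (∑-cong (upTo (suc l′)) λ m′ → ∑-*ˡ ⟦ l′ ℕ.≡ᵇ m ⟧ (below ls) _)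
                      (∑-*ˡ ⟦ l′ ℕ.≡ᵇ m ⟧ (upTo (suc l′)) _) ⟩
           ⟦ l′ ℕ.≡ᵇ m ⟧ * g m ∎) ⟩
    (∑[ m ← upTo (suc l) ] ⟦ l′ ℕ.≡ᵇ m ⟧ * g m)
      ≡⟨ ∑-δ (suc l) l′ g (≤ᵇ⁻ (proj₁ (∧⁻ {suc l′ ℕ.≤ᵇ suc l} dec))) ⟩
    g l′
      ≡⟨ go l′ ls (λ ms → f (l′ ∷ ms)) (proj₂ (∧⁻ {suc l′ ℕ.≤ᵇ suc l} dec)) ⟩
    f (l′ ∷ map pred ls ++ 0 ∷ []) ∎
    where
    g : ℕ → ℤ
    g m = ∑[ m′ ← upTo (suc l′) ] ∑[ ms ← below ls ] ⟦ insideᵇ (suc l′) ls m′ ms ⟧ * f (m ∷ m′ ∷ ms)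

-- Either the lowest row is shortened, which leaves a single hook by `∑-inside`, or the hook lies in
-- the rows above.
∑-special : ∀ κ (f : List ℕ → ℤ) → decreasingᵇ κ ≡ true →
  (∑[ μ ← below κ ] ⟦ specialᵇ κ μ ⟧ * f μ) ≡ ∑ (removals κ) f
∑-special []           f dec = trans (∑-single [] _) (sym (∑-[] f))
∑-special (zero ∷ ls)  f dec = subst (λ ls → (∑[ μ ← below (0 ∷ ls) ] ⟦ specialᵇ (0 ∷ ls) μ ⟧ * f μ) ≡ ∑ [] f)
  (sym (zeros-after-0 ls dec)) (trans (∑-below-zeros (suc k) _)
    (trans (cong (_* f (replicate (suc k) 0)) (⟦⟧-false λ e → misses (suc k)
       (Special.meets (specialᵇ⁻ (replicate (suc k) 0) (replicate (suc k) 0) e)))) (sym (∑-[] f))))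
  where
  k = length ls
  misses : ∀ k → meetsFirstColumnᵇ (replicate k 0) (replicate k 0) ≡ true → ⊥
  misses (suc k) e = misses k e
∑-special (suc l ∷ ls) f dec = begin
  (∑[ μ ← below (suc l ∷ ls) ] ⟦ specialᵇ (suc l ∷ ls) μ ⟧ * f μ)
    ≡⟨ trans (∑-below (suc l) ls _) (∑-upTo-snoc (suc l) _) ⟩
  (∑[ m ← upTo (suc l) ] ∑[ ms ← below ls ] ⟦ specialᵇ (suc l ∷ ls) (m ∷ ms) ⟧ * f (m ∷ ms))
    + (∑[ ms ← below ls ] ⟦ specialᵇ (suc l ∷ ls) (suc l ∷ ms) ⟧ * f (suc l ∷ ms))
    ≡⟨ cong₂ _+_
         (∑-upTo-cong (suc l) λ m m<l → ∑-cong (below ls) λ ms →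
           cong (λ b → ⟦ b ⟧ * f (m ∷ ms)) (special-occupied (suc l) ls m ms m<l))
         (∑-cong (below ls) λ ms → cong (λ b → ⟦ b ⟧ * f (suc l ∷ ms)) (special-unoccupied l ls ms dec)) ⟩
  (∑[ m ← upTo (suc l) ] ∑[ ms ← below ls ] ⟦ insideᵇ (suc l) ls m ms ⟧ * f (m ∷ ms))
    + (∑[ ms ← below ls ] ⟦ specialᵇ ls ms ⟧ * f (suc l ∷ ms))
    ≡⟨ cong₂ _+_ (∑-inside l ls f dec) (trans (∑-special ls (λ ms → f (suc l ∷ ms)) (decreasing-tail (suc l) ls dec))
         (sym (∑-map (removals ls) (suc l ∷_) f))) ⟩
  f (map pred ls ++ 0 ∷ []) + ∑ (map (suc l ∷_) (removals ls)) f
    ≡⟨ ∑-∷ _ _ f ⟨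
  ∑ (removals (suc l ∷ ls)) f ∎
  where open ≡-Reasoning

-- Tabloids as terms of the determinant

stair-pred : ∀ ls → All (1 ℕ.≤_) ls → stair ls ≡ map suc (stair (map pred ls))
stair-pred []           []       = refl
stair-pred (suc l ∷ ls) (_ ∷ ps) = cong₂ _∷_ (cong (λ k → suc (l ℕ.+ k)) (sym (Listₚ.length-map pred ls)))
                                             (stair-pred ls ps)

sum-pred : ∀ ls → All (1 ℕ.≤_) ls → sum (map pred ls) ℕ.+ length ls ≡ sum ls
sum-pred []           []       = refl
sum-pred (suc l ∷ ls) (_ ∷ ps) = trans (lemma l (sum (map pred ls)) (length ls)) (cong (suc l ℕ.+_) (sum-pred ls ps))
  where
  lemma : ∀ a b c → a ℕ.+ b ℕ.+ suc c ≡ suc a ℕ.+ (b ℕ.+ c)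
  lemma = ℕ-solve-∀

-- The special hooks of a shape without empty rows, indexed by their lowest row:
-- length, number of rows, and the shape left after removal (without its empty top row).
hooks : List ℕ → List (ℕ × ℕ × List ℕ)
hooks []       = []
hooks (l ∷ ls) = (l ℕ.+ length ls , suc (length ls) , map pred ls) ∷
                 map (λ (a , r , κ) → a , r , l ∷ κ) (hooks ls)

hooks-size : ∀ ν → All (1 ℕ.≤_) ν →
  All (λ (a , r , κ) → (suc (length κ) ≡ length ν) × (sum κ ℕ.+ a ≡ sum ν)) (hooks ν)
hooks-size []       []       = []
hooks-size (l ∷ ls) (_ ∷ ps) =
  (cong suc (Listₚ.length-map pred ls) ,
    trans (lemma (sum (map pred ls)) l (length ls)) (cong (l ℕ.+_) (sum-pred ls ps))) ∷
  Allₚ.map⁺ (All.map (λ {(a , r , κ)} (len , sz) → cong suc len ,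
    trans (ℕₚ.+-assoc l (sum κ) a) (cong (l ℕ.+_) sz)) (hooks-size ls ps))
  where
  lemma : ∀ a b c → a ℕ.+ (b ℕ.+ c) ≡ b ℕ.+ (a ℕ.+ c)
  lemma = ℕ-solve-∀

hookRows : List ℕ → List ℕ → ℕ
hookRows κ μ = countᵇ (λ b → b) (occupied κ μ)

hooks-rows : ∀ ν → All (1 ℕ.≤_) ν → decreasingᵇ ν ≡ true →
  All (λ (a , r , κ) → hookRows ν (κ ++ 0 ∷ []) ≡ r) (hooks ν)
hooks-rows []       []       dec = []
hooks-rows (l ∷ ls) (p ∷ ps) dec = all-occupied l ls p ps dec ∷
  Allₚ.map⁺ (All.map (λ {(a , r , κ)} e → trans
    (cong (λ b → (if b then 1 else 0) ℕ.+ hookRows ls (κ ++ 0 ∷ [])) (n<ᵇn l)) e)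
    (hooks-rows ls ps (decreasing-tail l ls dec)))
  where
  all-occupied : ∀ l ls → 1 ℕ.≤ l → All (1 ℕ.≤_) ls → decreasingᵇ (l ∷ ls) ≡ true →
    hookRows (l ∷ ls) (map pred ls ++ 0 ∷ []) ≡ suc (length ls)
  all-occupied l []           l≥1 []       dec =
    cong (λ b → (if b then 1 else 0) ℕ.+ 0) (<ᵇ⁺ l≥1)
  all-occupied l (suc x ∷ ls) l≥1 (p ∷ ps) dec = cong₂ (λ b k → (if b then 1 else 0) ℕ.+ k)
    (<ᵇ⁺ (≤ᵇ⁻ {suc x} {l} (proj₁ (∧⁻ {suc x ℕ.≤ᵇ l} dec))))
    (all-occupied (suc x) ls p ps (proj₂ (∧⁻ {suc x ℕ.≤ᵇ l} dec)))

∑-removals : ∀ ν (f : List ℕ → ℤ) → All (1 ℕ.≤_) ν →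
  ∑ (removals ν) f ≡ ∑[ h ← hooks ν ] f (proj₂ (proj₂ h) ++ 0 ∷ [])
∑-removals []           f []       = trans (∑-[] _) (sym (∑-[] _))
∑-removals (suc l ∷ ls) f (_ ∷ ps) = begin
  ∑ ((map pred ls ++ 0 ∷ []) ∷ map (suc l ∷_) (removals ls)) f
    ≡⟨ ∑-∷ _ _ f ⟩
  f (map pred ls ++ 0 ∷ []) + ∑ (map (suc l ∷_) (removals ls)) f
    ≡⟨ cong (_+_ (f (map pred ls ++ 0 ∷ []))) (trans (∑-map (removals ls) (suc l ∷_) f)
         (trans (∑-removals ls (λ κ → f (suc l ∷ κ)) ps) (sym (∑-map (hooks ls) _ _)))) ⟩
  f (map pred ls ++ 0 ∷ []) + (∑[ h ← map _ (hooks ls) ] f (proj₂ (proj₂ h) ++ 0 ∷ []))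
    ≡⟨ ∑-∷ _ _ (λ h → f (proj₂ (proj₂ h) ++ 0 ∷ [])) ⟨
  (∑[ h ← hooks (suc l ∷ ls) ] f (proj₂ (proj₂ h) ++ 0 ∷ [])) ∎
  where open ≡-Reasoning

-- Deleting the entry of one row leaves a staircase raised by one: the rows before it have one row
-- fewer after them, and the rows after it lose one cell each, exactly as when the hook starting in
-- that row is removed. The deleted entry is the length of this hook. In row i of ℓ the hook has r =
-- ℓ - i + 1 rows, so the alternating sign (-1)^(i-1) is `sign (ℓ + r)`.
lap-stair : ∀ ν (ψ : ℕ → List ℕ → ℤ) → All (1 ℕ.≤_) ν →
  lap ψ (stair ν) ≡ ∑[ h ← hooks ν ] sign (length ν ℕ.+ proj₁ (proj₂ h)) * ψ (proj₁ h) (map suc (stair (proj₂ (proj₂ h))))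
lap-stair []       ψ []       = sym (∑-[] _)
lap-stair (l ∷ ls) ψ (_ ∷ ps) = begin
  ψ b (stair ls) - lap (λ y ys → ψ y (b ∷ ys)) (stair ls)
    ≡⟨ cong₂ _-_ head tail ⟩
  H (b , suc (length ls) , map pred ls) - (∑[ h ← hooks ls ] - (+ 1) * H (lift h))
    ≡⟨ cong (λ e → H (b , suc (length ls) , map pred ls) - e) (∑-*ˡ (- (+ 1)) (hooks ls) _) ⟩
  H (b , suc (length ls) , map pred ls) - - (+ 1) * (∑[ h ← hooks ls ] H (lift h))
    ≡⟨ lemma (H (b , suc (length ls) , map pred ls)) _ ⟩
  H (b , suc (length ls) , map pred ls) + (∑[ h ← hooks ls ] H (lift h))
    ≡⟨ cong (_+_ (H (b , suc (length ls) , map pred ls))) (∑-map (hooks ls) lift H) ⟨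
  H (b , suc (length ls) , map pred ls) + ∑ (map lift (hooks ls)) H
    ≡⟨ ∑-∷ _ _ H ⟨
  ∑ (hooks (l ∷ ls)) H ∎
  where
  open ≡-Reasoning
  b = l ℕ.+ length ls
  lift : ℕ × ℕ × List ℕ → ℕ × ℕ × List ℕ
  lift (a , r , κ) = a , r , l ∷ κ
  H : ℕ × ℕ × List ℕ → ℤ
  H (a , r , κ) = sign (suc (length ls) ℕ.+ r) * ψ a (map suc (stair κ))
  lemma : ∀ x y → x - - (+ 1) * y ≡ x + y
  lemma = solve-∀
  head : ψ b (stair ls) ≡ sign (suc (length ls) ℕ.+ suc (length ls)) * ψ b (map suc (stair (map pred ls)))
  head = sym (trans (cong₂ _*_ (trans (sign-+ (suc (length ls)) (suc (length ls))) (sign² (suc (length ls))))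
                               (cong (ψ b) (sym (stair-pred ls ps))))
                    (ℤₚ.*-identityˡ _))
  tail : lap (λ y ys → ψ y (b ∷ ys)) (stair ls) ≡ ∑[ h ← hooks ls ] - (+ 1) * H (lift h)
  tail = trans (lap-stair ls _ ps) (∑-congᴬ (hooks-size ls ps) λ (a , r , κ) (len , _) → begin
    sign (length ls ℕ.+ r) * ψ a (b ∷ map suc (stair κ))
      ≡⟨ cong₂ (λ s k → s * ψ a (k ∷ map suc (stair κ))) (sym (ℤₚ.neg-involutive (sign (length ls ℕ.+ r))))
           (trans (cong (l ℕ.+_) (sym len)) (ℕₚ.+-suc l (length κ))) ⟩
    - - sign (length ls ℕ.+ r) * ψ a (map suc (stair (l ∷ κ)))
      ≡⟨ cong (λ s → - s * ψ a (map suc (stair (l ∷ κ)))) (sign-suc (length ls ℕ.+ r)) ⟨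
    - sign (suc (length ls) ℕ.+ r) * ψ a (map suc (stair (l ∷ κ)))
      ≡⟨ lemma₂ (sign (suc (length ls) ℕ.+ r)) _ ⟩
    - (+ 1) * H (lift (a , r , κ)) ∎)
    where
    lemma₂ : ∀ x y → - x * y ≡ - (+ 1) * (x * y)
    lemma₂ = solve-∀

length≤sum : ∀ ls → All (1 ℕ.≤_) ls → length ls ℕ.≤ sum ls
length≤sum []       []       = z≤n
length≤sum (l ∷ ls) (p ∷ ps) = ℕₚ.+-mono-≤ p (length≤sum ls ps)

stair-bound : ∀ ν → All (1 ℕ.≤_) ν → All (ℕ._≤ sum ν) (stair ν)
stair-bound []       []       = []
stair-bound (l ∷ ls) (_ ∷ ps) = ℕₚ.+-monoʳ-≤ l (length≤sum ls ps) ∷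
  All.map (λ b≤ → ℕₚ.≤-trans b≤ (ℕₚ.m≤n+m (sum ls) l)) (stair-bound ls ps)

removals-snoc : ∀ ν → removals (ν ++ 0 ∷ []) ≡ map (_++ 0 ∷ []) (removals ν)
removals-snoc []           = refl
removals-snoc (zero ∷ ls)  = refl
removals-snoc (suc l ∷ ls) = cong₂ _∷_ (cong (_++ 0 ∷ []) (Listₚ.map-++ pred ls (0 ∷ [])))
  (trans (cong (map (suc l ∷_)) (removals-snoc ls))
    (trans (sym (Listₚ.map-∘ (removals ls))) (Listₚ.map-∘ (removals ls))))

all-length-removals : ∀ ν → All (λ μ → length μ ≡ length ν) (removals ν)
all-length-removals []           = []
all-length-removals (zero ∷ ls)  = []
all-length-removals (suc l ∷ ls) =
  trans (Listₚ.length-++ (map pred ls)) (trans (ℕₚ.+-comm _ 1) (cong suc (Listₚ.length-map pred ls))) ∷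
  Allₚ.map⁺ (All.map (cong suc) (all-length-removals ls))

sum-snoc-0 : ∀ μ → sum (μ ++ 0 ∷ []) ≡ sum μ
sum-snoc-0 μ = trans (ListActₚ.sum-++ μ (0 ∷ [])) (ℕₚ.+-identityʳ (sum μ))

hookRows-snoc-0 : ∀ κ μ → length μ ≡ length κ → hookRows (κ ++ 0 ∷ []) (μ ++ 0 ∷ []) ≡ hookRows κ μ
hookRows-snoc-0 []       []       e = refl
hookRows-snoc-0 (l ∷ κ)  (m ∷ μ)  e =
  cong ((if m ℕ.<ᵇ l then 1 else 0) ℕ.+_) (hookRows-snoc-0 κ μ (ℕₚ.suc-injective e))

decompose : ∀ κ → decreasingᵇ κ ≡ true →
  ∃₂ λ ν z → All (1 ℕ.≤_) ν × decreasingᵇ ν ≡ true × κ ≡ ν ++ replicate z 0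
decompose []           dec = [] , 0 , [] , refl , refl
decompose (zero ∷ ls)  dec = [] , suc (length ls) , [] , refl , cong (0 ∷_) (zeros-after-0 ls dec)
decompose (suc l ∷ ls) dec with decompose ls (decreasing-tail (suc l) ls dec)
... | []    , z , ps , dν , refl = suc l ∷ [] , z , s≤s z≤n ∷ ps , refl , refl
... | x ∷ ν , z , ps , dν , refl = suc l ∷ x ∷ ν , z , s≤s z≤n ∷ ps , ∧⁺ (proj₁ (∧⁻ {x ℕ.≤ᵇ suc l} dec)) dν , refl

containedᵇ⇒sum≤ : ∀ κ μ → containedᵇ κ μ ≡ true → sum μ ℕ.≤ sum κ
containedᵇ⇒sum≤ []       []       c = z≤n
containedᵇ⇒sum≤ (l ∷ ls) (m ∷ ms) c = ℕₚ.+-mono-≤ (≤ᵇ⁻ (proj₁ (∧⁻ {m ℕ.≤ᵇ l} c)))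
                                                   (containedᵇ⇒sum≤ ls ms (proj₂ (∧⁻ {m ℕ.≤ᵇ l} c)))

meets⇒sum< : ∀ κ μ → containedᵇ κ μ ≡ true → meetsFirstColumnᵇ κ μ ≡ true → sum μ ℕ.< sum κ
meets⇒sum< (l ∷ ls) (m ∷ ms) c t with ∨⁻ {(m ℕ.≡ᵇ 0) ∧ (1 ℕ.≤ᵇ l)} t
... | inj₁ e = ℕₚ.+-mono-<-≤ (subst (ℕ._< l) (sym (≡ᵇ⁻ {m} {0} (proj₁ (∧⁻ e)))) (≤ᵇ⁻ {1} {l} (proj₂ (∧⁻ {m ℕ.≡ᵇ 0} e))))
                             (containedᵇ⇒sum≤ ls ms (proj₂ (∧⁻ {m ℕ.≤ᵇ l} c)))
... | inj₂ e = ℕₚ.+-mono-≤-< (≤ᵇ⁻ (proj₁ (∧⁻ {m ℕ.≤ᵇ l} c))) (meets⇒sum< ls ms (proj₂ (∧⁻ {m ℕ.≤ᵇ l} c)) e)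

-- The right-hand side is the usual sign (-1)^(r-1) of a rim hook with `r` rows; `|W|` records it by
-- counting the even ones.
sign-even : ∀ r → sign (if isEvenᵇ r then 1 else 0) ≡ - sign r
sign-even zero          = refl
sign-even (suc zero)    = refl
sign-even (suc (suc r)) = sign-even r

sign-|W| : ∀ h T → sign (|W| (h ∷ T)) ≡ - sign (rows h) * sign (|W| T)
sign-|W| h T = trans (sign-+ (if isEvenᵇ (rows h) then 1 else 0) (|W| T)) (cong (_* sign (|W| T)) (sign-even (rows h)))

isEmptyShapeᵇ-zeros : ∀ k → isEmptyShapeᵇ (replicate k 0) ≡ true
isEmptyShapeᵇ-zeros zero    = refl
isEmptyShapeᵇ-zeros (suc k) = isEmptyShapeᵇ-zeros k

module TabloidExpansion
  (n : ℕ) (F : List ℕ → ℤ)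
  (F-↭ : ∀ {π ρ} → π ↭ ρ → F π ≡ F ρ)
  (F-0 : ∀ π → F (0 ∷ π) ≡ F π)
  (F-support : ∀ π → ¬ (sum π ≡ n) → F π ≡ + 0)
  where

  open JacobiTrudi n F F-↭ F-0 F-support

  J-++-zeros : ∀ ν z π → J (ν ++ replicate z 0) π ≡ J ν π
  J-++-zeros ν zero    π = cong (λ κ → J κ π) (Listₚ.++-identityʳ ν)
  J-++-zeros ν (suc z) π = trans (cong (λ κ → J κ π) (sym (Listₚ.∷ʳ-++ ν 0 (replicate z 0))))
    (trans (J-++-zeros (ν ++ 0 ∷ []) z π) (J-snoc-0 ν π))

  removalTerm : List ℕ → List ℕ → List ℕ → ℤ
  removalTerm κ π μ = - sign (hookRows κ μ) * J μ (sum κ ℕ.∸ sum μ ∷ π)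

  -- The expansion along column 0 deletes one staircase entry at a time, which by `lap-stair` is the
  -- removal of one special hook.
  J-removals-positive : ∀ x ν π → All (1 ℕ.≤_) (x ∷ ν) → decreasingᵇ (x ∷ ν) ≡ true → sum (x ∷ ν) ℕ.≤ n →
    J (x ∷ ν) π ≡ ∑ (removals (x ∷ ν)) (removalTerm (x ∷ ν) π)
  J-removals-positive x ν π pos dec ≤n = begin
    sign p * lap (λ r rs → ∑[ k ← upTo (suc n) ] r 0 k * det p 1 rs (k ∷ π)) (map v (stair κ))
      -- Every row number is at most `sum κ ≤ n`, so no entry of column 0 is lost to the truncation
      -- at `n`.
      ≡⟨ cong (_*_ (sign p)) (trans (lap-map v (λ r rs → ∑[ k ← upTo (suc n) ] r 0 k * det p 1 rs (k ∷ π)) (stair κ)) (lap-cong↭ (stair κ) λ b bs q →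
           ∑-δ (suc n) b (λ k → det p 1 (map v bs) (k ∷ π))
             (s≤s (ℕₚ.≤-trans (All.head (↭ₚ.All-resp-↭ (↭-sym q) (stair-bound κ pos))) ≤n)))) ⟩
    sign p * lap (λ b bs → det p 1 (map v bs) (b ∷ π)) (stair κ)
      ≡⟨ cong (_*_ (sign p)) (lap-stair κ (λ b bs → det p 1 (map v bs) (b ∷ π)) pos) ⟩
    sign p * (∑[ h ← hooks κ ] sign (length κ ℕ.+ proj₁ (proj₂ h)) * det p 1 (map v (map suc (stair (proj₂ (proj₂ h))))) (proj₁ h ∷ π))
      ≡⟨ ∑-*ˡ (sign p) (hooks κ) _ ⟨
    (∑[ h ← hooks κ ] sign p * (sign (length κ ℕ.+ proj₁ (proj₂ h)) * det p 1 (map v (map suc (stair (proj₂ (proj₂ h))))) (proj₁ h ∷ π)))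
      ≡⟨ ∑-congᴬ (All.zip (hooks-size κ pos , hooks-rows κ pos dec)) (λ (a , r , μ) ((len , sz) , rw) → term a r μ len sz rw) ⟩
    (∑[ h ← hooks κ ] removalTerm κ π (proj₂ (proj₂ h) ++ 0 ∷ []))
      ≡⟨ ∑-removals κ (removalTerm κ π) pos ⟨
    ∑ (removals κ) (removalTerm κ π) ∎
    where
    open ≡-Reasoning
    κ = x ∷ ν
    p = length ν
    term : ∀ a r μ → suc (length μ) ≡ length κ → sum μ ℕ.+ a ≡ sum κ → hookRows κ (μ ++ 0 ∷ []) ≡ r →
      sign p * (sign (suc p ℕ.+ r) * det p 1 (map v (map suc (stair μ))) (a ∷ π)) ≡ removalTerm κ π (μ ++ 0 ∷ [])
    term a r μ len sz rw = begin
      sign p * (sign (suc p ℕ.+ r) * det p 1 (map v (map suc (stair μ))) (a ∷ π))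
        ≡⟨ cong₂ (λ s d → sign p * (s * d)) (trans (sign-suc (p ℕ.+ r)) (cong -_ (sign-+ p r)))
             (trans (det-shift p 0 (stair μ) (a ∷ π)) (cong (λ m → det m 0 (map v (stair μ)) (a ∷ π))
               (sym (ℕₚ.suc-injective len)))) ⟩
      sign p * (- (sign p * sign r) * J μ (a ∷ π))
        -- The factor `sign p` built into `det` cancels against the one in the sign of the deleted
        -- row, and (-1)^(r-1) is left.
        ≡⟨ lemma (sign p) (sign r) _ ⟩
      sign p * sign p * (- sign r * J μ (a ∷ π))
        ≡⟨ cong₂ _*_ (sign² p) (cong₂ _*_ (cong (λ r → - sign r) (sym rw))
             (trans (sym (J-snoc-0 μ (a ∷ π))) (cong (λ a → J (μ ++ 0 ∷ []) (a ∷ π)) size))) ⟩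
      + 1 * removalTerm κ π (μ ++ 0 ∷ [])
        ≡⟨ ℤₚ.*-identityˡ _ ⟩
      removalTerm κ π (μ ++ 0 ∷ []) ∎
      where
      lemma : ∀ s t d → s * (- (s * t) * d) ≡ s * s * (- t * d)
      lemma = solve-∀
      size : a ≡ sum κ ℕ.∸ sum (μ ++ 0 ∷ [])
      size = trans (sym (ℕₚ.m+n∸m≡n (sum μ) a)) (cong₂ ℕ._∸_ sz (sym (sum-snoc-0 μ)))

  -- `specialTabloids` keeps emptied rows as zeros, so its recursion meets padded shapes even when
  -- it starts from a partition.
  J-removals-zeros : ∀ z κ → (∀ π → J κ π ≡ ∑ (removals κ) (removalTerm κ π)) →
    ∀ π → J (κ ++ replicate z 0) π ≡ ∑ (removals (κ ++ replicate z 0)) (removalTerm (κ ++ replicate z 0) π)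
  J-removals-zeros zero    κ eq π = subst (λ κ → J κ π ≡ ∑ (removals κ) (removalTerm κ π))
    (sym (Listₚ.++-identityʳ κ)) (eq π)
  J-removals-zeros (suc z) κ eq π = subst (λ κ → J κ π ≡ ∑ (removals κ) (removalTerm κ π))
    (Listₚ.∷ʳ-++ κ 0 (replicate z 0)) (J-removals-zeros z (κ ++ 0 ∷ []) step π)
    where
    step : ∀ π → J (κ ++ 0 ∷ []) π ≡ ∑ (removals (κ ++ 0 ∷ [])) (removalTerm (κ ++ 0 ∷ []) π)
    step π = trans (J-snoc-0 κ π) (trans (eq π) (trans
      (∑-congᴬ (all-length-removals κ) λ μ len → cong₂ _*_
        (cong (λ r → - sign r) (sym (hookRows-snoc-0 κ μ len)))
        (trans (sym (J-snoc-0 μ _)) (cong₂ (λ a b → J (μ ++ 0 ∷ []) (a ℕ.∸ b ∷ π)) (sym (sum-snoc-0 κ)) (sym (sum-snoc-0 μ)))))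
      (sym (trans (cong (λ xs → ∑ xs (removalTerm (κ ++ 0 ∷ []) π)) (removals-snoc κ)) (∑-map (removals κ) (_++ 0 ∷ []) _)))))

  J-removals : ∀ κ π → decreasingᵇ κ ≡ true → isEmptyShapeᵇ κ ≡ false → sum κ ℕ.≤ n →
    J κ π ≡ ∑ (removals κ) (removalTerm κ π)
  J-removals κ π dec nonempty ≤n with decompose κ dec
  ... | []    , z , pos , dν , refl = contradiction (trans (sym (isEmptyShapeᵇ-zeros z)) nonempty) λ ()
  ... | x ∷ ν , z , pos , dν , refl = J-removals-zeros z (x ∷ ν) (λ π → J-removals-positive x ν π pos dν
        (ℕₚ.≤-trans (ℕₚ.≤-trans (ℕₚ.m≤m+n (sum (x ∷ ν)) _) (ℕₚ.≤-reflexive (sym (ListActₚ.sum-++ (x ∷ ν) (replicate z 0))))) ≤n)) π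

  J-empty : ∀ κ π → decreasingᵇ κ ≡ true → isEmptyShapeᵇ κ ≡ true → J κ π ≡ F π
  J-empty κ π dec empty with decompose κ dec
  ... | []        , z , _       , _ , refl = J-++-zeros [] z π
  ... | zero ∷ ν  , z , () ∷ _  , _ , refl
  ... | suc _ ∷ ν , z , _       , _ , refl = contradiction empty λ ()

  -- The induction needs `π`, the lengths of the hooks removed before. A special hook has at least
  -- one cell, so the size of the shape stays within the decreasing fuel.
  ∑-specialTabloids : ∀ f κ π → decreasingᵇ κ ≡ true → sum κ ℕ.≤ f → sum κ ℕ.≤ n →
    (∑[ T ← specialTabloids f κ ] sign (|W| T) * F (πT T ++ π)) ≡ J κ π
  ∑-specialTabloids f κ π dec ≤f ≤n with isEmptyShapeᵇ κ in empty
  ∑-specialTabloids zero    κ π dec ≤f ≤n | true  =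
    trans (cong (λ e → ∑[ T ← if e then [] ∷ [] else [] ] sign (|W| T) * F (πT T ++ π)) empty)
      (trans (∑-single [] _) (trans (ℤₚ.*-identityˡ (F π)) (sym (J-empty κ π dec empty))))
  ∑-specialTabloids (suc f) κ π dec ≤f ≤n | true  =
    trans (cong (λ e → ∑[ T ← if e then [] ∷ [] else tabs ] sign (|W| T) * F (πT T ++ π)) empty)
      (trans (∑-single [] _) (trans (ℤₚ.*-identityˡ (F π)) (sym (J-empty κ π dec empty))))
    where
    tabs = concatMap (λ μ → map (hookData κ μ ∷_) (specialTabloids f μ)) (specialRemovals κ)
  ∑-specialTabloids zero    κ π dec ≤f ≤n | false = contradiction (trans (sym (sum≡0 κ (ℕₚ.n≤0⇒n≡0 ≤f))) empty) λ ()
    where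
    sum≡0 : ∀ κ → sum κ ≡ 0 → isEmptyShapeᵇ κ ≡ true
    sum≡0 []         e = refl
    sum≡0 (zero ∷ κ) e = sum≡0 κ e
  ∑-specialTabloids (suc f) κ π dec ≤f ≤n | false = begin
    (∑[ T ← if isEmptyShapeᵇ κ then [] ∷ [] else tabs ] sign (|W| T) * F (πT T ++ π))
      ≡⟨ cong (λ e → ∑[ T ← if e then [] ∷ [] else tabs ] sign (|W| T) * F (πT T ++ π)) empty ⟩
    (∑[ T ← tabs ] sign (|W| T) * F (πT T ++ π))
      ≡⟨ ∑-concatMap (specialRemovals κ) _ _ ⟩
    (∑[ μ ← specialRemovals κ ] ∑[ T ← map (hookData κ μ ∷_) (specialTabloids f μ) ] sign (|W| T) * F (πT T ++ π))
      ≡⟨ ∑-cong (specialRemovals κ) (λ μ → trans (∑-map (specialTabloids f μ) (hookData κ μ ∷_) _)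
           (trans (∑-cong (specialTabloids f μ) λ T → trans
             (cong₂ _*_ (sign-|W| (hookData κ μ) T) (F-↭ (↭-sym (↭ₚ.shift (sum κ ℕ.∸ sum μ) (πT T) π))))
             (ℤₚ.*-assoc (- sign (hookRows κ μ)) (sign (|W| T)) _))
             (∑-*ˡ (- sign (hookRows κ μ)) (specialTabloids f μ) _))) ⟩
    (∑[ μ ← specialRemovals κ ] - sign (hookRows κ μ) *
      (∑[ T ← specialTabloids f μ ] sign (|W| T) * F (πT T ++ sum κ ℕ.∸ sum μ ∷ π)))
      ≡⟨ ∑-filter (specialᵇ κ) (below κ) _ ⟩
    (∑[ μ ← below κ ] ⟦ specialᵇ κ μ ⟧ * (- sign (hookRows κ μ) *
      (∑[ T ← specialTabloids f μ ] sign (|W| T) * F (πT T ++ sum κ ℕ.∸ sum μ ∷ π))))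
      ≡⟨ ∑-cong (below κ) (λ μ → ⟦⟧-guard (specialᵇ κ μ) λ e →
           let sp = specialᵇ⁻ κ μ e
               lt = meets⇒sum< κ μ (Special.contained sp) (Special.meets sp)
           in cong (_*_ (- sign (hookRows κ μ))) (∑-specialTabloids f μ _ (Special.decreasing sp)
                (ℕₚ.≤-pred (ℕₚ.≤-trans lt ≤f)) (ℕₚ.≤-trans (ℕₚ.<⇒≤ lt) ≤n))) ⟩
    (∑[ μ ← below κ ] ⟦ specialᵇ κ μ ⟧ * removalTerm κ π μ)
      ≡⟨ ∑-special κ (removalTerm κ π) dec ⟩
    ∑ (removals κ) (removalTerm κ π)
      ≡⟨ J-removals κ π dec empty ≤n ⟨
    J κ π ∎
    where
    open ≡-Reasoning
    tabs = concatMap (λ μ → map (hookData κ μ ∷_) (specialTabloids f μ)) (specialRemovals κ)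

  -- Needed because `F π` also counts sequences with empty blocks: only for positive parts is it
  -- `π^!` times a number of stable partitions.
  πT-positive : ∀ f κ → All (λ T → All (1 ℕ.≤_) (πT T)) (specialTabloids f κ)
  πT-positive zero    κ with isEmptyShapeᵇ κ
  ... | true  = [] ∷ []
  ... | false = []
  πT-positive (suc f) κ with isEmptyShapeᵇ κ
  ... | true  = [] ∷ []
  ... | false = Allₚ.concat⁺ (Allₚ.map⁺ (All.map (λ {μ} e → Allₚ.map⁺ (All.map (λ ps →
          ℕₚ.m<n⇒0<n∸m (let sp = specialᵇ⁻ κ μ e in meets⇒sum< κ μ (Special.contained sp) (Special.meets sp)) ∷ ps)
          (πT-positive f μ)))
          (Allₚ.all-filter (λ μ → specialᵇ κ μ Data.Bool.≟ true) (below κ))))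

-- The Schur expansion of a functional

all-listsOfLen : {A : Set} {P : A → Set} (k : ℕ) {xs : List A} → All P xs → All (All P) (listsOfLen k xs)
all-listsOfLen zero    pxs = [] ∷ []
all-listsOfLen (suc k) pxs = Allₚ.concat⁺ (Allₚ.map⁺ (All.map
  (λ px → Allₚ.map⁺ (All.map (px ∷_) (all-listsOfLen k pxs))) pxs))

-- Of `n + 1` entries with sum at most `n` at least one is zero, so every decreasing list of such
-- size ends with the empty row that `pieri` requires. The common length also gives all determinants
-- the same size.
box : ℕ → List (List ℕ)
box n = listsOfLen (suc n) (upTo (suc n))

all-box : ∀ n → All (λ κ → (length κ ≡ suc n) × All (ℕ._< suc n) κ) (box n)
all-box n = All.zip (all-length-listsOfLen (suc n) (upTo (suc n)) , all-listsOfLen (suc n) (Allₚ.all-upTo (suc n)))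

∑-empty-δ : ∀ k n (g : List ℕ → ℤ) →
  (∑[ κ ← listsOfLen k (upTo (suc n)) ] ⟦ isEmptyShapeᵇ κ ⟧ * g κ) ≡ g (replicate k 0)
∑-empty-δ zero    n g = trans (∑-single [] _) (ℤₚ.*-identityˡ (g []))
∑-empty-δ (suc k) n g = begin
  (∑[ κ ← listsOfLen (suc k) (upTo (suc n)) ] ⟦ isEmptyShapeᵇ κ ⟧ * g κ)
    ≡⟨ trans (∑-listsOfLen k (upTo (suc n)) _) (∑-upTo n _) ⟩
  (∑[ κ ← listsOfLen k (upTo (suc n)) ] ⟦ isEmptyShapeᵇ κ ⟧ * g (0 ∷ κ))
    + (∑[ l ← upTo n ] ∑[ κ ← listsOfLen k (upTo (suc n)) ] + 0 * g (suc l ∷ κ))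
    ≡⟨ cong₂ _+_ (∑-empty-δ k n (λ κ → g (0 ∷ κ)))
         (∑-zero (upTo n) λ l → ∑-zero (listsOfLen k (upTo (suc n))) λ κ → refl) ⟩
  g (0 ∷ replicate k 0) + + 0
    ≡⟨ ℤₚ.+-identityʳ _ ⟩
  g (0 ∷ replicate k 0) ∎
  where open ≡-Reasoning

decreasingᵇ-zeros : ∀ k → decreasingᵇ (replicate k 0) ≡ true
decreasingᵇ-zeros zero          = refl
decreasingᵇ-zeros (suc zero)    = refl
decreasingᵇ-zeros (suc (suc k)) = decreasingᵇ-zeros (suc k)

replicate-snoc : ∀ k → replicate (suc k) 0 ≡ replicate k 0 ++ 0 ∷ []
replicate-snoc zero    = refl
replicate-snoc (suc k) = cong (0 ∷_) (replicate-snoc k)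

decreasingᵇ-map-suc : ∀ r → decreasingᵇ (map suc r) ≡ chainᵇ (λ a b → b ℕ.≤ᵇ a) r
decreasingᵇ-map-suc []          = refl
decreasingᵇ-map-suc (a ∷ [])    = refl
decreasingᵇ-map-suc (a ∷ b ∷ r) = cong₂ _∧_ (suc≤ᵇsuc b a) (decreasingᵇ-map-suc (b ∷ r))

decreasingᵇ≡chainᵇ : ∀ r → decreasingᵇ r ≡ chainᵇ (λ a b → b ℕ.≤ᵇ a) r
decreasingᵇ≡chainᵇ []          = refl
decreasingᵇ≡chainᵇ (a ∷ [])    = refl
decreasingᵇ≡chainᵇ (a ∷ b ∷ r) = cong ((b ℕ.≤ᵇ a) ∧_) (decreasingᵇ≡chainᵇ (b ∷ r))

∑-positive : ∀ k n (g : List ℕ → ℤ) →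
  (∑[ κ ← listsOfLen k (upTo (suc n)) ] ⟦ allᵇ (λ a → 1 ℕ.≤ᵇ a) κ ⟧ * g κ) ≡
  (∑[ r ← listsOfLen k (upTo n) ] g (map suc r))
∑-positive zero    n g = trans (∑-single [] _) (trans (ℤₚ.*-identityˡ (g [])) (sym (∑-single [] _)))
∑-positive (suc k) n g = begin
  (∑[ κ ← listsOfLen (suc k) (upTo (suc n)) ] ⟦ allᵇ (λ a → 1 ℕ.≤ᵇ a) κ ⟧ * g κ)
    ≡⟨ trans (∑-listsOfLen k (upTo (suc n)) _) (∑-upTo n _) ⟩
  (∑[ κ ← listsOfLen k (upTo (suc n)) ] + 0 * g (0 ∷ κ))
    + (∑[ l ← upTo n ] ∑[ κ ← listsOfLen k (upTo (suc n)) ] ⟦ allᵇ (λ a → 1 ℕ.≤ᵇ a) κ ⟧ * g (suc l ∷ κ))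
    ≡⟨ cong₂ _+_ (∑-zero (listsOfLen k (upTo (suc n))) λ κ → refl)
         (∑-cong (upTo n) λ l → ∑-positive k n (λ κ → g (suc l ∷ κ))) ⟩
  + 0 + (∑[ l ← upTo n ] ∑[ r ← listsOfLen k (upTo n) ] g (suc l ∷ map suc r))
    ≡⟨ ℤₚ.+-identityˡ _ ⟩
  (∑[ l ← upTo n ] ∑[ r ← listsOfLen k (upTo n) ] g (suc l ∷ map suc r))
    ≡⟨ ∑-listsOfLen k (upTo n) _ ⟨
  (∑[ r ← listsOfLen (suc k) (upTo n) ] g (map suc r)) ∎
  where open ≡-Reasoning

schurCoeff-++-zeros : ∀ κ z N α → schurCoeff (κ ++ replicate z 0) N α ≡ schurCoeff κ N α
schurCoeff-++-zeros κ zero    N α = cong (λ κ → schurCoeff κ N α) (Listₚ.++-identityʳ κ)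
schurCoeff-++-zeros κ (suc z) N α = trans (cong (λ κ → schurCoeff κ N α) (sym (Listₚ.∷ʳ-++ κ 0 (replicate z 0))))
  (trans (schurCoeff-++-zeros (κ ++ 0 ∷ []) z N α) (schurCoeff-snoc-0 κ N α))

module SchurExpansion
  (n : ℕ) (F : List ℕ → ℤ)
  (F-↭ : ∀ {π ρ} → π ↭ ρ → F π ≡ F ρ)
  (F-0 : ∀ π → F (0 ∷ π) ≡ F π)
  (F-support : ∀ π → ¬ (sum π ≡ n) → F π ≡ + 0)
  where

  open JacobiTrudi n F F-↭ F-0 F-support
  open TabloidExpansion n F F-↭ F-0 F-support

  -- The size brackets single out one degree on each side of `pieri`. Since `J` vanishes in all
  -- other degrees, they may be inserted and removed freely.
  pieri-δ : ∀ μ a π → sum (μ ++ 0 ∷ []) ℕ.+ a ℕ.+ sum π ≡ n → decreasingᵇ (n ∷ μ ++ 0 ∷ []) ≡ true →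
    length (μ ++ 0 ∷ []) ≡ suc n →
    (∑[ κ ← box n ] ⟦ interlaced n (μ ++ 0 ∷ []) κ ⟧ * (⟦ sum (μ ++ 0 ∷ []) ℕ.+ a ℕ.≡ᵇ sum κ ⟧ * J κ π)) ≡
    J (μ ++ 0 ∷ []) (a ∷ π)
  pieri-δ μ a π sz dec len = begin
    (∑[ κ ← box n ] ⟦ interlaced n μ0 κ ⟧ * (⟦ sum μ0 ℕ.+ a ℕ.≡ᵇ sum κ ⟧ * J κ π))
      ≡⟨ ∑-cong (box n) (λ κ → cong (_*_ ⟦ interlaced n μ0 κ ⟧) (redundant (sum μ0 ℕ.+ a ℕ.≡ᵇ sum κ) λ e →
           J-support κ π λ e′ → e (≡ᵇ⁺ (ℕₚ.+-cancelʳ-≡ (sum π) (sum μ0 ℕ.+ a) (sum κ) (trans sz (sym e′)))))) ⟩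
    (∑[ κ ← box n ] ⟦ interlaced n μ0 κ ⟧ * J κ π)
      ≡⟨ cong (λ m → ∑[ κ ← listsOfLen m (upTo (suc n)) ] ⟦ interlaced n μ0 κ ⟧ * J κ π) len ⟨
    (∑[ κ ← listsOfLen (length μ0) (upTo (suc n)) ] ⟦ interlaced n μ0 κ ⟧ * J κ π)
      ≡⟨ pieri μ π dec ⟩
    (∑[ k ← upTo (suc n) ] J μ0 (k ∷ π))
      ≡⟨ ∑-cong (upTo (suc n)) (λ k → redundant (a ℕ.≡ᵇ k) λ e → J-support μ0 (k ∷ π) λ e′ →
           e (≡ᵇ⁺ (ℕₚ.+-cancelʳ-≡ (sum π) a k (ℕₚ.+-cancelˡ-≡ (sum μ0) _ _
             (trans (sym (ℕₚ.+-assoc (sum μ0) a (sum π))) (trans sz (sym e′))))))) ⟨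
    (∑[ k ← upTo (suc n) ] ⟦ a ℕ.≡ᵇ k ⟧ * J μ0 (k ∷ π))
      ≡⟨ ∑-δ (suc n) a _ (s≤s (ℕₚ.≤-trans (ℕₚ.m≤n+m a (sum μ0)) (ℕₚ.≤-trans (ℕₚ.m≤m+n _ (sum π)) (ℕₚ.≤-reflexive sz)))) ⟩
    J μ0 (a ∷ π) ∎
    where
    open ≡-Reasoning
    μ0 = μ ++ 0 ∷ []
    redundant : ∀ b {x} → (¬ (b ≡ true) → x ≡ + 0) → ⟦ b ⟧ * x ≡ x
    redundant true  eq = ℤₚ.*-identityˡ _
    redundant false eq = sym (eq λ ())

  -- Both sides vanish unless `μ` is decreasing and the sizes add up to `n`; in the remaining case
  -- `μ` ends with the zero that `pieri-δ` asks for.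
  pieri-sized : ∀ μ a π → length μ ≡ suc n → All (ℕ._< suc n) μ →
    (∑[ κ ← box n ] ⟦ interlaced n μ κ ⟧ * (⟦ sum μ ℕ.+ a ℕ.≡ᵇ sum κ ⟧ * J κ π)) ≡ ⟦ decreasingᵇ μ ⟧ * J μ (a ∷ π)
  pieri-sized μ a π len μ≤n with decreasingᵇ μ in dec
  ... | false = ∑-zero (box n) λ κ → cong (_* (⟦ sum μ ℕ.+ a ℕ.≡ᵇ sum κ ⟧ * J κ π))
        (⟦⟧-false λ e → contradiction (trans (sym dec) (proj₂ (interlaced⇒decreasingᵇ n κ μ e))) λ ())
  ... | true with sum μ ℕ.+ a ℕ.+ sum π ℕₚ.≟ n
  ...   | no ne = trans (∑-zero (box n) λ κ → trans (cong (_*_ ⟦ interlaced n μ κ ⟧) (trans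
            (⟦⟧-guard (sum μ ℕ.+ a ℕ.≡ᵇ sum κ) λ e → J-support κ π λ e′ →
              ne (trans (cong (ℕ._+ sum π) (≡ᵇ⁻ {sum μ ℕ.+ a} e)) e′))
            (ℤₚ.*-zeroʳ ⟦ sum μ ℕ.+ a ℕ.≡ᵇ sum κ ⟧))) (ℤₚ.*-zeroʳ ⟦ interlaced n μ κ ⟧))
          (sym (trans (ℤₚ.*-identityˡ _) (J-support μ (a ∷ π) λ e → ne (trans (ℕₚ.+-assoc (sum μ) a (sum π)) e))))
  ...   | yes sz with decompose μ dec
  -- Without a zero, `μ` would have `n + 1` positive parts, more than its size allows.
  ...     | ν , zero , pos , _ , eq = contradiction too-long (ℕₚ.<⇒≱ (ℕₚ.n<1+n n))
    where
    μ≡ν : μ ≡ ν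
    μ≡ν = trans eq (Listₚ.++-identityʳ ν)
    too-long : suc n ℕ.≤ n
    too-long = begin
      suc n                     ≡⟨ len ⟨
      length μ                  ≡⟨ cong length μ≡ν ⟩
      length ν                  ≤⟨ length≤sum ν pos ⟩
      sum ν                     ≡⟨ cong sum μ≡ν ⟨
      sum μ                     ≤⟨ ℕₚ.m≤m+n (sum μ) a ⟩
      sum μ ℕ.+ a               ≤⟨ ℕₚ.m≤m+n (sum μ ℕ.+ a) (sum π) ⟩
      sum μ ℕ.+ a ℕ.+ sum π     ≡⟨ sz ⟩
      n                         ∎
      where open ℕₚ.≤-Reasoning
  ...     | ν , suc z , _ , _ , eq = trans
    (subst (λ μ → All (ℕ._< suc n) μ → decreasingᵇ μ ≡ true → sum μ ℕ.+ a ℕ.+ sum π ≡ n → length μ ≡ suc n →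
        (∑[ κ ← box n ] ⟦ interlaced n μ κ ⟧ * (⟦ sum μ ℕ.+ a ℕ.≡ᵇ sum κ ⟧ * J κ π)) ≡ J μ (a ∷ π))
      (sym (trans eq (trans (cong (ν ++_) (replicate-snoc z)) (sym (Listₚ.++-assoc ν (replicate z 0) (0 ∷ []))))))
      (λ μ≤n dec sz len → pieri-δ (ν ++ replicate z 0) a π sz (decreasing-∷ μ≤n dec) len)
      μ≤n dec sz len)
    (sym (ℤₚ.*-identityˡ _))
    where
    decreasing-∷ : ∀ {μ} → All (ℕ._< suc n) μ → decreasingᵇ μ ≡ true → decreasingᵇ (n ∷ μ) ≡ true
    decreasing-∷ []         dec = refl
    decreasing-∷ (m≤n ∷ _)  dec = ∧⁺ (≤ᵇ⁺ (ℕₚ.≤-pred m≤n)) dec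

  -- The list `π` collects the multiplicities of the letters already removed, so that the induction
  -- on `N` can pass them on; with no letters left only the empty shape remains.
  ∑-box-schur : ∀ N (α : Fin N → ℕ) π →
    (∑[ κ ← box n ] ⟦ decreasingᵇ κ ⟧ * (J κ π * + schurCoeff κ N α)) ≡ F (tabulate α ++ π)
  ∑-box-schur zero α π = begin
    (∑[ κ ← box n ] ⟦ decreasingᵇ κ ⟧ * (J κ π * + schurCoeff κ 0 α))
      ≡⟨ ∑-cong (box n) (λ κ → trans (cong (λ e → ⟦ decreasingᵇ κ ⟧ * (J κ π * e)) (schurCoeff-0 κ α))
           (lemma ⟦ decreasingᵇ κ ⟧ (J κ π) ⟦ isEmptyShapeᵇ κ ⟧)) ⟩
    (∑[ κ ← box n ] ⟦ isEmptyShapeᵇ κ ⟧ * (⟦ decreasingᵇ κ ⟧ * J κ π))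
      ≡⟨ ∑-empty-δ (suc n) n _ ⟩
    ⟦ decreasingᵇ (replicate (suc n) 0) ⟧ * J (replicate (suc n) 0) π
      ≡⟨ cong₂ (λ b x → ⟦ b ⟧ * x) (decreasingᵇ-zeros (suc n)) (J-++-zeros [] (suc n) π) ⟩
    + 1 * F π
      ≡⟨ ℤₚ.*-identityˡ (F π) ⟩
    F π ∎
    where
    open ≡-Reasoning
    lemma : ∀ a b c → a * (b * c) ≡ c * (a * b)
    lemma = solve-∀
  ∑-box-schur (suc N) α π = begin
    (∑[ κ ← box n ] ⟦ decreasingᵇ κ ⟧ * (J κ π * + schurCoeff κ (suc N) α))
      ≡⟨ ∑-congᴬ (all-box n) expand ⟩
    (∑[ κ ← box n ] ∑[ μ ← box n ] K μ * (⟦ interlaced n μ κ ⟧ * (⟦ sum μ ℕ.+ a ℕ.≡ᵇ sum κ ⟧ * J κ π)))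
      ≡⟨ ∑-swap (box n) (box n) _ ⟩
    (∑[ μ ← box n ] ∑[ κ ← box n ] K μ * (⟦ interlaced n μ κ ⟧ * (⟦ sum μ ℕ.+ a ℕ.≡ᵇ sum κ ⟧ * J κ π)))
      ≡⟨ ∑-congᴬ (all-box n) (λ μ (len , μ≤n) → trans (∑-*ˡ (K μ) (box n) _) (trans
           (cong (_*_ (K μ)) (pieri-sized μ a π len μ≤n)) (rotate (K μ) ⟦ decreasingᵇ μ ⟧ (J μ (a ∷ π))))) ⟩
    (∑[ μ ← box n ] ⟦ decreasingᵇ μ ⟧ * (J μ (a ∷ π) * K μ))
      ≡⟨ ∑-box-schur N (α ∘ inject₁) (a ∷ π) ⟩
    F (tabulate (α ∘ inject₁) ++ a ∷ π)
      ≡⟨ cong F (trans (cong (_++ π) (tabulate-snoc N α)) (Listₚ.∷ʳ-++ (tabulate (α ∘ inject₁)) a π)) ⟨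
    F (tabulate α ++ π) ∎
    where
    open ≡-Reasoning
    a = α (fromℕ N)
    K : List ℕ → ℤ
    K μ = + schurCoeff μ N (α ∘ inject₁)
    rotate : ∀ x y z → x * (y * z) ≡ y * (z * x)
    rotate = solve-∀
    absorb : ∀ κ μ → ⟦ decreasingᵇ κ ⟧ * ⟦ interlaced n μ κ ⟧ ≡ ⟦ interlaced n μ κ ⟧
    absorb κ μ = trans (ℤₚ.*-comm ⟦ decreasingᵇ κ ⟧ ⟦ interlaced n μ κ ⟧) (trans
      (⟦⟧-guard (interlaced n μ κ) {y = + 1} λ e → cong ⟦_⟧ (proj₁ (interlaced⇒decreasingᵇ n κ μ e)))
      (ℤₚ.*-identityʳ ⟦ interlaced n μ κ ⟧))
    expand : ∀ κ → (length κ ≡ suc n) × All (ℕ._< suc n) κ →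
      ⟦ decreasingᵇ κ ⟧ * (J κ π * + schurCoeff κ (suc N) α) ≡
      (∑[ μ ← box n ] K μ * (⟦ interlaced n μ κ ⟧ * (⟦ sum μ ℕ.+ a ℕ.≡ᵇ sum κ ⟧ * J κ π)))
    expand κ (len , κ≤n) = begin
      ⟦ decreasingᵇ κ ⟧ * (J κ π * + schurCoeff κ (suc N) α)
        ≡⟨ cong (λ e → ⟦ decreasingᵇ κ ⟧ * (J κ π * e)) (trans (schurCoeff-suc n κ N α κ≤n)
             (cong (λ m → ∑[ μ ← listsOfLen m (upTo (suc n)) ] ⟦ interlaced n μ κ ⟧ * (⟦ sum μ ℕ.+ a ℕ.≡ᵇ sum κ ⟧ * K μ)) len)) ⟩
      ⟦ decreasingᵇ κ ⟧ * (J κ π * (∑[ μ ← box n ] ⟦ interlaced n μ κ ⟧ * (⟦ sum μ ℕ.+ a ℕ.≡ᵇ sum κ ⟧ * K μ)))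
        ≡⟨ trans (cong (_*_ ⟦ decreasingᵇ κ ⟧) (sym (∑-*ˡ (J κ π) (box n) _))) (sym (∑-*ˡ ⟦ decreasingᵇ κ ⟧ (box n) _)) ⟩
      (∑[ μ ← box n ] ⟦ decreasingᵇ κ ⟧ * (J κ π * (⟦ interlaced n μ κ ⟧ * (⟦ sum μ ℕ.+ a ℕ.≡ᵇ sum κ ⟧ * K μ))))
        ≡⟨ ∑-cong (box n) (λ μ → trans
             (lemma ⟦ decreasingᵇ κ ⟧ (J κ π) ⟦ interlaced n μ κ ⟧ ⟦ sum μ ℕ.+ a ℕ.≡ᵇ sum κ ⟧ (K μ))
             (cong (λ e → K μ * (e * (⟦ sum μ ℕ.+ a ℕ.≡ᵇ sum κ ⟧ * J κ π))) (absorb κ μ))) ⟩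
      (∑[ μ ← box n ] K μ * (⟦ interlaced n μ κ ⟧ * (⟦ sum μ ℕ.+ a ℕ.≡ᵇ sum κ ⟧ * J κ π))) ∎
      where
      lemma : ∀ d j i s k → d * (j * (i * (s * k))) ≡ k * ((d * i) * (s * j))
      lemma = solve-∀

  ∑-partitionsOf : ∀ N (α : Fin N → ℕ) →
    (∑[ κ ← partitionsOf n ] J κ [] * + schurCoeff κ N α) ≡ F (tabulate α)
  ∑-partitionsOf N α = begin
    ∑ (partitionsOf n) g
      ≡⟨ trans (∑-filter (isPartitionOfᵇ n) _ g) (∑-concatMap (upTo (suc n)) _ _) ⟩
    (∑[ k ← upTo (suc n) ] ∑[ κ ← listsOfLen k (upTo (suc n)) ] ⟦ isPartitionOfᵇ n κ ⟧ * g κ)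
      ≡⟨ ∑-cong (upTo (suc n)) (λ k → trans (∑-cong (listsOfLen k (upTo (suc n))) drop-size)
           (trans (∑-positive k n _) (∑-cong (listsOfLen k (upTo n)) λ r →
             cong (λ b → ⟦ b ⟧ * g (map suc r)) (decreasingᵇ-map-suc r)))) ⟩
    (∑[ k ← upTo (suc n) ] h k)
      ≡⟨ ℤₚ.+-identityʳ _ ⟨
    (∑[ k ← upTo (suc n) ] h k) + + 0
      -- The range is extended by `k = n + 1` to match the number of rows of the box; the new term
      -- is zero because `n + 1` positive parts add up to more than `n`.
      ≡⟨ cong (_+_ (∑[ k ← upTo (suc n) ] h k)) h-top ⟨
    (∑[ k ← upTo (suc n) ] h k) + h (suc n)
      ≡⟨ ∑-upTo-snoc (suc n) h ⟨
    (∑[ k ← upTo (suc (suc n)) ] h k)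
      ≡⟨ ∑-cong (upTo (suc (suc n))) (λ k → ∑-cong (listsOfLen k (upTo n)) λ r →
           cong (_*_ ⟦ chainᵇ (λ a b → b ℕ.≤ᵇ a) r ⟧) (cong₂ (λ x y → x * + y)
             (J-++-zeros (map suc r) (suc n ℕ.∸ k) []) (schurCoeff-++-zeros (map suc r) (suc n ℕ.∸ k) N α))) ⟨
    (∑[ k ← upTo (suc (suc n)) ] ∑[ r ← listsOfLen k (upTo n) ]
      ⟦ chainᵇ (λ a b → b ℕ.≤ᵇ a) r ⟧ * g (map suc r ++ replicate (suc n ℕ.∸ k) 0))
      ≡⟨ ∑-chain-padded (upTo n) (upTo (suc n)) suc 0 (λ a b → b ℕ.≤ᵇ a) (λ a b → b ℕ.≤ᵇ a)
           (λ f → trans (∑-upTo n f) (ℤₚ.+-comm (f 0) _)) (λ a b → suc≤ᵇsuc b a) (λ _ → refl) refl (λ _ → refl) (suc n) g ⟨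
    (∑[ κ ← box n ] ⟦ chainᵇ (λ a b → b ℕ.≤ᵇ a) κ ⟧ * g κ)
      ≡⟨ ∑-cong (box n) (λ κ → cong (λ b → ⟦ b ⟧ * g κ) (decreasingᵇ≡chainᵇ κ)) ⟨
    (∑[ κ ← box n ] ⟦ decreasingᵇ κ ⟧ * g κ)
      ≡⟨ ∑-box-schur N α [] ⟩
    F (tabulate α ++ [])
      ≡⟨ cong F (Listₚ.++-identityʳ (tabulate α)) ⟩
    F (tabulate α) ∎
    where
    open ≡-Reasoning
    g : List ℕ → ℤ
    g κ = J κ [] * + schurCoeff κ N α
    h : ℕ → ℤ
    h k = ∑[ r ← listsOfLen k (upTo n) ] ⟦ chainᵇ (λ a b → b ℕ.≤ᵇ a) r ⟧ * g (map suc r)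
    g-support : ∀ κ → ¬ (sum κ ≡ n) → g κ ≡ + 0
    g-support κ ne = cong (_* + schurCoeff κ N α) (J-support κ [] λ e → ne (trans (sym (ℕₚ.+-identityʳ (sum κ))) e))
    h-top : h (suc n) ≡ + 0
    h-top = trans (∑-congᴬ {f = λ r → ⟦ chainᵇ (λ a b → b ℕ.≤ᵇ a) r ⟧ * g (map suc r)} {g = λ _ → + 0}
      (all-length-listsOfLen (suc n) (upTo n)) λ r len → trans
        (cong (_*_ ⟦ chainᵇ (λ a b → b ℕ.≤ᵇ a) r ⟧) (g-support (map suc r) λ e → ℕₚ.<⇒≱ (ℕₚ.n<1+n n)
          (subst₂ ℕ._≤_ (trans (Listₚ.length-map suc r) len) e (length≤sum (map suc r) (Allₚ.map⁺ (All.universal (λ _ → s≤s z≤n) r))))))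
        (ℤₚ.*-zeroʳ ⟦ chainᵇ (λ a b → b ℕ.≤ᵇ a) r ⟧)) (∑-zero (listsOfLen (suc n) (upTo n)) λ _ → refl)
    drop-size : ∀ κ → ⟦ isPartitionOfᵇ n κ ⟧ * g κ ≡ ⟦ allᵇ (λ a → 1 ℕ.≤ᵇ a) κ ⟧ * (⟦ decreasingᵇ κ ⟧ * g κ)
    drop-size κ = trans (⟦⟧-∧-* (decreasingᵇ κ) _ (g κ)) (trans (cong (_*_ ⟦ decreasingᵇ κ ⟧)
      (trans (⟦⟧-∧-* (allᵇ (λ a → 1 ℕ.≤ᵇ a) κ) (sum κ ℕ.≡ᵇ n) (g κ)) (cong (_*_ ⟦ allᵇ (λ a → 1 ℕ.≤ᵇ a) κ ⟧) sized)))
      (lemma ⟦ decreasingᵇ κ ⟧ ⟦ allᵇ (λ a → 1 ℕ.≤ᵇ a) κ ⟧ (g κ)))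
      where
      lemma : ∀ a b c → a * (b * c) ≡ b * (a * c)
      lemma = solve-∀
      sized : ⟦ sum κ ℕ.≡ᵇ n ⟧ * g κ ≡ g κ
      sized with sum κ ℕₚ.≟ n
      ... | yes e = trans (cong (λ b → ⟦ b ⟧ * g κ) (≡ᵇ⁺ e)) (ℤₚ.*-identityˡ (g κ))
      ... | no ne = trans (cong (_*_ ⟦ sum κ ℕ.≡ᵇ n ⟧) (g-support κ ne)) (trans (ℤₚ.*-zeroʳ ⟦ sum κ ℕ.≡ᵇ n ⟧) (sym (g-support κ ne)))

-- Colourings and stable partitions

countᵇ-↭ : {A : Set} (p : A → Bool) {xs ys : List A} → xs ↭ ys → countᵇ p xs ≡ countᵇ p ys
countᵇ-↭ p ↭.refl                    = refl
countᵇ-↭ p (↭.prep x q)              = cong ((if p x then 1 else 0) ℕ.+_) (countᵇ-↭ p q)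
countᵇ-↭ p (↭.swap {xs} {ys} x y q)  = trans (cong (λ c → a ℕ.+ (b ℕ.+ c)) (countᵇ-↭ p q)) (lemma a b (countᵇ p ys))
  where
  a = if p x then 1 else 0
  b = if p y then 1 else 0
  lemma : ∀ a b c → a ℕ.+ (b ℕ.+ c) ≡ b ℕ.+ (a ℕ.+ c)
  lemma = ℕ-solve-∀
countᵇ-↭ p (↭.trans q r)             = trans (countᵇ-↭ p q) (countᵇ-↭ p r)

countᵇ≤length : {A : Set} (p : A → Bool) (xs : List A) → countᵇ p xs ℕ.≤ length xs
countᵇ≤length p []       = z≤n
countᵇ≤length p (x ∷ xs) with p x
... | true  = s≤s (countᵇ≤length p xs)
... | false = ℕₚ.m≤n⇒m≤1+n (countᵇ≤length p xs)

allᵇ-↭ : {A : Set} (p : A → Bool) {xs ys : List A} → xs ↭ ys → allᵇ p xs ≡ allᵇ p ys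
allᵇ-↭ p q = true-ext (λ e → allᵇ⁺ (↭ₚ.All-resp-↭ q (allᵇ⁻ e)))
                      (λ e → allᵇ⁺ (↭ₚ.All-resp-↭ (↭-sym q) (allᵇ⁻ e)))

module _ {B : Set} where

  Symmetric : (List B → ℤ) → Set
  Symmetric w = ∀ {P Q} → P ↭ Q → w P ≡ w Q

  NoRepeats : (List B → ℤ) → Set
  NoRepeats w = ∀ x P → w (x ∷ x ∷ P) ≡ + 0

  ∷-symmetric : ∀ {w} → Symmetric w → ∀ x → Symmetric (λ P → w (x ∷ P))
  ∷-symmetric w-sym x q = w-sym (↭-prep x q)

  ∷-noRepeats : ∀ {w} → Symmetric w → NoRepeats w → ∀ x → NoRepeats (λ P → w (x ∷ P))
  ∷-noRepeats w-sym w-norep x y P = trans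
    (w-sym (↭-trans (↭-swap x y ↭-refl) (↭-prep y (↭-swap x y ↭-refl)))) (w-norep y (x ∷ P))

  ∑-sublists-∷ : ∀ x xs (f : List B → ℤ) →
    ∑ (sublists (x ∷ xs)) f ≡ (∑[ P ← sublists xs ] f (x ∷ P)) + ∑ (sublists xs) f
  ∑-sublists-∷ x xs f = trans (∑-++ (map (x ∷_) (sublists xs)) (sublists xs) f)
    (cong (_+ ∑ (sublists xs) f) (∑-map (sublists xs) (x ∷_) f))

  -- Double counting of pairs x ∈ P; NoRepeats discards the pairs of x with a sublist that contains it.
  ∑-marked-sublists : ∀ (g : B → ℤ) U (w : List B → ℤ) → Symmetric w → NoRepeats w →
    (∑[ x ← U ] g x * (∑[ P ← sublists U ] w (x ∷ P))) ≡ (∑[ P ← sublists U ] ∑ P g * w P)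
  ∑-marked-sublists g []      w w-sym w-norep = trans (∑-[] _)
    (sym (trans (∑-single [] _) (cong (_* w []) (∑-[] g))))
  ∑-marked-sublists g (y ∷ U) w w-sym w-norep = begin
    (∑[ x ← y ∷ U ] g x * (∑[ P ← sublists (y ∷ U) ] w (x ∷ P)))
      ≡⟨ trans (∑-∷ y U _) (cong₂ _+_
           (cong (_*_ (g y)) (trans (∑-sublists-∷ y U _)
             (trans (cong (_+ S y) (∑-zero (sublists U) λ P → w-norep y P)) (ℤₚ.+-identityˡ (S y)))))
           (trans (∑-cong U λ x → trans (cong (_*_ (g x)) (trans (∑-sublists-∷ y U _)
               (cong (_+ S x) (∑-cong (sublists U) λ P → w-sym (↭-swap x y ↭-refl)))))
               (ℤₚ.*-distribˡ-+ (g x) _ _)) (∑-+ U _ _))) ⟩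
    g y * S y + ((∑[ x ← U ] g x * (∑[ P ← sublists U ] w (y ∷ x ∷ P))) + (∑[ x ← U ] g x * S x))
      ≡⟨ cong (_+_ (g y * S y)) (cong₂ _+_
           (∑-marked-sublists g U (λ P → w (y ∷ P)) (∷-symmetric w-sym y) (∷-noRepeats w-sym w-norep y))
           (∑-marked-sublists g U w w-sym w-norep)) ⟩
    g y * S y + ((∑[ P ← sublists U ] ∑ P g * w (y ∷ P)) + (∑[ P ← sublists U ] ∑ P g * w P))
      ≡⟨ ℤₚ.+-assoc (g y * S y) _ _ ⟨
    g y * S y + (∑[ P ← sublists U ] ∑ P g * w (y ∷ P)) + (∑[ P ← sublists U ] ∑ P g * w P)
      ≡⟨ cong (_+ (∑[ P ← sublists U ] ∑ P g * w P)) (trans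
           (cong (_+ (∑[ P ← sublists U ] ∑ P g * w (y ∷ P))) (sym (∑-*ˡ (g y) (sublists U) _)))
           (trans (sym (∑-+ (sublists U) _ _)) (∑-cong (sublists U) λ P → trans
             (sym (ℤₚ.*-distribʳ-+ (w (y ∷ P)) (g y) (∑ P g))) (cong (_* w (y ∷ P)) (sym (∑-∷ y P g)))))) ⟩
    (∑[ P ← sublists U ] ∑ (y ∷ P) g * w (y ∷ P)) + (∑[ P ← sublists U ] ∑ P g * w P)
      ≡⟨ ∑-sublists-∷ y U _ ⟨
    (∑[ P ← sublists (y ∷ U) ] ∑ P g * w P) ∎
    where
    open ≡-Reasoning
    S : B → ℤ
    S x = ∑[ P ← sublists U ] w (x ∷ P)

-- Sequences of blocks with prescribed sizes

module Sequences {B : Set} (U : List B) (size : B → ℕ) where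

  -- The sum of w over the sequences from U with sizes π.
  seq : List ℕ → (List B → ℤ) → ℤ
  seq []      w = w []
  seq (a ∷ π) w = ∑[ x ← U ] ⟦ size x ℕ.≡ᵇ a ⟧ * seq π (λ P → w (x ∷ P))

  seq-cong : ∀ π {w w′} → (∀ P → map size P ≡ π → w P ≡ w′ P) → seq π w ≡ seq π w′
  seq-cong []      eq = eq [] refl
  seq-cong (a ∷ π) eq = ∑-cong U λ x → ⟦⟧-guard (size x ℕ.≡ᵇ a) λ e →
    seq-cong π λ P e′ → eq (x ∷ P) (cong₂ _∷_ (≡ᵇ⁻ e) e′)

  seq-zero : ∀ π → seq π (λ _ → + 0) ≡ + 0
  seq-zero []      = refl
  seq-zero (a ∷ π) = ∑-zero U λ x → trans (cong (_*_ ⟦ size x ℕ.≡ᵇ a ⟧) (seq-zero π)) (ℤₚ.*-zeroʳ ⟦ size x ℕ.≡ᵇ a ⟧)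

  seq-↭ : ∀ {π ρ} w → Symmetric w → π ↭ ρ → seq π w ≡ seq ρ w
  seq-↭ w w-sym ↭.refl         = refl
  seq-↭ w w-sym (↭.prep a q)   = ∑-cong U λ x → cong (_*_ ⟦ size x ℕ.≡ᵇ a ⟧) (seq-↭ _ (∷-symmetric w-sym x) q)
  seq-↭ w w-sym (↭.swap {π} {ρ} a b q) = begin
    (∑[ x ← U ] ⟦ size x ℕ.≡ᵇ a ⟧ * (∑[ y ← U ] ⟦ size y ℕ.≡ᵇ b ⟧ * seq π (λ P → w (x ∷ y ∷ P))))
      ≡⟨ ∑-cong U (λ x → sym (∑-*ˡ ⟦ size x ℕ.≡ᵇ a ⟧ U _)) ⟩
    (∑[ x ← U ] ∑[ y ← U ] ⟦ size x ℕ.≡ᵇ a ⟧ * (⟦ size y ℕ.≡ᵇ b ⟧ * seq π (λ P → w (x ∷ y ∷ P))))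
      ≡⟨ ∑-swap U U _ ⟩
    (∑[ y ← U ] ∑[ x ← U ] ⟦ size x ℕ.≡ᵇ a ⟧ * (⟦ size y ℕ.≡ᵇ b ⟧ * seq π (λ P → w (x ∷ y ∷ P))))
      ≡⟨ ∑-cong U (λ y → trans (∑-cong U λ x → trans (lemma ⟦ size x ℕ.≡ᵇ a ⟧ ⟦ size y ℕ.≡ᵇ b ⟧ _)
           (cong (λ e → ⟦ size y ℕ.≡ᵇ b ⟧ * (⟦ size x ℕ.≡ᵇ a ⟧ * e))
             (trans (seq-↭ _ (∷-symmetric (∷-symmetric w-sym x) y) q)
                    (seq-cong ρ λ P _ → w-sym (↭-swap x y ↭-refl)))))
           (∑-*ˡ ⟦ size y ℕ.≡ᵇ b ⟧ U _)) ⟩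
    (∑[ y ← U ] ⟦ size y ℕ.≡ᵇ b ⟧ * (∑[ x ← U ] ⟦ size x ℕ.≡ᵇ a ⟧ * seq ρ (λ P → w (y ∷ x ∷ P)))) ∎
    where
    open ≡-Reasoning
    lemma : ∀ a b c → a * (b * c) ≡ b * (a * c)
    lemma = solve-∀
  seq-↭ w w-sym (↭.trans q r)  = trans (seq-↭ w w-sym q) (seq-↭ w w-sym r)

  sizesᵇ : List B → List ℕ → Bool
  sizesᵇ []      []      = true
  sizesᵇ (x ∷ P) (a ∷ π) = (size x ℕ.≡ᵇ a) ∧ sizesᵇ P π
  sizesᵇ _       _       = false

  seq-listsOfLen : ∀ π w → seq π w ≡ ∑[ P ← listsOfLen (length π) U ] ⟦ sizesᵇ P π ⟧ * w P
  seq-listsOfLen []      w = sym (trans (∑-single [] _) (ℤₚ.*-identityˡ (w [])))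
  seq-listsOfLen (a ∷ π) w = trans
    (∑-cong U λ x → trans (cong (_*_ ⟦ size x ℕ.≡ᵇ a ⟧) (seq-listsOfLen π _))
      (trans (sym (∑-*ˡ ⟦ size x ℕ.≡ᵇ a ⟧ (listsOfLen (length π) U) _))
        (∑-cong (listsOfLen (length π) U) λ P → sym (⟦⟧-∧-* (size x ℕ.≡ᵇ a) (sizesᵇ P π) _))))
    (sym (∑-listsOfLen (length π) U _))

-- Multiplicities, their factorials and the type of a set of blocks

mult-sum< : ∀ k π → sum π ℕ.< k → mult k π ≡ 0
mult-sum< k []      lt = refl
mult-sum< k (a ∷ π) lt = cong₂ ℕ._+_
  (cong (if_then 1 else 0) (Boolₚ.¬-not λ e → ℕₚ.<⇒≢ (ℕₚ.≤-trans (s≤s (ℕₚ.m≤m+n a (sum π))) lt) (≡ᵇ⁻ {a} e)))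
  (mult-sum< k π (ℕₚ.≤-trans (s≤s (ℕₚ.m≤n+m (sum π) a)) lt))

mult-head : ∀ a π → mult a (a ∷ π) ≡ suc (mult a π)
mult-head a π = cong (λ b → (if b then 1 else 0) ℕ.+ mult a π) (≡ᵇ⁺ {a} refl)

∏ : ℕ → (ℕ → ℕ) → ℕ
∏ zero    f = 1
∏ (suc k) f = ∏ k f ℕ.* f k

product-upTo : ∀ k f → product (map f (upTo k)) ≡ ∏ k f
product-upTo zero    f = refl
product-upTo (suc k) f = begin
  product (map f (upTo (suc k)))            ≡⟨ cong (product ∘ map f) (Listₚ.upTo-∷ʳ k) ⟨
  product (map f (upTo k ++ k ∷ []))        ≡⟨ cong product (Listₚ.map-++ f (upTo k) (k ∷ [])) ⟩
  product (map f (upTo k) ++ f k ∷ [])      ≡⟨ ListActₚ.product-++ (map f (upTo k)) (f k ∷ []) ⟩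
  product (map f (upTo k)) ℕ.* (f k ℕ.* 1)  ≡⟨ cong₂ ℕ._*_ (product-upTo k f) (ℕₚ.*-identityʳ (f k)) ⟩
  ∏ (suc k) f                               ∎
  where open ≡-Reasoning

∏-cong : ∀ k {f g} → (∀ i → i ℕ.< k → f i ≡ g i) → ∏ k f ≡ ∏ k g
∏-cong zero    eq = refl
∏-cong (suc k) eq = cong₂ ℕ._*_ (∏-cong k λ i i<k → eq i (ℕₚ.m≤n⇒m≤1+n i<k)) (eq k (ℕₚ.n<1+n k))

∏-update : ∀ k j c {f g} → j ℕ.< k → (∀ i → ¬ (i ≡ j) → g i ≡ f i) → g j ≡ c ℕ.* f j → ∏ k g ≡ c ℕ.* ∏ k f
∏-update (suc k) j c {f} {g} j<1+k off on with k ℕₚ.≟ j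
... | yes refl = trans (cong₂ ℕ._*_ (∏-cong k λ i i<k → off i (ℕₚ.<⇒≢ i<k)) on) (lemma (∏ k f) c (f k))
  where
  lemma : ∀ p c f → p ℕ.* (c ℕ.* f) ≡ c ℕ.* (p ℕ.* f)
  lemma = ℕ-solve-∀
... | no k≢j   = trans (cong₂ ℕ._*_ (∏-update k j c (ℕₚ.≤∧≢⇒< (ℕₚ.≤-pred j<1+k) (k≢j ∘ sym)) off on) (off k k≢j))
                       (ℕₚ.*-assoc c (∏ k f) (f k))

multFactorials : List ℕ → ℕ → ℕ
multFactorials π i = (mult (suc i) π) !

-- Every factor beyond `sum π` is `0! = 1`. This makes products over different ranges comparable,
-- since `factorialOfPartition` takes its range from its argument.
∏-factorial : ∀ k π → ∏ (k ℕ.+ sum π) (multFactorials π) ≡ factorialOfPartition π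
∏-factorial zero    π = sym (product-upTo (sum π) (multFactorials π))
∏-factorial (suc k) π = trans (cong₂ ℕ._*_ (∏-factorial k π)
  (cong _! (mult-sum< (suc (k ℕ.+ sum π)) π (s≤s (ℕₚ.m≤n+m (sum π) k))))) (ℕₚ.*-identityʳ _)

-- Only the multiplicity of `a` changes, and `(m + 1)! = (m + 1) · m!`.
factorialOfPartition-∷ : ∀ a π → 1 ℕ.≤ a →
  factorialOfPartition (a ∷ π) ≡ mult a (a ∷ π) ℕ.* factorialOfPartition π
factorialOfPartition-∷ (suc a) π _ = begin
  factorialOfPartition (suc a ∷ π)
    ≡⟨ product-upTo (suc a ℕ.+ sum π) _ ⟩
  ∏ (suc a ℕ.+ sum π) (multFactorials (suc a ∷ π))
    ≡⟨ ∏-update (suc a ℕ.+ sum π) a (mult (suc a) (suc a ∷ π)) (s≤s (ℕₚ.m≤m+n a (sum π)))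
         (λ i i≢a → cong (λ b → ((if b then 1 else 0) ℕ.+ mult (suc i) π) !) (Boolₚ.¬-not λ e → i≢a (sym (≡ᵇ⁻ {a} {i} e))))
         (trans (cong _! (mult-head (suc a) π)) (cong (ℕ._* (mult (suc a) π) !) (sym (mult-head (suc a) π)))) ⟩
  mult (suc a) (suc a ∷ π) ℕ.* ∏ (suc a ℕ.+ sum π) (multFactorials π)
    ≡⟨ cong (mult (suc a) (suc a ∷ π) ℕ.*_) (∏-factorial (suc a) π) ⟩
  mult (suc a) (suc a ∷ π) ℕ.* factorialOfPartition π ∎
  where open ≡-Reasoning

module _ {n : ℕ} where

  blockCount : ℕ → List (Vec Bool n) → ℕ
  blockCount k = countᵇ (λ B → blockSize B ℕ.≡ᵇ k)

  blockSize≤n : (B : Vec Bool n) → blockSize B ℕ.≤ n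
  blockSize≤n B = ℕₚ.≤-trans (countᵇ≤length (lookup B) (allFin n)) (ℕₚ.≤-reflexive (Listₚ.length-tabulate id))

  blockCount-large : ∀ k P → n ℕ.< k → blockCount k P ≡ 0
  blockCount-large k P n<k = countᵇ-none P λ B → Boolₚ.¬-not λ e →
    ℕₚ.<⇒≢ (ℕₚ.≤-trans (s≤s (blockSize≤n B)) n<k) (≡ᵇ⁻ {blockSize B} e)

  HasType : List (Vec Bool n) → List ℕ → Set
  HasType P π = (∀ k → blockCount k P ≡ mult k π) × length P ≡ length π

  -- The test inspects only `k ≤ n + sum π`; no block and no part is larger than that, so beyond it
  -- both counts are zero.
  hasTypeᵇ⁻ : ∀ P π → hasTypeᵇ P π ≡ true → HasType P π
  hasTypeᵇ⁻ P π e with ∧⁻ {allᵇ _ (upTo (suc (n ℕ.+ sum π)))} e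
  ... | c , l = counts , ≡ᵇ⁻ l
    where
    counts : ∀ k → blockCount k P ≡ mult k π
    counts k with k ℕₚ.≤? n ℕ.+ sum π
    ... | yes k≤ = ≡ᵇ⁻ (Allₚ.applyUpTo⁻ id (suc (n ℕ.+ sum π)) (allᵇ⁻ c) (s≤s k≤))
    ... | no k≰  = trans (blockCount-large k P (ℕₚ.≤-trans (s≤s (ℕₚ.m≤m+n n (sum π))) (ℕₚ.≰⇒> k≰)))
                         (sym (mult-sum< k π (ℕₚ.≤-trans (s≤s (ℕₚ.m≤n+m (sum π) n)) (ℕₚ.≰⇒> k≰))))

  hasTypeᵇ⁺ : ∀ P π → HasType P π → hasTypeᵇ P π ≡ true
  hasTypeᵇ⁺ P π (c , l) = ∧⁺ (allᵇ⁺ (All.universal (λ k → ≡ᵇ⁺ (c k)) (upTo (suc (n ℕ.+ sum π))))) (≡ᵇ⁺ l)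

  hasTypeᵇ-∷ : ∀ (x : Vec Bool n) P a π → blockSize x ≡ a → hasTypeᵇ P π ≡ hasTypeᵇ (x ∷ P) (a ∷ π)
  hasTypeᵇ-∷ x P a π refl = true-ext
    (λ e → let c , l = hasTypeᵇ⁻ P π e in hasTypeᵇ⁺ (x ∷ P) (a ∷ π)
       ((λ k → cong ((if a ℕ.≡ᵇ k then 1 else 0) ℕ.+_) (c k)) , cong suc l))
    (λ e → let c , l = hasTypeᵇ⁻ (x ∷ P) (a ∷ π) e in hasTypeᵇ⁺ P π
       ((λ k → ℕₚ.+-cancelˡ-≡ (if a ℕ.≡ᵇ k then 1 else 0) _ _ (c k)) , ℕₚ.suc-injective l))

  hasTypeᵇ-↭ : ∀ {P Q} π → P ↭ Q → hasTypeᵇ P π ≡ hasTypeᵇ Q π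
  hasTypeᵇ-↭ {P} {Q} π q = true-ext (go q) (go (↭-sym q))
    where
    go : ∀ {P Q} → P ↭ Q → hasTypeᵇ P π ≡ true → hasTypeᵇ Q π ≡ true
    go {P} {Q} q e = let c , l = hasTypeᵇ⁻ P π e in hasTypeᵇ⁺ Q π
      ((λ k → trans (sym (countᵇ-↭ _ q)) (c k)) , trans (sym (↭ₚ.↭-length q)) l)

  module _ (U : List (Vec Bool n)) where

    open Sequences U blockSize

    ∑-sublists-[] : ∀ (V : List (Vec Bool n)) (w : List (Vec Bool n) → ℤ) →
      (∑[ P ← sublists V ] ⟦ hasTypeᵇ P [] ⟧ * w P) ≡ w []
    ∑-sublists-[] []      w = trans (∑-single [] _) (trans (cong (λ b → ⟦ b ⟧ * w [])
      (hasTypeᵇ⁺ [] [] ((λ k → refl) , refl))) (ℤₚ.*-identityˡ (w [])))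
    ∑-sublists-[] (x ∷ V) w = trans (∑-sublists-∷ x V _) (trans (cong₂ _+_
      (∑-zero (sublists V) λ P → cong (_* w (x ∷ P)) (⟦⟧-false λ e → contradiction (proj₂ (hasTypeᵇ⁻ (x ∷ P) [] e)) λ ()))
      (∑-sublists-[] V w)) (ℤₚ.+-identityˡ _))

    -- The first block of a sequence marks a block of size `a` in the sublist formed by all its
    -- blocks. A sublist of type `a ∷ π` has `mult a (a ∷ π)` such blocks, and these factors
    -- multiply up to the factorial of the partition.
    seq-sublists : ∀ π (w : List (Vec Bool n) → ℤ) → Symmetric w → NoRepeats w → All (1 ℕ.≤_) π →
      seq π w ≡ + factorialOfPartition π * (∑[ P ← sublists U ] ⟦ hasTypeᵇ P π ⟧ * w P)
    seq-sublists []      w w-sym w-norep [] = sym (trans (ℤₚ.*-identityˡ _) (∑-sublists-[] U w))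
    seq-sublists (a ∷ π) w w-sym w-norep (a≥1 ∷ pos) = begin
      (∑[ x ← U ] ⟦ blockSize x ℕ.≡ᵇ a ⟧ * seq π (λ P → w (x ∷ P)))
        ≡⟨ ∑-cong U (λ x → trans (⟦⟧-guard (blockSize x ℕ.≡ᵇ a) λ e → trans
             (seq-sublists π _ (∷-symmetric w-sym x) (∷-noRepeats w-sym w-norep x) pos)
             (cong (_*_ φ) (∑-cong (sublists U) λ P → cong (λ b → ⟦ b ⟧ * w (x ∷ P)) (hasTypeᵇ-∷ x P a π (≡ᵇ⁻ {blockSize x} {a} e)))))
             (lemma ⟦ blockSize x ℕ.≡ᵇ a ⟧ φ _)) ⟩
      (∑[ x ← U ] φ * (⟦ blockSize x ℕ.≡ᵇ a ⟧ * (∑[ P ← sublists U ] w′ (x ∷ P))))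
        ≡⟨ trans (∑-*ˡ φ U _) (cong (_*_ φ) (∑-marked-sublists (λ x → ⟦ blockSize x ℕ.≡ᵇ a ⟧) U w′ w′-sym w′-norep)) ⟩
      φ * (∑[ P ← sublists U ] (∑[ x ← P ] ⟦ blockSize x ℕ.≡ᵇ a ⟧) * w′ P)
        ≡⟨ cong (_*_ φ) (trans (∑-cong (sublists U) λ P → trans
             (cong (_* w′ P) (sym (∑-countᵇ (λ x → blockSize x ℕ.≡ᵇ a) P))) (trans
             (lemma (+ blockCount a P) ⟦ hasTypeᵇ P (a ∷ π) ⟧ (w P)) (trans
             (⟦⟧-guard (hasTypeᵇ P (a ∷ π)) λ e → cong (λ k → + k * w P) (proj₁ (hasTypeᵇ⁻ P (a ∷ π) e) a))
             (lemma ⟦ hasTypeᵇ P (a ∷ π) ⟧ m (w P)))))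
             (∑-*ˡ m (sublists U) w′)) ⟩
      φ * (m * ∑ (sublists U) w′)
        ≡⟨ lemma₂ φ m _ ⟩
      m * φ * ∑ (sublists U) w′
        ≡⟨ cong (_* ∑ (sublists U) w′) (trans (sym (ℤₚ.pos-* (mult a (a ∷ π)) (factorialOfPartition π)))
             (cong (λ k → + k) (sym (factorialOfPartition-∷ a π a≥1)))) ⟩
      + factorialOfPartition (a ∷ π) * (∑[ P ← sublists U ] ⟦ hasTypeᵇ P (a ∷ π) ⟧ * w P) ∎
      where
      open ≡-Reasoning
      φ = + factorialOfPartition π
      m = + mult a (a ∷ π)
      w′ : List (Vec Bool n) → ℤ
      w′ P = ⟦ hasTypeᵇ P (a ∷ π) ⟧ * w P
      w′-sym : Symmetric w′
      w′-sym q = cong₂ (λ b x → ⟦ b ⟧ * x) (hasTypeᵇ-↭ (a ∷ π) q) (w-sym q)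
      w′-norep : NoRepeats w′
      w′-norep x P = trans (cong (_*_ ⟦ hasTypeᵇ (x ∷ x ∷ P) (a ∷ π) ⟧) (w-norep x P)) (ℤₚ.*-zeroʳ ⟦ hasTypeᵇ (x ∷ x ∷ P) (a ∷ π) ⟧)
      lemma : ∀ a b c → a * (b * c) ≡ b * (a * c)
      lemma = solve-∀
      lemma₂ : ∀ a b c → a * (b * c) ≡ b * a * c
      lemma₂ = solve-∀

-- Covers and the fibres of a colouring

coverᵇ : {n : ℕ} → List (Vec Bool n) → Bool
coverᵇ {n} P = allᵇ (λ v → countᵇ (λ B → lookup B v) P ℕ.≡ᵇ 1) (allFin n)

coverᵇ⁻ : ∀ {n} (P : List (Vec Bool n)) → coverᵇ P ≡ true → ∀ v → countᵇ (λ B → lookup B v) P ≡ 1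
coverᵇ⁻ {n} P e v = ≡ᵇ⁻ (allFinᵇ⁻ {n} {λ v → countᵇ (λ B → lookup B v) P ℕ.≡ᵇ 1} e v)

coverᵇ⁺ : ∀ {n} (P : List (Vec Bool n)) → (∀ v → countᵇ (λ B → lookup B v) P ≡ 1) → coverᵇ P ≡ true
coverᵇ⁺ {n} P e = allFinᵇ⁺ {n} {λ v → countᵇ (λ B → lookup B v) P ℕ.≡ᵇ 1} λ v → ≡ᵇ⁺ (e v)

coverᵇ-cong : ∀ {n} (P Q : List (Vec Bool n)) → (∀ v → countᵇ (λ B → lookup B v) P ≡ countᵇ (λ B → lookup B v) Q) →
              coverᵇ P ≡ coverᵇ Q
coverᵇ-cong P Q eq = true-ext (λ e → coverᵇ⁺ Q λ v → trans (sym (eq v)) (coverᵇ⁻ P e v))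
                              (λ e → coverᵇ⁺ P λ v → trans (eq v) (coverᵇ⁻ Q e v))

sum-countᵇ : {A B : Set} (r : B → A → Bool) (P : List B) (vs : List A) →
  sum (map (λ B → countᵇ (r B) vs) P) ≡ sum (map (λ v → countᵇ (λ B → r B v) P) vs)
sum-countᵇ r []      vs = sym (zeros vs)
  where
  zeros : ∀ vs → sum (map (λ v → 0) vs) ≡ 0
  zeros []       = refl
  zeros (_ ∷ vs) = zeros vs
sum-countᵇ r (B ∷ P) vs = trans (cong (countᵇ (r B) vs ℕ.+_) (sum-countᵇ r P vs)) (sym (split vs))
  where
  lemma : ∀ a b c d → a ℕ.+ b ℕ.+ (c ℕ.+ d) ≡ (a ℕ.+ c) ℕ.+ (b ℕ.+ d)
  lemma = ℕ-solve-∀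
  split : ∀ vs → sum (map (λ v → countᵇ (λ B → r B v) (B ∷ P)) vs) ≡
                 countᵇ (r B) vs ℕ.+ sum (map (λ v → countᵇ (λ B → r B v) P) vs)
  split []       = refl
  split (v ∷ vs) = trans (cong (countᵇ (λ B → r B v) (B ∷ P) ℕ.+_) (split vs))
    (lemma (if r B v then 1 else 0) (countᵇ (λ B → r B v) P) (countᵇ (r B) vs) _)

-- Counts the pairs of a block and a vertex in it, first by blocks and then by vertices, each of
-- which lies in one block.
coverᵇ⇒sizes : ∀ {n} (P : List (Vec Bool n)) → coverᵇ P ≡ true → sum (map blockSize P) ≡ n
coverᵇ⇒sizes {n} P e = trans (sum-countᵇ lookup P (allFin n)) (trans (ones (allFin n)) (Listₚ.length-tabulate id))
  where
  ones : ∀ vs → sum (map (λ v → countᵇ (λ B → lookup B v) P) vs) ≡ length vs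
  ones []       = refl
  ones (v ∷ vs) = cong₂ ℕ._+_ (coverᵇ⁻ P e v) (ones vs)

countᵇ-true⁻ : {A : Set} (p : A → Bool) (xs : List A) → 1 ℕ.≤ countᵇ p xs → ∃ λ x → p x ≡ true
countᵇ-true⁻ p (x ∷ xs) c with p x in eq
... | true  = x , eq
... | false = countᵇ-true⁻ p xs c

∑-allSubsets : ∀ n (f : Vec Bool (suc n) → ℤ) →
  ∑ (allSubsets (suc n)) f ≡ ∑[ b ← true ∷ false ∷ [] ] ∑[ B ← allSubsets n ] f (b ∷ B)
∑-allSubsets n f = trans (∑-concatMap (true ∷ false ∷ []) _ f)
  (∑-cong (true ∷ false ∷ []) λ b → ∑-map (allSubsets n) (b ∷_) f)

∑-bools : (f : Bool → ℤ) → ∑ (true ∷ false ∷ []) f ≡ f true + f false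
∑-bools f = trans (∑-∷ true _ f) (cong (_+_ (f true)) (∑-single false f))

allFin-suc : ∀ n → allFin (suc n) ≡ zero ∷ map suc (allFin n)
allFin-suc n = cong (zero ∷_) (sym (Listₚ.map-tabulate id suc))

blockSize-∷ : ∀ {n} b (B : Vec Bool n) → blockSize (b ∷ B) ≡ (if b then 1 else 0) ℕ.+ blockSize B
blockSize-∷ {n} b B = trans (cong (countᵇ (lookup (b ∷ B))) (allFin-suc n))
  (cong ((if b then 1 else 0) ℕ.+_) (countᵇ-map (lookup (b ∷ B)) suc (allFin n)))

∑-empty-subset : ∀ n (f : Vec Bool n → ℤ) →
  (∑[ B ← allSubsets n ] ⟦ blockSize B ℕ.≡ᵇ 0 ⟧ * f B) ≡ f (Vec.replicate n false)
∑-empty-subset zero    f = trans (∑-single [] _) (ℤₚ.*-identityˡ (f []))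
∑-empty-subset (suc n) f = begin
  (∑[ B ← allSubsets (suc n) ] ⟦ blockSize B ℕ.≡ᵇ 0 ⟧ * f B)
    ≡⟨ trans (∑-allSubsets n _) (∑-bools _) ⟩
  (∑[ B ← allSubsets n ] ⟦ blockSize (true ∷ B) ℕ.≡ᵇ 0 ⟧ * f (true ∷ B))
    + (∑[ B ← allSubsets n ] ⟦ blockSize (false ∷ B) ℕ.≡ᵇ 0 ⟧ * f (false ∷ B))
    ≡⟨ cong₂ _+_ (∑-zero (allSubsets n) λ B → cong (λ k → ⟦ k ℕ.≡ᵇ 0 ⟧ * f (true ∷ B)) (blockSize-∷ true B))
         (trans (∑-cong (allSubsets n) λ B → cong (λ k → ⟦ k ℕ.≡ᵇ 0 ⟧ * f (false ∷ B)) (blockSize-∷ false B))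
           (∑-empty-subset n (λ B → f (false ∷ B)))) ⟩
  + 0 + f (Vec.replicate (suc n) false)
    ≡⟨ ℤₚ.+-identityˡ _ ⟩
  f (Vec.replicate (suc n) false) ∎
  where open ≡-Reasoning

fibers : ∀ {n N} → (Fin n → Fin N) → List (Vec Bool n)
fibers κ = tabulate λ i → Vec.tabulate λ v → κ v ==ᶠ i

zipWith-tabulate : {A B C : Set} (N : ℕ) (h : A → B → C) (f : Fin N → A) (g : Fin N → B) →
  zipWith h (tabulate f) (tabulate g) ≡ tabulate (λ i → h (f i) (g i))
zipWith-tabulate zero    h f g = refl
zipWith-tabulate (suc N) h f g = cong (h (f zero) (g zero) ∷_) (zipWith-tabulate N h (f ∘ suc) (g ∘ suc))

-- A list of `N` subsets is an `N` by `n + 1` matrix of bits; its first column, which tells the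
-- blocks that contain vertex `zero`, is split off.
∑-allSubsets-columns : ∀ n N (f : List (Vec Bool (suc n)) → ℤ) →
  ∑ (listsOfLen N (allSubsets (suc n))) f ≡
  ∑[ b ← listsOfLen N (true ∷ false ∷ []) ] ∑[ P ← listsOfLen N (allSubsets n) ] f (zipWith _∷_ b P)
∑-allSubsets-columns n zero    f = trans (∑-single [] f) (sym (trans (∑-single [] _) (∑-single [] _)))
∑-allSubsets-columns n (suc N) f = begin
  ∑ (listsOfLen (suc N) (allSubsets (suc n))) f
    ≡⟨ trans (∑-listsOfLen N (allSubsets (suc n)) f) (∑-allSubsets n _) ⟩
  (∑[ b ← 𝔹 ] ∑[ B ← allSubsets n ] ∑[ Q ← listsOfLen N (allSubsets (suc n)) ] f ((b ∷ B) ∷ Q))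
    ≡⟨ ∑-cong 𝔹 (λ b → trans (∑-cong (allSubsets n) λ B → ∑-allSubsets-columns n N _)
         (trans (∑-swap (allSubsets n) (listsOfLen N 𝔹) _) (∑-cong (listsOfLen N 𝔹) λ bs →
           sym (∑-listsOfLen N (allSubsets n) _)))) ⟩
  (∑[ b ← 𝔹 ] ∑[ bs ← listsOfLen N 𝔹 ] ∑[ P ← listsOfLen (suc N) (allSubsets n) ] f (zipWith _∷_ (b ∷ bs) P))
    ≡⟨ ∑-listsOfLen N 𝔹 _ ⟨
  (∑[ b ← listsOfLen (suc N) 𝔹 ] ∑[ P ← listsOfLen (suc N) (allSubsets n) ] f (zipWith _∷_ b P)) ∎
  where
  open ≡-Reasoning
  𝔹 = true ∷ false ∷ []

∑-no-true : ∀ N (f : List Bool → ℤ) →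
  (∑[ b ← listsOfLen N (true ∷ false ∷ []) ] ⟦ countᵇ id b ℕ.≡ᵇ 0 ⟧ * f b) ≡ f (tabulate {n = N} (λ _ → false))
∑-no-true zero    f = trans (∑-single [] _) (ℤₚ.*-identityˡ (f []))
∑-no-true (suc N) f = trans (trans (∑-listsOfLen N _ _) (∑-bools _)) (trans
  (cong₂ _+_ (∑-zero (listsOfLen N _) λ b → refl) (∑-no-true N (λ b → f (false ∷ b)))) (ℤₚ.+-identityˡ _))

∑-one-true : ∀ N (f : List Bool → ℤ) →
  (∑[ b ← listsOfLen N (true ∷ false ∷ []) ] ⟦ countᵇ id b ℕ.≡ᵇ 1 ⟧ * f b) ≡
  (∑[ c ← allFin N ] f (tabulate (λ i → c ==ᶠ i)))
∑-one-true zero    f = trans (∑-single [] _) (sym (∑-[] _))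
∑-one-true (suc N) f = begin
  (∑[ b ← listsOfLen (suc N) 𝔹 ] ⟦ countᵇ id b ℕ.≡ᵇ 1 ⟧ * f b)
    ≡⟨ trans (∑-listsOfLen N 𝔹 _) (∑-bools _) ⟩
  (∑[ b ← listsOfLen N 𝔹 ] ⟦ countᵇ id b ℕ.≡ᵇ 0 ⟧ * f (true ∷ b))
    + (∑[ b ← listsOfLen N 𝔹 ] ⟦ countᵇ id b ℕ.≡ᵇ 1 ⟧ * f (false ∷ b))
    ≡⟨ cong₂ _+_ (∑-no-true N (λ b → f (true ∷ b))) (∑-one-true N (λ b → f (false ∷ b))) ⟩
  g zero + (∑[ c ← allFin N ] g (suc c))
    ≡⟨ cong (_+_ (g zero)) (∑-map (allFin N) suc g) ⟨
  g zero + ∑ (map suc (allFin N)) g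
    ≡⟨ trans (cong (λ xs → ∑ xs g) (allFin-suc N)) (∑-∷ zero _ g) ⟨
  ∑ (allFin (suc N)) g ∎
  where
  open ≡-Reasoning
  𝔹 = true ∷ false ∷ []
  g : Fin (suc N) → ℤ
  g c = f (tabulate (λ i → c ==ᶠ i))

coverᵇ-zipWith : ∀ {n} b (P : List (Vec Bool n)) → length b ≡ length P →
  coverᵇ (zipWith _∷_ b P) ≡ (countᵇ id b ℕ.≡ᵇ 1) ∧ coverᵇ P
coverᵇ-zipWith {n} b P len = true-ext
  (λ e → ∧⁺ (≡ᵇ⁺ (trans (sym (count-zero b P len)) (coverᵇ⁻ (zipWith _∷_ b P) e zero)))
            (coverᵇ⁺ P λ v → trans (sym (count-suc b P v len)) (coverᵇ⁻ (zipWith _∷_ b P) e (suc v))))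
  (λ e → coverᵇ⁺ (zipWith _∷_ b P) λ
    { zero    → trans (count-zero b P len) (≡ᵇ⁻ (proj₁ (∧⁻ e)))
    ; (suc v) → trans (count-suc b P v len) (coverᵇ⁻ P (proj₂ (∧⁻ {countᵇ id b ℕ.≡ᵇ 1} e)) v) })
  where
  count-zero : ∀ b (P : List (Vec Bool n)) → length b ≡ length P →
    countᵇ (λ B → lookup B zero) (zipWith _∷_ b P) ≡ countᵇ id b
  count-zero []      []      len = refl
  count-zero (x ∷ b) (B ∷ P) len = cong ((if x then 1 else 0) ℕ.+_) (count-zero b P (ℕₚ.suc-injective len))
  count-suc : ∀ b (P : List (Vec Bool n)) v → length b ≡ length P →
    countᵇ (λ B → lookup B (suc v)) (zipWith _∷_ b P) ≡ countᵇ (λ B → lookup B v) P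
  count-suc []      []      v len = refl
  count-suc (x ∷ b) (B ∷ P) v len = cong ((if lookup B v then 1 else 0) ℕ.+_) (count-suc b P v (ℕₚ.suc-injective len))

-- Colourings correspond to ordered covers, vertex by vertex: the column of a vertex in a cover has
-- exactly one true entry, and its position is the colour.
∑-fibers : ∀ n N (f : List (Vec Bool n) → ℤ) →
  (∑[ κ ← allFuns n N ] f (fibers κ)) ≡ (∑[ P ← listsOfLen N (allSubsets n) ] ⟦ coverᵇ P ⟧ * f P)
∑-fibers zero    N f = trans (∑-single _ _) (sym (trans (singletons N _) (ℤₚ.*-identityˡ _)))
  where
  singletons : ∀ N (g : List (Vec Bool 0) → ℤ) → ∑ (listsOfLen N ([] ∷ [])) g ≡ g (tabulate {n = N} (λ _ → []))
  singletons zero    g = ∑-single [] g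
  singletons (suc N) g = trans (∑-listsOfLen N ([] ∷ []) g) (trans (∑-single [] _) (singletons N (λ P → g ([] ∷ P))))
∑-fibers (suc n) N f = begin
  (∑[ κ ← allFuns (suc n) N ] f (fibers κ))
    ≡⟨ trans (∑-concatMap (allFin N) _ _) (∑-cong (allFin N) λ c → trans (∑-map (allFuns n N) (consF c) _)
         (∑-cong (allFuns n N) λ κ → cong f (sym (zipWith-tabulate N _∷_ (λ i → c ==ᶠ i) (λ i → Vec.tabulate λ v → κ v ==ᶠ i))))) ⟩
  (∑[ c ← allFin N ] ∑[ κ ← allFuns n N ] f (zipWith _∷_ (tabulate (λ i → c ==ᶠ i)) (fibers κ)))
    ≡⟨ ∑-cong (allFin N) (λ c → ∑-fibers n N _) ⟩
  (∑[ c ← allFin N ] ∑[ P ← listsOfLen N (allSubsets n) ] ⟦ coverᵇ P ⟧ * f (zipWith _∷_ (tabulate (λ i → c ==ᶠ i)) P))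
    ≡⟨ ∑-one-true N (λ b → ∑[ P ← listsOfLen N (allSubsets n) ] ⟦ coverᵇ P ⟧ * f (zipWith _∷_ b P)) ⟨
  (∑[ b ← listsOfLen N 𝔹 ] ⟦ countᵇ id b ℕ.≡ᵇ 1 ⟧ * (∑[ P ← listsOfLen N (allSubsets n) ] ⟦ coverᵇ P ⟧ * f (zipWith _∷_ b P)))
    ≡⟨ ∑-congᴬ (all-length-listsOfLen N 𝔹) (λ b len → trans
         (sym (∑-*ˡ ⟦ countᵇ id b ℕ.≡ᵇ 1 ⟧ (listsOfLen N (allSubsets n)) _))
         (∑-congᴬ (all-length-listsOfLen N (allSubsets n)) λ P len′ → trans
           (sym (⟦⟧-∧-* (countᵇ id b ℕ.≡ᵇ 1) (coverᵇ P) _))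
           (cong (λ e → ⟦ e ⟧ * f (zipWith _∷_ b P)) (sym (coverᵇ-zipWith b P (trans len (sym len′))))))) ⟩
  (∑[ b ← listsOfLen N 𝔹 ] ∑[ P ← listsOfLen N (allSubsets n) ] ⟦ coverᵇ (zipWith _∷_ b P) ⟧ * f (zipWith _∷_ b P))
    ≡⟨ ∑-allSubsets-columns n N _ ⟨
  (∑[ P ← listsOfLen N (allSubsets (suc n)) ] ⟦ coverᵇ P ⟧ * f P) ∎
  where
  open ≡-Reasoning
  𝔹 = true ∷ false ∷ []

==ᶠ-refl : ∀ {N} (i : Fin N) → (i ==ᶠ i) ≡ true
==ᶠ-refl i = ≡ᵇ⁺ {toℕ i} refl

not-true : ∀ {b} → (b ≡ true → ⊥) → not b ≡ true
not-true ne = cong not (Boolₚ.¬-not ne)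

-- The functional of a graph

module ColouringsOf {n : ℕ} (G : SimpleGraph n) where

  -- Empty blocks are allowed here: unused colours have empty fibres.
  weight : List (Vec Bool n) → ℤ
  weight P = ⟦ coverᵇ P ∧ allᵇ (isStableᵇ G) P ⟧

  weight-sym : Symmetric weight
  weight-sym {P} {Q} q = cong ⟦_⟧ (cong₂ _∧_ (coverᵇ-cong P Q λ v → countᵇ-↭ (λ B → lookup B v) q) (allᵇ-↭ (isStableᵇ G) q))

  isStableᵇ⁺ : ∀ B → (∀ u v → lookup B u ∧ lookup B v ∧ Adj G u v ≡ true → ⊥) → isStableᵇ G B ≡ true
  isStableᵇ⁺ B ne = allFinᵇ⁺ {n} {λ u → allᵇ (λ v → not (lookup B u ∧ lookup B v ∧ Adj G u v)) (allFin n)} λ u →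
    allFinᵇ⁺ {n} {λ v → not (lookup B u ∧ lookup B v ∧ Adj G u v)} λ v → not-true (ne u v)

  isStableᵇ⁻ : ∀ B → isStableᵇ G B ≡ true → ∀ u v → lookup B u ∧ lookup B v ∧ Adj G u v ≡ true → ⊥
  isStableᵇ⁻ B e u v c = contradiction (trans (sym (allFinᵇ⁻ (allFinᵇ⁻ e u) v)) (cong not c)) λ ()

  open Sequences (allSubsets n) blockSize

  F : List ℕ → ℤ
  F π = seq π weight

  F-↭ : ∀ {π ρ} → π ↭ ρ → F π ≡ F ρ
  F-↭ = seq-↭ weight weight-sym

  lookup-empty : ∀ v → lookup (Vec.replicate n false) v ≡ false
  lookup-empty v = Vecₚ.lookup-replicate v false

  -- The empty set is the only subset of size 0, and adding it affects neither covering nor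
  -- stability.
  F-0 : ∀ π → F (0 ∷ π) ≡ F π
  F-0 π = trans (∑-empty-subset n _) (seq-cong π λ P _ → cong ⟦_⟧ (cong₂ _∧_
    (coverᵇ-cong (∅ ∷ P) P (count P))
    (cong (_∧ allᵇ (isStableᵇ G) P) stable)))
    where
    ∅ = Vec.replicate n false
    count : ∀ P v → countᵇ (λ B → lookup B v) (∅ ∷ P) ≡ countᵇ (λ B → lookup B v) P
    count P v = cong (λ b → (if b then 1 else 0) ℕ.+ countᵇ (λ B → lookup B v) P) (lookup-empty v)
    stable : isStableᵇ G ∅ ≡ true
    stable = isStableᵇ⁺ ∅ λ u v e →
      contradiction (trans (sym (lookup-empty u)) (proj₁ (∧⁻ {lookup ∅ u} e))) λ ()

  F-support : ∀ π → ¬ (sum π ≡ n) → F π ≡ + 0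
  F-support π ne = trans (seq-cong π λ P e → ⟦⟧-false λ c → ne (trans (cong sum (sym e))
    (coverᵇ⇒sizes P (proj₁ (∧⁻ {coverᵇ P} c))))) (seq-zero π)

  partitionWeight : List (Vec Bool n) → ℤ
  partitionWeight P = ⟦ isStablePartitionᵇ G P ⟧

  partitionWeight-sym : Symmetric partitionWeight
  partitionWeight-sym {P} {Q} q = cong ⟦_⟧ (cong₂ _∧_ (allᵇ-↭ _ q) (cong₂ _∧_ (coverᵇ-cong P Q λ v → countᵇ-↭ (λ B → lookup B v) q) (allᵇ-↭ (isStableᵇ G) q)))

  -- A repeated nonempty block covers its vertices twice. `weight` lacks this property, since the
  -- empty set may repeat in it.
  partitionWeight-noRepeats : NoRepeats partitionWeight
  partitionWeight-noRepeats x P = ⟦⟧-false λ e →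
    let ne , rest = ∧⁻ {allᵇ (λ B → 1 ℕ.≤ᵇ blockSize B) (x ∷ x ∷ P)} e
        v , xv    = countᵇ-true⁻ (lookup x) (allFin n) (≤ᵇ⁻ {1} (proj₁ (∧⁻ {1 ℕ.≤ᵇ blockSize x} ne)))
        once      = coverᵇ⁻ (x ∷ x ∷ P) (proj₁ (∧⁻ {coverᵇ (x ∷ x ∷ P)} rest)) v
    in contradiction (trans (sym once) (cong (λ b → (if b then 1 else 0) ℕ.+ ((if b then 1 else 0) ℕ.+ countᵇ (λ B → lookup B v) P)) xv)) λ ()

  F-stablePartitions : ∀ π → All (1 ℕ.≤_) π → F π ≡ + (factorialOfPartition π ℕ.* stablePartitionCount G π)
  F-stablePartitions π pos = begin
    seq π weight
      -- Since the sizes in `π` are positive, the nonemptiness test holds for every sequence that is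
      -- counted.
      ≡⟨ seq-cong π (λ P e → cong ⟦_⟧ (cong (_∧ (coverᵇ P ∧ allᵇ (isStableᵇ G) P)) (sym (nonempty P e)))) ⟩
    seq π partitionWeight
      ≡⟨ seq-sublists (allSubsets n) π partitionWeight partitionWeight-sym partitionWeight-noRepeats pos ⟩
    + factorialOfPartition π * (∑[ P ← sublists (allSubsets n) ] ⟦ hasTypeᵇ P π ⟧ * partitionWeight P)
      ≡⟨ cong (_*_ (+ factorialOfPartition π)) (trans (∑-cong (sublists (allSubsets n)) λ P → trans
           (ℤₚ.*-comm ⟦ hasTypeᵇ P π ⟧ (partitionWeight P)) (sym (⟦⟧-∧ (isStablePartitionᵇ G P) (hasTypeᵇ P π))))
           (sym (∑-countᵇ _ (sublists (allSubsets n))))) ⟩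
    + factorialOfPartition π * + stablePartitionCount G π
      ≡⟨ ℤₚ.pos-* (factorialOfPartition π) (stablePartitionCount G π) ⟨
    + (factorialOfPartition π ℕ.* stablePartitionCount G π) ∎
    where
    open ≡-Reasoning
    nonempty : ∀ P → map blockSize P ≡ π → allᵇ (λ B → 1 ℕ.≤ᵇ blockSize B) P ≡ true
    nonempty P refl = allᵇ⁺ (All.map ≤ᵇ⁺ (Allₚ.map⁻ pos))

  sizesᵇ-tabulate : ∀ N (f : Fin N → Vec Bool n) (α : Fin N → ℕ) →
    sizesᵇ (tabulate f) (tabulate α) ≡ allᵇ (λ i → blockSize (f i) ℕ.≡ᵇ α i) (allFin N)
  sizesᵇ-tabulate N f α = true-ext (λ e → allFinᵇ⁺ (to N f α e)) (λ e → from N f α (allFinᵇ⁻ e))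
    where
    to : ∀ N (f : Fin N → Vec Bool n) (α : Fin N → ℕ) → sizesᵇ (tabulate f) (tabulate α) ≡ true →
         ∀ i → (blockSize (f i) ℕ.≡ᵇ α i) ≡ true
    to (suc N) f α e zero    = proj₁ (∧⁻ e)
    to (suc N) f α e (suc i) = to N (f ∘ suc) (α ∘ suc) (proj₂ (∧⁻ {blockSize (f zero) ℕ.≡ᵇ α zero} e)) i
    from : ∀ N (f : Fin N → Vec Bool n) (α : Fin N → ℕ) → (∀ i → (blockSize (f i) ℕ.≡ᵇ α i) ≡ true) →
           sizesᵇ (tabulate f) (tabulate α) ≡ true
    from zero    f α e = refl
    from (suc N) f α e = ∧⁺ (e zero) (from N (f ∘ suc) (α ∘ suc) (e ∘ suc))

  hasContentᵇ-fibers : ∀ {N} (κ : Fin n → Fin N) α → hasContentᵇ κ α ≡ sizesᵇ (fibers κ) (tabulate α)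
  hasContentᵇ-fibers {N} κ α = sym (trans (sizesᵇ-tabulate N _ α) (true-ext
    (λ e → allFinᵇ⁺ λ i → trans (cong (ℕ._≡ᵇ α i) (sym (size i))) (allFinᵇ⁻ e i))
    (λ e → allFinᵇ⁺ λ i → trans (cong (ℕ._≡ᵇ α i) (size i)) (allFinᵇ⁻ e i))))
    where
    size : ∀ i → blockSize (Vec.tabulate λ v → κ v ==ᶠ i) ≡ countᵇ (λ v → κ v ==ᶠ i) (allFin n)
    size i = countᵇ-cong (allFin n) (Vecₚ.lookup∘tabulate (λ v → κ v ==ᶠ i))

  -- A monochromatic edge is an edge inside the fibre of its colour.
  properᵇ-fibers : ∀ {N} (κ : Fin n → Fin N) → properᵇ G κ ≡ allᵇ (isStableᵇ G) (fibers κ)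
  properᵇ-fibers {N} κ = true-ext
    (λ e → allᵇ⁺ (Allₚ.tabulate⁺ λ i → isStableᵇ⁺ (fiber i) λ u v c →
      let Bu , rest = ∧⁻ {lookup (fiber i) u} c
          Bv , adj  = ∧⁻ {lookup (fiber i) v} rest
          κu≡i      = ≡ᵇ⁻ {toℕ (κ u)} (trans (sym (Vecₚ.lookup∘tabulate _ u)) Bu)
          κv≡i      = ≡ᵇ⁻ {toℕ (κ v)} (trans (sym (Vecₚ.lookup∘tabulate _ v)) Bv)
      in contradiction (trans (sym (allFinᵇ⁻ (allFinᵇ⁻ e u) v))
           (cong not (∧⁺ adj (≡ᵇ⁺ {toℕ (κ u)} (trans κu≡i (sym κv≡i)))))) λ ()))
    (λ e → allFinᵇ⁺ λ u → allFinᵇ⁺ λ v → not-true λ c →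
      let adj , same = ∧⁻ {Adj G u v} c
          Bu         = trans (Vecₚ.lookup∘tabulate (λ v → κ v ==ᶠ κ u) u) (==ᶠ-refl (κ u))
          Bv         = trans (Vecₚ.lookup∘tabulate (λ v → κ v ==ᶠ κ u) v) (≡ᵇ⁺ {toℕ (κ v)} (sym (≡ᵇ⁻ {toℕ (κ u)} same)))
      in isStableᵇ⁻ (fiber (κ u)) (Allₚ.tabulate⁻ (allᵇ⁻ e) (κ u)) u v (∧⁺ Bu (∧⁺ Bv adj)))
    where
    fiber : Fin N → Vec Bool n
    fiber i = Vec.tabulate λ v → κ v ==ᶠ i

  F-chromCoeff : ∀ N (α : Fin N → ℕ) → + chromCoeff G N α ≡ F (tabulate α)
  F-chromCoeff N α = begin
    + chromCoeff G N α
      ≡⟨ ∑-countᵇ _ (allFuns n N) ⟩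
    (∑[ κ ← allFuns n N ] ⟦ properᵇ G κ ∧ hasContentᵇ κ α ⟧)
      ≡⟨ ∑-cong (allFuns n N) (λ κ → cong ⟦_⟧ (cong₂ _∧_ (properᵇ-fibers κ) (hasContentᵇ-fibers κ α))) ⟩
    (∑[ κ ← allFuns n N ] ⟦ allᵇ (isStableᵇ G) (fibers κ) ∧ sizesᵇ (fibers κ) (tabulate α) ⟧)
      ≡⟨ ∑-fibers n N (λ P → ⟦ allᵇ (isStableᵇ G) P ∧ sizesᵇ P (tabulate α) ⟧) ⟩
    (∑[ P ← listsOfLen N (allSubsets n) ] ⟦ coverᵇ P ⟧ * ⟦ allᵇ (isStableᵇ G) P ∧ sizesᵇ P (tabulate α) ⟧)
      ≡⟨ ∑-cong (listsOfLen N (allSubsets n)) (λ P → trans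
           (cong (_*_ ⟦ coverᵇ P ⟧) (⟦⟧-∧ (allᵇ (isStableᵇ G) P) (sizesᵇ P (tabulate α))))
           (trans (lemma ⟦ coverᵇ P ⟧ ⟦ allᵇ (isStableᵇ G) P ⟧ ⟦ sizesᵇ P (tabulate α) ⟧)
             (cong (_*_ ⟦ sizesᵇ P (tabulate α) ⟧) (sym (⟦⟧-∧ (coverᵇ P) (allᵇ (isStableᵇ G) P)))))) ⟩
    (∑[ P ← listsOfLen N (allSubsets n) ] ⟦ sizesᵇ P (tabulate α) ⟧ * weight P)
      ≡⟨ cong (λ k → ∑[ P ← listsOfLen k (allSubsets n) ] ⟦ sizesᵇ P (tabulate α) ⟧ * weight P) (Listₚ.length-tabulate α) ⟨
    (∑[ P ← listsOfLen (length (tabulate α)) (allSubsets n) ] ⟦ sizesᵇ P (tabulate α) ⟧ * weight P)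
      ≡⟨ seq-listsOfLen (tabulate α) weight ⟨
    F (tabulate α) ∎
    where
    open ≡-Reasoning
    lemma : ∀ a b c → a * (b * c) ≡ c * (a * b)
    lemma = solve-∀

all-partitionsOf : ∀ n → All (λ κ → isPartitionOfᵇ n κ ≡ true) (partitionsOf n)
all-partitionsOf n = Allₚ.all-filter (λ κ → isPartitionOfᵇ n κ Data.Bool.≟ true)
  (concatMap (λ k → listsOfLen k (upTo (suc n))) (upTo (suc n)))

theorem3p1 : (n : ℕ) (G : SimpleGraph n) (N : ℕ) (α : Fin N → ℕ) →
    + chromCoeff G N α
    ≡ sumℤ (map (λ λ' → claimedCoeff G λ' * + schurCoeff λ' N α) (partitionsOf n))
theorem3p1 n G N α = begin
  + chromCoeff G N α
    ≡⟨ F-chromCoeff N α ⟩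
  F (tabulate α)
    ≡⟨ ∑-partitionsOf N α ⟨
  (∑[ κ ← partitionsOf n ] J κ [] * + schurCoeff κ N α)
    ≡⟨ ∑-congᴬ (all-partitionsOf n) (λ κ p → cong (_* + schurCoeff κ N α) (claimed κ p)) ⟨
  (∑[ κ ← partitionsOf n ] claimedCoeff G κ * + schurCoeff κ N α)
    ≡⟨ ∑-def (partitionsOf n) _ ⟨
  sumℤ (map (λ κ → claimedCoeff G κ * + schurCoeff κ N α) (partitionsOf n)) ∎
  where
  open ≡-Reasoning
  open ColouringsOf G
  open JacobiTrudi n F F-↭ F-0 F-support
  open TabloidExpansion n F F-↭ F-0 F-support
  open SchurExpansion n F F-↭ F-0 F-support
  claimed : ∀ κ → isPartitionOfᵇ n κ ≡ true → claimedCoeff G κ ≡ J κ []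
  claimed κ p = begin
    claimedCoeff G κ
      ≡⟨ ∑-def (𝒯 κ) _ ⟩
    (∑[ T ← 𝒯 κ ] sign (|W| T) * + (factorialOfPartition (πT T) ℕ.* stablePartitionCount G (πT T)))
      ≡⟨ ∑-congᴬ (πT-positive (sum κ) κ) (λ T pos → cong (_*_ (sign (|W| T))) (trans
           (cong F (Listₚ.++-identityʳ (πT T))) (F-stablePartitions (πT T) pos))) ⟨
    (∑[ T ← 𝒯 κ ] sign (|W| T) * F (πT T ++ []))
      ≡⟨ ∑-specialTabloids (sum κ) κ [] (proj₁ (∧⁻ p)) ℕₚ.≤-refl (ℕₚ.≤-reflexive size) ⟩
    J κ [] ∎
    where
    size : sum κ ≡ n
    size = ≡ᵇ⁻ (proj₂ (∧⁻ {allᵇ (λ a → 1 ℕ.≤ᵇ a) κ} (proj₂ (∧⁻ {decreasingᵇ κ} p))))
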